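{- Let $n\geq 3$ be an integer, let $C_n=\langle x\rangle$ be the cyclic group of order $n$ with identity $e$, and let $X\subseteq C_n\setminus\{e\}$. The dihedrant $Dih(n,X,X)$ is a DSRG with parameters $(2n,2|X|,\mu,\lambda,t)$ if and only if one of the following holds: (a) Let $v=\frac{n}{\mu-\lambda}$. There exists a subset $T$ of $\{x,x^2,\dots,x^{v-1}\}$ satisfying (i) $X=T\langle x^v\rangle$; (ii) $X\cup X^{(-1)}=C_n\setminus\langle x^v\rangle$. (b) Let $v=\frac{n}{\mu-\lambda}$. There exists a subset $T'$ of $\{x,x^2,\dots,x^{2v-1}\}$ satisfying (i) $X=T'\langle x^{2v}\rangle$; (ii) $X\uplus X^{(-1)}=(C_n\setminus\langle x^{2v}\rangle)\uplus x^v\langle x^{2v}\rangle$; (iii) $X\cup x^vX=C_n$.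
   Context: A directed graph on $N$ vertices with adjacency matrix $A$ is a directed strongly regular graph (DSRG) with parameters $(N,k,\mu,\lambda,t)$ if $JA=AJ=kJ$ and $A^2=tI+\lambda A+\mu(J-I-A)$, where $I$ is the identity matrix and $J$ the all-ones matrix. All DSRGs are assumed genuine, i.e. $0<t<k$. For a finite group $G$ with identity $e$ and $S\subseteq G\setminus\{e\}$, $\mathbf{Cay}(G,S)$ is the digraph with vertex set $G$ and an arc $g\to h$ if and only if $g^{ -1}h\in S$. The dihedral group is $D_n=\langle x,\tau\mid x^n=1,\tau^2=1,\tau x=x^{ -1}\tau\rangle$, with $C_n=\langle x\rangle\leq D_n$. For $X,Y\subseteq C_n$, $Dih(n,X,Y)=\mathbf{Cay}(D_n,X\cup Y\tau)$; Cayley graphs on dihedral groups are called dihedrants. $X^{(-1)}=\{g^{ -1}:g\in X\}$. For sets, $\cup$ and $\setminus$ denote the usual union and difference; $\uplus$ denotes the multiset union, in which multiplicities add. For a divisor $w$ of $n$ and a subset $T$ of $\{e,x,\dots,x^{w-1}\}$, $T\langle x^w\rangle$ is the union of the cosets $s\langle x^w\rangle$ with $s\in T$.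
   Formalization: In (a) the sets X and X^(-1) are also required to be disjoint (else n=v=5, X={x,x^2,x^3} is a counterexample), v>1 is required since v=1 never gives 0<t<k, and "DSRG with parameters" means: for some μ, λ, t with the given difference μ-λ. -}

module Defs where

open import Algebra.Bundles using (AbelianGroup)
open import Algebra.Structures using (IsGroup; IsAbelianGroup)
open import Data.Bool.Base using (Bool; if_then_else_)
open import Data.Fin.Base using (Fin; toℕ)
open import Data.Fin.Patterns using (0F; 1F)
open import Data.Fin.Properties using (_≟_; any?; *↔×; toℕ-fromℕ<; toℕ<n; toℕ-injective)
open import Data.Fin.Subset using (Subset; _∈_; _∪_; _∩_; _─_) renaming (⊤ to full; ⊥ to ∅)
open import Data.Fin.Subset.Properties using (_∈?_)
open import Data.Integer.Base as ℤ using (ℤ; +_; 0ℤ; 1ℤ)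
import Data.Integer.Properties as ℤ
open import Data.Nat.Base as ℕ using (ℕ; NonZero; _<_; _≤_; _∸_)
open import Data.Nat.Divisibility using (_∣_)
open import Data.Nat.DivMod
  using (_%_; _mod_; m%n<n; n%n≡0; m<n⇒m%n≡m; %-distribˡ-+)
import Data.Nat.Properties as ℕ
open import Data.Product.Base using (∃-syntax; _×_; _,_)
open import Data.Vec.Base using (lookup; tabulate)
open import Function.Bundles using (_↔_; mk↔ₛ′; module Inverse)
open import Function.Construct.Composition using (_↔-∘_)
open import Level using (0ℓ)
open import Relation.Binary.PropositionalEquality
  using (_≡_; refl; sym; trans; cong; cong₂; isEquivalence; module ≡-Reasoning)
open import Relation.Nullary.Decidable using (does; _×-dec_)
open import Algebra.Properties.CommutativeMonoid.Sum ℤ.+-0-commutativeMonoid using (sum)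

------------------------------------------------------------------------
-- Directed strongly regular graphs

record Digraph (N : ℕ) : Set₁ where
  field
    Vertex : Set
    enum   : Fin N ↔ Vertex
    arc    : Vertex → Vertex → Bool

module Matrices {N : ℕ} (Γ : Digraph N) where
  open Digraph Γ

  infix  4 _≋_
  infixl 6 _⊕_ _⊖_
  infixr 7 _•_
  infixl 8 _⊗_

  Matrix : Set
  Matrix = Vertex → Vertex → ℤ

  _≋_ : Matrix → Matrix → Set
  M ≋ M′ = ∀ g h → M g h ≡ M′ g h

  _⊕_ _⊖_ _⊗_ : Matrix → Matrix → Matrix
  (M ⊕ M′) g h = M g h ℤ.+ M′ g h
  (M ⊖ M′) g h = M g h ℤ.- M′ g h
  (M ⊗ M′) g h = sum λ i → M g (Inverse.to enum i) ℤ.* M′ (Inverse.to enum i) h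

  _•_ : ℕ → Matrix → Matrix
  (c • M) g h = + c ℤ.* M g h

  J I A : Matrix
  J g h = 1ℤ
  I g h = if does (Inverse.from enum g ≟ Inverse.from enum h) then 1ℤ else 0ℤ
  A g h = if arc g h then 1ℤ else 0ℤ

-- The parameters are (N, k, μ, lam, t); the first one is the index of Γ.
-- The bounds on t say that the graph is genuine.
record IsDSRG {N : ℕ} (Γ : Digraph N) (k μ lam t : ℕ) : Set where
  open Matrices Γ
  field
    JA  : J ⊗ A ≋ k • J
    AJ  : A ⊗ J ≋ k • J
    A²  : A ⊗ A ≋ t • I ⊕ lam • A ⊕ μ • (J ⊖ I ⊖ A)
    0<t : 0 < t
    t<k : t < k

------------------------------------------------------------------------
-- Cayley digraphs

record FiniteGroup (N : ℕ) : Set₁ where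
  infixl 7 _∙_
  infix  8 _⁻¹
  field
    Carrier : Set
    _∙_     : Carrier → Carrier → Carrier
    ε       : Carrier
    _⁻¹     : Carrier → Carrier
    isGroup : IsGroup _≡_ _∙_ ε _⁻¹
    enum    : Fin N ↔ Carrier

Cay : ∀ {N} (G : FiniteGroup N) → (FiniteGroup.Carrier G → Bool) → Digraph N
Cay G S = record
  { Vertex = Carrier
  ; enum   = enum
  ; arc    = λ g h → S (g ⁻¹ ∙ h)
  } where open FiniteGroup G

------------------------------------------------------------------------
-- The cyclic group Cₙ = ⟨ x ⟩: the index i : Fin n stands for xⁱ.

module Cyclic (n : ℕ) .{{_ : NonZero n}} where

  infixl 7 _∙_
  infix  8 _⁻¹

  x^_ : ℕ → Fin n
  x^ i = i mod n

  _∙_ : Fin n → Fin n → Fin n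
  g ∙ h = x^ (toℕ g ℕ.+ toℕ h)

  e : Fin n
  e = x^ 0

  _⁻¹ : Fin n → Fin n
  g ⁻¹ = x^ (n ∸ toℕ g)

  private
    toℕ-x^ : ∀ i → toℕ (x^ i) ≡ i % n
    toℕ-x^ i = toℕ-fromℕ< (m%n<n i n)

    x^-cong : ∀ {i j} → i % n ≡ j % n → x^ i ≡ x^ j
    x^-cong {i} {j} eq = toℕ-injective (trans (toℕ-x^ i) (trans eq (sym (toℕ-x^ j))))

    x^-toℕ : ∀ g → x^ toℕ g ≡ g
    x^-toℕ g = toℕ-injective (trans (toℕ-x^ (toℕ g)) (m<n⇒m%n≡m (toℕ<n g)))

  x^-+ : ∀ i j → x^ (i ℕ.+ j) ≡ x^ i ∙ x^ j
  x^-+ i j = x^-cong (trans (%-distribˡ-+ i j n)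
    (sym (cong₂ (λ a b → (a ℕ.+ b) % n) (toℕ-x^ i) (toℕ-x^ j))))

  x^n≡e : x^ n ≡ e
  x^n≡e = x^-cong (trans (n%n≡0 n) (sym (m<n⇒m%n≡m (ℕ.>-nonZero⁻¹ n))))

  ∙-comm : ∀ g h → g ∙ h ≡ h ∙ g
  ∙-comm g h = cong x^_ (ℕ.+-comm (toℕ g) (toℕ h))

  ∙-assoc : ∀ g h k → (g ∙ h) ∙ k ≡ g ∙ (h ∙ k)
  ∙-assoc g h k = begin
    (g ∙ h) ∙ k                          ≡⟨ cong (g ∙ h ∙_) (x^-toℕ k) ⟨
    x^ (toℕ g ℕ.+ toℕ h) ∙ x^ toℕ k      ≡⟨ x^-+ (toℕ g ℕ.+ toℕ h) (toℕ k) ⟨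
    x^ (toℕ g ℕ.+ toℕ h ℕ.+ toℕ k)       ≡⟨ cong x^_ (ℕ.+-assoc (toℕ g) (toℕ h) (toℕ k)) ⟩
    x^ (toℕ g ℕ.+ (toℕ h ℕ.+ toℕ k))     ≡⟨ x^-+ (toℕ g) (toℕ h ℕ.+ toℕ k) ⟩
    x^ toℕ g ∙ (h ∙ k)                   ≡⟨ cong (_∙ (h ∙ k)) (x^-toℕ g) ⟩
    g ∙ (h ∙ k)                          ∎
    where open ≡-Reasoning

  ∙-identityˡ : ∀ g → e ∙ g ≡ g
  ∙-identityˡ g = begin
    e ∙ g            ≡⟨ cong (e ∙_) (x^-toℕ g) ⟨
    x^ 0 ∙ x^ toℕ g  ≡⟨ x^-+ 0 (toℕ g) ⟨
    x^ toℕ g         ≡⟨ x^-toℕ g ⟩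
    g                ∎
    where open ≡-Reasoning

  ⁻¹-inverseˡ : ∀ g → g ⁻¹ ∙ g ≡ e
  ⁻¹-inverseˡ g = begin
    g ⁻¹ ∙ g                  ≡⟨ cong (g ⁻¹ ∙_) (x^-toℕ g) ⟨
    g ⁻¹ ∙ x^ toℕ g           ≡⟨ x^-+ (n ∸ toℕ g) (toℕ g) ⟨
    x^ (n ∸ toℕ g ℕ.+ toℕ g)  ≡⟨ cong x^_ (ℕ.m∸n+n≡m (ℕ.<⇒≤ (toℕ<n g))) ⟩
    x^ n                      ≡⟨ x^n≡e ⟩
    e                         ∎
    where open ≡-Reasoning

  ∙-isGroup : IsGroup _≡_ _∙_ e _⁻¹
  ∙-isGroup = record
    { isMonoid = record
      { isSemigroup = record
        { isMagma = record { isEquivalence = isEquivalence ; ∙-cong = cong₂ _∙_ }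
        ; assoc   = ∙-assoc
        }
      ; identity = ∙-identityˡ , λ g → trans (∙-comm g e) (∙-identityˡ g)
      }
    ; inverse = ⁻¹-inverseˡ , λ g → trans (∙-comm g (g ⁻¹)) (⁻¹-inverseˡ g)
    ; ⁻¹-cong = cong _⁻¹
    }

  ∙-isAbelianGroup : IsAbelianGroup _≡_ _∙_ e _⁻¹
  ∙-isAbelianGroup = record { isGroup = ∙-isGroup ; comm = ∙-comm }

  abelianGroup : AbelianGroup 0ℓ 0ℓ
  abelianGroup = record { isAbelianGroup = ∙-isAbelianGroup }

  ----------------------------------------------------------------------
  -- Subsets and multisets of Cₙ

  image : (Fin n → Fin n) → Subset n → Subset n
  image f X = tabulate λ h → does (any? λ g → (g ∈? X) ×-dec (f g ≟ h))

  _⁽⁻¹⁾ : Subset n → Subset n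
  X ⁽⁻¹⁾ = image _⁻¹ X

  _·_ : Fin n → Subset n → Subset n
  g · X = image (g ∙_) X

  -- The exponents 0, …, n - 1 already give all powers of x ^ w.
  ⟨x^_⟩ : ℕ → Subset n
  ⟨x^ w ⟩ = image (λ i → x^ (w ℕ.* toℕ i)) full

  -- T ⟨ x ^ w ⟩, the union of the cosets s ⟨ x ^ w ⟩ with s ∈ T.
  _·⟨x^_⟩ : Subset n → ℕ → Subset n
  T ·⟨x^ w ⟩ = tabulate λ h → does (any? λ s → (s ∈? T) ×-dec (h ∈? (s · ⟨x^ w ⟩)))

  -- T ⊆ { x , x ^ 2 , … , x ^ (w - 1) }
  _⊆x⋯x^[_-1] : Subset n → ℕ → Set
  T ⊆x⋯x^[ w -1] = ∀ {g} → g ∈ T → ∃[ i ] (1 ≤ i × i < w × g ≡ x^ i)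

  Multiset : Set
  Multiset = Fin n → ℕ

  ⟦_⟧ : Subset n → Multiset
  ⟦ X ⟧ g = if lookup X g then 1 else 0

  _⊎_ : Multiset → Multiset → Multiset
  (M ⊎ M′) g = M g ℕ.+ M′ g

  _≗ₘ_ : Multiset → Multiset → Set
  M ≗ₘ M′ = ∀ g → M g ≡ M′ g

------------------------------------------------------------------------
-- The dihedral group Dₙ

data D (n : ℕ) : Set where
  rot : Fin n → D n   -- rot i = x ^ i
  ref : Fin n → D n   -- ref i = x ^ i τ

module Dihedral (n : ℕ) .{{_ : NonZero n}} where
  open Cyclic n using (e; abelianGroup)
    renaming (_∙_ to _∙ᶜ_; _⁻¹ to _⁻¹ᶜ; x^_ to x↑_)
  open AbelianGroup abelianGroup
    using (assoc; comm; identityˡ; identityʳ; inverseˡ; inverseʳ)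
  open import Algebra.Properties.AbelianGroup abelianGroup
    using (⁻¹-∙-comm; ⁻¹-involutive; ε⁻¹≈ε)

  infixl 7 _∙_
  infix  8 _⁻¹

  -- τ x = x ⁻¹ τ gives x ^ i τ x ^ j = x ^ (i - j) τ.
  _∙_ : D n → D n → D n
  rot i ∙ rot j = rot (i ∙ᶜ j)
  rot i ∙ ref j = ref (i ∙ᶜ j)
  ref i ∙ rot j = ref (i ∙ᶜ j ⁻¹ᶜ)
  ref i ∙ ref j = rot (i ∙ᶜ j ⁻¹ᶜ)

  ε τ x : D n
  ε = rot e
  τ = ref e
  x = rot (x↑ 1)

  _⁻¹ : D n → D n
  (rot i) ⁻¹ = rot (i ⁻¹ᶜ)
  (ref i) ⁻¹ = ref i

  private
    assoc⁻ : ∀ i j k → (i ∙ᶜ j ⁻¹ᶜ) ∙ᶜ k ⁻¹ᶜ ≡ i ∙ᶜ (j ∙ᶜ k) ⁻¹ᶜ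
    assoc⁻ i j k = trans (assoc i (j ⁻¹ᶜ) (k ⁻¹ᶜ)) (cong (i ∙ᶜ_) (⁻¹-∙-comm j k))

    assoc± : ∀ i j k → (i ∙ᶜ j ⁻¹ᶜ) ∙ᶜ k ≡ i ∙ᶜ (j ∙ᶜ k ⁻¹ᶜ) ⁻¹ᶜ
    assoc± i j k = trans (cong ((i ∙ᶜ j ⁻¹ᶜ) ∙ᶜ_) (sym (⁻¹-involutive k))) (assoc⁻ i j (k ⁻¹ᶜ))

  ∙-assoc : ∀ g h k → (g ∙ h) ∙ k ≡ g ∙ (h ∙ k)
  ∙-assoc (rot i) (rot j) (rot k) = cong rot (assoc i j k)
  ∙-assoc (rot i) (rot j) (ref k) = cong ref (assoc i j k)
  ∙-assoc (rot i) (ref j) (rot k) = cong ref (assoc i j (k ⁻¹ᶜ))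
  ∙-assoc (rot i) (ref j) (ref k) = cong rot (assoc i j (k ⁻¹ᶜ))
  ∙-assoc (ref i) (rot j) (rot k) = cong ref (assoc⁻ i j k)
  ∙-assoc (ref i) (rot j) (ref k) = cong rot (assoc⁻ i j k)
  ∙-assoc (ref i) (ref j) (rot k) = cong rot (assoc± i j k)
  ∙-assoc (ref i) (ref j) (ref k) = cong ref (assoc± i j k)

  ∙-identityˡ : ∀ g → ε ∙ g ≡ g
  ∙-identityˡ (rot i) = cong rot (identityˡ i)
  ∙-identityˡ (ref i) = cong ref (identityˡ i)

  ∙-identityʳ : ∀ g → g ∙ ε ≡ g
  ∙-identityʳ (rot i) = cong rot (identityʳ i)
  ∙-identityʳ (ref i) = cong ref (trans (cong (i ∙ᶜ_) ε⁻¹≈ε) (identityʳ i))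

  ⁻¹-inverseˡ : ∀ g → g ⁻¹ ∙ g ≡ ε
  ⁻¹-inverseˡ (rot i) = cong rot (inverseˡ i)
  ⁻¹-inverseˡ (ref i) = cong rot (inverseʳ i)

  ⁻¹-inverseʳ : ∀ g → g ∙ g ⁻¹ ≡ ε
  ⁻¹-inverseʳ (rot i) = cong rot (inverseʳ i)
  ⁻¹-inverseʳ (ref i) = cong rot (inverseʳ i)

  -- Two of the defining relations; the third one, x ^ n = 1, is Cyclic.x^n≡e.
  τ²≡ε : τ ∙ τ ≡ ε
  τ²≡ε = ⁻¹-inverseʳ τ

  τx≡x⁻¹τ : τ ∙ x ≡ x ⁻¹ ∙ τ
  τx≡x⁻¹τ = cong ref (comm e ((x↑ 1) ⁻¹ᶜ))

  group : FiniteGroup (2 ℕ.* n)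
  group = record
    { Carrier = D n
    ; _∙_     = _∙_
    ; ε       = ε
    ; _⁻¹     = _⁻¹
    ; isGroup = record
      { isMonoid = record
        { isSemigroup = record
          { isMagma = record { isEquivalence = isEquivalence ; ∙-cong = cong₂ _∙_ }
          ; assoc   = ∙-assoc
          }
        ; identity = ∙-identityˡ , ∙-identityʳ
        }
      ; inverse = ⁻¹-inverseˡ , ⁻¹-inverseʳ
      ; ⁻¹-cong = cong _⁻¹
      }
    ; enum = pairs ↔-∘ *↔× {2} {n}
    }
    where
    pairs : (Fin 2 × Fin n) ↔ D n
    pairs = mk↔ₛ′
      (λ { (0F , i) → rot i ; (1F , i) → ref i })
      (λ { (rot i) → 0F , i ; (ref i) → 1F , i })
      (λ { (rot i) → refl ; (ref i) → refl })
      (λ { (0F , i) → refl ; (1F , i) → refl })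

  _∪_τ : Subset n → Subset n → D n → Bool
  (X ∪ Y τ) (rot i) = lookup X i
  (X ∪ Y τ) (ref i) = lookup Y i

Dih : (n : ℕ) .{{_ : NonZero n}} → Subset n → Subset n → Digraph (2 ℕ.* n)
Dih n X Y = Cay group (X ∪ Y τ)
  where open Dihedral n using (group; _∪_τ)

------------------------------------------------------------------------
-- The two conditions on X, for a given v
--
-- For v = 1 the sets satisfying them are ∅ and { x , x ³ , … , x ^ (n - 1) },
-- whose dihedrants are undirected, so genuine graphs have 1 < v.

module _ (n : ℕ) .{{_ : NonZero n}} (X : Subset n) (v : ℕ) where
  open Cyclic n

  -- The union in (ii) is one of disjoint sets; without disjointness
  -- n = v = 3, X = { x , x ² } would satisfy (i) and (ii), although
  -- Dih(3,X,X) is an undirected graph.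
  record ConditionA : Set where
    field
      T        : Subset n
      T⊆       : T ⊆x⋯x^[ v -1]
      i        : X ≡ T ·⟨x^ v ⟩
      ii       : X ∪ X ⁽⁻¹⁾ ≡ full ─ ⟨x^ v ⟩
      disjoint : X ∩ X ⁽⁻¹⁾ ≡ ∅

  record ConditionB : Set where
    field
      2v∣n : 2 ℕ.* v ∣ n
      T′   : Subset n
      T′⊆  : T′ ⊆x⋯x^[ 2 ℕ.* v -1]
      i    : X ≡ T′ ·⟨x^ 2 ℕ.* v ⟩
      ii   : (⟦ X ⟧ ⊎ ⟦ X ⁽⁻¹⁾ ⟧)
               ≗ₘ (⟦ full ─ ⟨x^ 2 ℕ.* v ⟩ ⟧ ⊎ ⟦ (x^ v) · ⟨x^ 2 ℕ.* v ⟩ ⟧)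
      iii  : X ∪ ((x^ v) · X) ≡ full

{-# OPTIONS --safe #-}

-- For X ⊆ Cₙ let U = X + X⁻¹ in the group ring. Since (X ∪ Xτ)² = X U (1 + τ), the graph
-- is a DSRG iff X U = μ Cₙ - d X with d = μ - λ, t = μ and 0 < μ < 2 ∣ X ∣; then U² = 2μ Cₙ - d U as well.
-- Expanding ∑ₕ (U(h) - U(h⁻¹g))² = 2 d U(g) shows that H = { U = 0 } is a subgroup which
-- leaves U and X invariant. On Cₘ = Cₙ / H, where u vanishes only at e, this becomes
-- u² = c - d′ u with d = ∣ H ∣ d′; here d′ is an integer because u takes the value 1, the
-- graph being genuine. For a prime q ∣ d′ the Frobenius map gives
-- ∑ u(g) gᵠ ≡ uᵠ ≡ const (mod q), which forces q = 2 and then d′ = 2. So d′ is 1 or 2, and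
-- counting the nonzero terms of the sum of squares leaves exactly u = 1 off e (condition (a))
-- and u = 2 at the involution, 1 elsewhere off e (condition (b)).

module Submission where

-- `XU` arises because `τ` inverts rotations: pulling `τ` past the second factor replaces `X` by
-- `X⁻¹`, so the terms starting in `X` contribute `X²` and those starting in `Xτ` contribute
-- `X X⁻¹`. The obstacle is to bound `d′` from above, since listing terms of the sum of squares
-- yields only lower bounds. The upper bound is arithmetic and rests on the value of the constant in
-- the Frobenius congruence. If `q` did not divide `m`, taking `q`-th powers would permute `Cₘ`, and
-- the constant would be congruent both to `u(e) = 0` and to a value 1. Hence `q ∣ m`, the generator
-- has no `q`-th root, and the constant is 0. On the subgroup of order `q` this says `q ∣ 2A`, where
-- `A` counts the elements of the image of `X` lying there; since `0 < A < q`, `q = 2`. For `q = 2`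
-- it says that `u(k) + u(kz)` is even, `z` being the involution, which leaves only `e` and `z` in
-- the sum of squares at `z`: `4 + 4 = 4 d′`.

module Development where

  open import Defs
  open import Algebra.Bundles using (AbelianGroup; CommutativeSemiring)
  open import Algebra.Structures using (IsAbelianGroup)
  import Algebra.Properties.AbelianGroup as AbelianGroupProperties
  import Algebra.Properties.CommutativeMonoid.Sum as MonoidSum
  import Algebra.Properties.CommutativeSemiring.Binomial as Binomial
  import Algebra.Properties.Semiring.Exp as Exp
  import Algebra.Properties.Semiring.Mult as Mult
  import Algebra.Properties.Semiring.Sum as SemiringSum
  open import Data.Bool.Base using (Bool; true; false; not; _∧_; _∨_; if_then_else_)
  open import Data.Fin.Base as Fin using (Fin; zero; suc; toℕ; combine; inject₁; fromℕ; _↑ˡ_; _↑ʳ_)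
  open import Data.Fin.Permutation using (permutation)
  import Data.Fin.Properties as Fin
  open import Data.Fin.Subset using (Subset; _∈_; _∉_; _∪_; _∩_; _─_) renaming (⊤ to full; ⊥ to ∅)
  open import Data.Fin.Subset.Properties using (_∈?_; ∈⊤)
  open import Data.Integer.Base as ℤ using (ℤ; +_; 0ℤ; 1ℤ; _+_; _*_; _-_; -_)
  import Data.Integer.Properties as ℤ
  open import Data.Integer.Divisibility.Signed as ℤ∣ using (divides) renaming (_∣_ to _∣ℤ_)
  open import Data.Integer.Tactic.RingSolver using (solve-∀)
  open import Data.List.Base using (List; []; _∷_)
  open import Data.List.Relation.Unary.All using (All; []; _∷_)
  open import Data.List.Relation.Unary.AllPairs using ([]; _∷_)
  open import Data.List.Relation.Unary.Unique.Propositional using (Unique)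
  open import Data.Nat.Base as ℕ using (ℕ; zero; suc; NonZero; _!)
  import Data.Nat.Properties as ℕ
  open import Data.Nat.Combinatorics using (_C_; nCk≡n!/k![n-k]!; k![n∸k]!∣n!; nCn≡1)
  open import Data.Nat.Coprimality using (Coprime; coprime-divisor)
  open import Data.Nat.DivMod
    using (_%_; _/_; m%n≤m; m%n<n; m<n⇒m%n≡m; m≡m%n+[m/n]*n; m/n*n≡m; m∣n⇒o%n%m≡o%m; %-remove-+ˡ)
  open import Data.Nat.Divisibility as ℕ∣ using (_∣_; _∤_; _∣?_)
  open import Data.Nat.Induction using (<-rec)
  open import Data.Nat.Primality
    using (Prime; prime[2]; euclidsLemma; prime⇒nonTrivial; prime⇒nonZero; prime⇒irreducible)
  open import Data.Nat.Primality.Factorisation using (factorise)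
  open import Data.Product.Base using (∃-syntax; _×_; _,_; proj₁; proj₂)
  open import Data.Sum.Base using (_⊎_; inj₁; inj₂)
  open import Data.Vec.Base using ([]; _∷_; lookup; tabulate)
  open import Data.Vec.Properties
    using ([]=⇒lookup; lookup⇒[]=; lookup∘tabulate; tabulate∘lookup; tabulate-cong; lookup-zipWith; lookup-replicate)
  open import Function.Base using (_∘_)
  open import Function.Bundles using (_⇔_; mk⇔; module Equivalence; module Inverse)
  open import Relation.Binary.PropositionalEquality
    using (_≡_; _≢_; refl; sym; trans; cong; cong₂; subst; subst₂; ≢-sym; module ≡-Reasoning)
  open import Relation.Nullary.Decidable using (Dec; yes; no; does; dec-true; dec-false; does-⇔; _×-dec_)
  open import Relation.Nullary.Negation using (contradiction; ¬_)
  open import Relation.Unary using (Decidable)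

  open MonoidSum ℤ.+-0-commutativeMonoid
    using (sum; sum-cong-≗; ∑-distrib-+; ∑-comm; sum-permute; sum-replicate-zero)
  open SemiringSum ℤ.+-*-semiring using (*-distribˡ-sum; *-distribʳ-sum)

  -- The Frobenius map in characteristic p

  prime∤! : ∀ {p k} → Prime p → k ℕ.< p → ¬ p ∣ k !
  prime∤! {k = zero}  pp _ p∣1 = contradiction (ℕ∣.∣1⇒≡1 p∣1) (ℕ.nonTrivial⇒≢1 {{prime⇒nonTrivial pp}})
  prime∤! {k = suc k} pp k<p p∣ with euclidsLemma (suc k) (k !) pp p∣
  ... | inj₁ p∣k  = ℕ∣.>⇒∤ k<p p∣k
  ... | inj₂ p∣k! = prime∤! pp (ℕ.<-trans (ℕ.n<1+n k) k<p) p∣k!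

  -- `p` divides `p! = C · k! (p - k)!` but neither of the two factorials.
  prime∣C : ∀ {p k} → Prime p → 0 ℕ.< k → k ℕ.< p → p ∣ (p C k)
  prime∣C {p} {k} pp 0<k k<p with euclidsLemma (p C k) (k ! ℕ.* (p ℕ.∸ k) !) pp p∣
    where
    instance _ = k ℕ.!* (p ℕ.∸ k) !≢0
    p∣ : p ∣ (p C k) ℕ.* (k ! ℕ.* (p ℕ.∸ k) !)
    p∣ = subst (p ∣_) (sym (trans
           (cong (ℕ._* (k ! ℕ.* (p ℕ.∸ k) !)) (nCk≡n!/k![n-k]! (ℕ.<⇒≤ k<p)))
           (m/n*n≡m (k![n∸k]!∣n! (ℕ.<⇒≤ k<p)))))
           (p∣p! p {{prime⇒nonZero pp}})
      where
      p∣p! : ∀ p .{{_ : NonZero p}} → p ∣ p !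
      p∣p! (suc p) = ℕ∣.m∣m*n (p !)
  ... | inj₁ p∣C = p∣C
  ... | inj₂ p∣ with euclidsLemma (k !) ((p ℕ.∸ k) !) pp p∣
  ...   | inj₁ p∣k! = contradiction p∣k! (prime∤! pp k<p)
  ...   | inj₂ p∣!  = contradiction p∣! (prime∤! pp (ℕ.∸-monoʳ-< 0<k (ℕ.<⇒≤ k<p)))

  -- Kept general in the semiring and its equality, because the instance in use is convolution of
  -- integer functions with congruence modulo `p` as the equality.
  module Frobenius {a ℓ} (R : CommutativeSemiring a ℓ) {p : ℕ} (prime : Prime p)
    (char : ∀ x → CommutativeSemiring._≈_ R
                    (Mult._×_ (CommutativeSemiring.semiring R) p x)
                    (CommutativeSemiring.0# R)) where

    open CommutativeSemiring R renaming
      (Carrier to A; _+_ to _⊹_; _*_ to _⊛_; zero to *-zero; refl to ≈-refl; sym to ≈-sym; trans to ≈-trans)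
    open Binomial R using (theorem; binomial; binomialTerm)
    open Exp semiring using (_^_)
    open Mult semiring using () renaming (_×_ to _⋇_; ×-assocˡ to ⋇-assocˡ; ×-congˡ to ⋇-congˡ)
    open SemiringSum semiring using (sum-cong-≋; sum-init-last)
      renaming (sum to ⨁; sum-replicate-zero to ⨁-replicate-zero)
    open import Relation.Binary.Reasoning.Setoid setoid

    p∣⇒⋇≈0 : ∀ {k} → p ∣ k → ∀ x → k ⋇ x ≈ 0#
    p∣⇒⋇≈0 {k} (ℕ∣.divides r k≡rp) x = begin
      k ⋇ x            ≈⟨ ⋇-congˡ {x} (trans k≡rp (ℕ.*-comm r p)) ⟩
      (p ℕ.* r) ⋇ x    ≈⟨ ⋇-assocˡ x p r ⟨
      p ⋇ (r ⋇ x)      ≈⟨ char (r ⋇ x) ⟩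
      0#               ∎

    -- Every inner binomial coefficient is a multiple of `p` and vanishes. The equation `p ≡ suc r`
    -- is an argument so that matching on it exposes the last term of the binomial sum.
    ^-distrib-+′ : ∀ {r} → p ≡ suc r → ∀ x y → (x ⊹ y) ^ p ≈ x ^ p ⊹ y ^ p
    ^-distrib-+′ {r} refl x y = begin
      (x ⊹ y) ^ p                        ≈⟨ theorem p x y ⟩
      term zero ⊹ ⨁ (term ∘ suc)         ≈⟨ +-congˡ (sum-init-last (term ∘ suc)) ⟩
      term zero ⊹ (⨁ inner ⊹ top)        ≈⟨ +-congˡ (+-congʳ (≈-trans (sum-cong-≋ inner≈0) (⨁-replicate-zero r))) ⟩
      term zero ⊹ (0# ⊹ top)             ≈⟨ +-cong term0 (≈-trans (+-identityˡ top) topʸ) ⟩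
      y ^ p ⊹ x ^ p                      ≈⟨ +-comm _ _ ⟩
      x ^ p ⊹ y ^ p                      ∎
      where
      term  = binomialTerm x y p
      inner = λ i → term (suc (inject₁ i))
      top   = term (suc (fromℕ r))
      inner≈0 : ∀ i → inner i ≈ 0#
      inner≈0 i = p∣⇒⋇≈0 (prime∣C prime (ℕ.s≤s ℕ.z≤n)
        (ℕ.s≤s (subst (ℕ._< r) (sym (Fin.toℕ-inject₁ i)) (Fin.toℕ<n i)))) (binomial x y p (suc (inject₁ i)))
      -- The binomial index is the exponent of `x`, so index zero yields the power of `y`; hence the
      -- final swap of the two summands.
      term0 : term zero ≈ y ^ p
      term0 = ≈-trans (+-identityʳ _) (*-identityˡ _)
      topʸ : top ≈ x ^ p
      topʸ rewrite Fin.toℕ-fromℕ r | nCn≡1 (suc r) | ℕ.n∸n≡0 r = ≈-trans (+-identityʳ _) (*-identityʳ _)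

    p≡1+pred : p ≡ suc (ℕ.pred p)
    p≡1+pred = sym (ℕ.suc-pred p {{prime⇒nonZero prime}})

    ^-distrib-+ : ∀ x y → (x ⊹ y) ^ p ≈ x ^ p ⊹ y ^ p
    ^-distrib-+ = ^-distrib-+′ p≡1+pred

    0^p≈0 : 0# ^ p ≈ 0#
    0^p≈0 = subst (λ k → 0# ^ k ≈ 0#) (sym p≡1+pred) (zeroˡ _)

    ^-distrib-⨁ : ∀ {n} (t : Fin n → A) → ⨁ t ^ p ≈ ⨁ (λ i → t i ^ p)
    ^-distrib-⨁ {zero}  t = 0^p≈0
    ^-distrib-⨁ {suc n} t = ≈-trans (^-distrib-+ (t zero) (⨁ (t ∘ suc))) (+-congˡ (^-distrib-⨁ (t ∘ suc)))

  -- Sums over Fin n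

  𝟙 : Bool → ℤ
  𝟙 b = if b then 1ℤ else 0ℤ

  sum-const : ∀ n c → sum {n} (λ _ → c) ≡ + n * c
  sum-const zero    c = refl
  sum-const (suc n) c = trans (cong (_+_ c) (sum-const n c)) (sym (ℤ.suc-* (+ n) c))

  sum-neg : ∀ {n} (f : Fin n → ℤ) → sum (λ i → - f i) ≡ - sum f
  sum-neg {zero}  f = refl
  sum-neg {suc n} f = trans (cong (_+_ (- f zero)) (sum-neg (f ∘ suc))) (sym (ℤ.neg-distrib-+ (f zero) _))

  sum-∸ : ∀ {n} (f g : Fin n → ℤ) → sum (λ i → f i - g i) ≡ sum f - sum g
  sum-∸ f g = trans (∑-distrib-+ f (λ i → - g i)) (cong (λ s → sum f + s) (sum-neg g))

  sum-∣ : ∀ {n d} (f : Fin n → ℤ) → (∀ i → d ∣ℤ f i) → d ∣ℤ sum f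
  sum-∣ {zero}  f d∣f = divides 0ℤ refl
  sum-∣ {suc n} f d∣f = ℤ∣.∣m∣n⇒∣m+n (d∣f zero) (sum-∣ (f ∘ suc) (d∣f ∘ suc))

  sum-mono-≤ : ∀ {n} {f g : Fin n → ℤ} → (∀ i → f i ℤ.≤ g i) → sum f ℤ.≤ sum g
  sum-mono-≤ {zero}  f≤g = ℤ.≤-refl
  sum-mono-≤ {suc n} f≤g = ℤ.+-mono-≤ (f≤g zero) (sum-mono-≤ (f≤g ∘ suc))

  sum-0 : ∀ {n} {f : Fin n → ℤ} → (∀ i → f i ≡ 0ℤ) → sum f ≡ 0ℤ
  sum-0 {n} f≡0 = trans (sum-cong-≗ f≡0) (sum-replicate-zero n)

  sum-nonneg : ∀ {n} {f : Fin n → ℤ} → (∀ i → 0ℤ ℤ.≤ f i) → 0ℤ ℤ.≤ sum f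
  sum-nonneg {n} {f} f≥0 = subst (ℤ._≤ sum f) (sum-replicate-zero n) (sum-mono-≤ f≥0)

  _∖_ : ∀ {n} → (Fin n → ℤ) → Fin n → Fin n → ℤ
  (f ∖ p) i = if does (i Fin.≟ p) then 0ℤ else f i

  ∖-≡ : ∀ {n} (f : Fin n → ℤ) p → (f ∖ p) p ≡ 0ℤ
  ∖-≡ f p rewrite dec-true (p Fin.≟ p) refl = refl

  ∖-≢ : ∀ {n} (f : Fin n → ℤ) {p i} → i ≢ p → (f ∖ p) i ≡ f i
  ∖-≢ f {p} {i} i≢p rewrite dec-false (i Fin.≟ p) i≢p = refl

  sum-extract : ∀ {n} (f : Fin n → ℤ) p → sum f ≡ f p + sum (f ∖ p)
  sum-extract f zero    = cong (λ s → f zero + s) (sym (ℤ.+-identityˡ _))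
  sum-extract f (suc p) = trans (cong (λ s → f zero + s) (sum-extract (f ∘ suc) p)) (swap (f zero) (f (suc p)) _)
    where
    swap : ∀ a b c → a + (b + c) ≡ b + (a + c)
    swap = solve-∀

  sum-single : ∀ {n} (f : Fin n → ℤ) p → (∀ i → i ≢ p → f i ≡ 0ℤ) → sum f ≡ f p
  sum-single f p off = trans (sum-extract f p)
    (trans (cong (λ s → f p + s) (sum-0 rest)) (ℤ.+-identityʳ _))
    where
    rest : ∀ i → (f ∖ p) i ≡ 0ℤ
    rest i with i Fin.≟ p
    ... | yes _   = refl
    ... | no  i≢p = off i i≢p

  sumOver : ∀ {n} → (Fin n → ℤ) → List (Fin n) → ℤ
  sumOver f []       = 0ℤ
  sumOver f (p ∷ ps) = f p + sumOver f ps

  -- The source of all estimates on sums of squares: a few explicit distinct indices bound the whole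
  -- sum from below. A counted index is set to zero, which by distinctness leaves the remaining
  -- listed terms unchanged.
  sumOver-≤ : ∀ {n} {f : Fin n → ℤ} {ps} → Unique ps → (∀ i → 0ℤ ℤ.≤ f i) → sumOver f ps ℤ.≤ sum f
  sumOver-≤ []        f≥0 = sum-nonneg f≥0
  sumOver-≤ {f = f} {p ∷ ps} (p∉ps ∷ unique) f≥0 = begin
    f p + sumOver f ps         ≡⟨ cong (λ s → f p + s) (sumOver-∖ p∉ps) ⟨
    f p + sumOver (f ∖ p) ps   ≤⟨ ℤ.+-monoʳ-≤ (f p) (sumOver-≤ unique ∖≥0) ⟩
    f p + sum (f ∖ p)          ≡⟨ sum-extract f p ⟨
    sum f                      ∎
    where
    open ℤ.≤-Reasoning
    ∖≥0 : ∀ i → 0ℤ ℤ.≤ (f ∖ p) i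
    ∖≥0 i with does (i Fin.≟ p)
    ... | true  = ℤ.≤-refl
    ... | false = f≥0 i
    sumOver-∖ : ∀ {qs} → All (p ≢_) qs → sumOver (f ∖ p) qs ≡ sumOver f qs
    sumOver-∖ []            = refl
    sumOver-∖ (p≢q ∷ p∉qs) = cong₂ _+_ (∖-≢ f (p≢q ∘ sym)) (sumOver-∖ p∉qs)

  sum-reindex : ∀ {n} {φ ψ : Fin n → Fin n} → (∀ i → φ (ψ i) ≡ i) → (∀ i → ψ (φ i) ≡ i) →
                ∀ f → sum f ≡ sum (f ∘ φ)
  sum-reindex {φ = φ} {ψ} φψ ψφ f = sum-permute f (permutation φ ψ φψ ψφ)

  sum-++ : ∀ m {n} (f : Fin (m ℕ.+ n) → ℤ) → sum f ≡ sum (λ i → f (i ↑ˡ n)) + sum (λ i → f (m ↑ʳ i))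
  sum-++ zero    f = sym (ℤ.+-identityˡ _)
  sum-++ (suc m) f = trans (cong (λ s → f zero + s) (sum-++ m (f ∘ suc))) (sym (ℤ.+-assoc (f zero) _ _))

  sum-combine : ∀ a {b} (f : Fin (a ℕ.* b) → ℤ) → sum f ≡ sum (λ i → sum (λ j → f (combine {a} i j)))
  sum-combine zero    f = refl
  sum-combine (suc a) {b} f = trans (sum-++ b f) (cong (λ s → sum (λ j → f (j ↑ˡ (a ℕ.* b))) + s) (sum-combine a (λ i → f (b ↑ʳ i))))

  -- Restricting to functions of `toℕ` lets an equation such as `n = h m` change the index type
  -- without casts on the indices.
  sum-cast : ∀ {m n} → m ≡ n → ∀ (f : ℕ → ℤ) → sum {m} (f ∘ toℕ) ≡ sum {n} (f ∘ toℕ)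
  sum-cast refl f = refl

  -- Convolution on a finite abelian group

  module Convolution {n : ℕ} {_∙_ : Fin n → Fin n → Fin n} {ε : Fin n} {_⁻¹ : Fin n → Fin n}
    (isAbelianGroup : IsAbelianGroup _≡_ _∙_ ε _⁻¹) where

    abelianGroup : AbelianGroup _ _
    abelianGroup = record { isAbelianGroup = isAbelianGroup }

    open AbelianGroup abelianGroup using (assoc; comm; identityˡ; identityʳ; inverseˡ; inverseʳ)
    open AbelianGroupProperties abelianGroup
      using (⁻¹-∙-comm; ⁻¹-involutive; ε⁻¹≈ε)
    open AbelianGroupProperties abelianGroup public
      using () renaming (\\-leftDividesʳ to a⁻¹[ab]≡b; \\-leftDividesˡ to a[a⁻¹b]≡b)

    infixl 7 _⋆_

    -- The product of the integral group ring, whose elements are given by their coefficient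
    -- functions; `δ a` is the group element `a`.
    _⋆_ : (Fin n → ℤ) → (Fin n → ℤ) → Fin n → ℤ
    (f ⋆ g) k = sum (λ i → f i * g ((i ⁻¹) ∙ k))

    δ : Fin n → Fin n → ℤ
    δ a k = 𝟙 (does (a Fin.≟ k))

    pow : Fin n → ℕ → Fin n
    pow g zero    = ε
    pow g (suc k) = g ∙ pow g k

    [ab]⁻¹c≡b⁻¹[a⁻¹c] : ∀ a b c → ((a ∙ b) ⁻¹) ∙ c ≡ (b ⁻¹) ∙ ((a ⁻¹) ∙ c)
    [ab]⁻¹c≡b⁻¹[a⁻¹c] a b c =
      trans (cong (_∙ c) (trans (sym (⁻¹-∙-comm a b)) (comm _ _))) (assoc _ _ c)

    [a⁻¹b]⁻¹b≡a : ∀ a b → (((a ⁻¹) ∙ b) ⁻¹) ∙ b ≡ a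
    [a⁻¹b]⁻¹b≡a a b = trans ([ab]⁻¹c≡b⁻¹[a⁻¹c] (a ⁻¹) b b)
      (trans (cong (λ a′ → (b ⁻¹) ∙ (a′ ∙ b)) (⁻¹-involutive a))
      (trans (cong ((b ⁻¹) ∙_) (comm a b)) (a⁻¹[ab]≡b b a)))

    sum-shift : ∀ a f → sum f ≡ sum (λ i → f (a ∙ i))
    sum-shift a = sum-reindex (a[a⁻¹b]≡b a) (a⁻¹[ab]≡b a)

    sum-inverse : ∀ f → sum f ≡ sum (λ i → f (i ⁻¹))
    sum-inverse = sum-reindex ⁻¹-involutive ⁻¹-involutive

    sum-quotient : ∀ k f → sum f ≡ sum (λ i → f ((i ⁻¹) ∙ k))
    sum-quotient k = sum-reindex (λ i → [a⁻¹b]⁻¹b≡a i k) (λ i → [a⁻¹b]⁻¹b≡a i k)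

    ⋆-cong : ∀ {f f′ g g′} → (∀ i → f i ≡ f′ i) → (∀ i → g i ≡ g′ i) → ∀ k → (f ⋆ g) k ≡ (f′ ⋆ g′) k
    ⋆-cong f≗ g≗ k = sum-cong-≗ (λ i → cong₂ _*_ (f≗ i) (g≗ _))

    ⋆-comm : ∀ f g k → (f ⋆ g) k ≡ (g ⋆ f) k
    ⋆-comm f g k = trans (sum-quotient k _)
      (sum-cong-≗ λ i → trans (cong (λ j → f ((i ⁻¹) ∙ k) * g j) ([a⁻¹b]⁻¹b≡a i k)) (ℤ.*-comm _ (g i)))

    ⋆-assoc : ∀ f g h k → ((f ⋆ g) ⋆ h) k ≡ (f ⋆ (g ⋆ h)) k
    ⋆-assoc f g h k = begin
      sum (λ i → sum (λ j → f j * g ((j ⁻¹) ∙ i)) * h ((i ⁻¹) ∙ k))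
        ≡⟨ sum-cong-≗ (λ i → *-distribʳ-sum (h ((i ⁻¹) ∙ k)) (λ j → f j * g ((j ⁻¹) ∙ i))) ⟩
      sum (λ i → sum (λ j → f j * g ((j ⁻¹) ∙ i) * h ((i ⁻¹) ∙ k)))
        ≡⟨ ∑-comm (λ i j → f j * g ((j ⁻¹) ∙ i) * h ((i ⁻¹) ∙ k)) ⟩
      sum (λ j → sum (λ i → f j * g ((j ⁻¹) ∙ i) * h ((i ⁻¹) ∙ k)))
        ≡⟨ sum-cong-≗ (λ j → trans (sum-shift j (λ i → f j * g ((j ⁻¹) ∙ i) * h ((i ⁻¹) ∙ k)))
              (trans (sum-cong-≗ (inner j))
              (sym (*-distribˡ-sum (f j) (λ l → g l * h ((l ⁻¹) ∙ ((j ⁻¹) ∙ k))))))) ⟩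
      sum (λ j → f j * sum (λ l → g l * h ((l ⁻¹) ∙ ((j ⁻¹) ∙ k)))) ∎
      where
      open ≡-Reasoning
      inner : ∀ j l → f j * g ((j ⁻¹) ∙ (j ∙ l)) * h (((j ∙ l) ⁻¹) ∙ k)
                    ≡ f j * (g l * h ((l ⁻¹) ∙ ((j ⁻¹) ∙ k)))
      inner j l = trans
        (cong₂ (λ a b → f j * g a * h b) (a⁻¹[ab]≡b j l) ([ab]⁻¹c≡b⁻¹[a⁻¹c] j l k))
        (ℤ.*-assoc (f j) (g l) _)

    ⋆-distribˡ-+ : ∀ f g h k → (f ⋆ (λ i → g i + h i)) k ≡ (f ⋆ g) k + (f ⋆ h) k
    ⋆-distribˡ-+ f g h k = trans (sum-cong-≗ λ i → ℤ.*-distribˡ-+ (f i) _ _)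
      (∑-distrib-+ (λ i → f i * g ((i ⁻¹) ∙ k)) (λ i → f i * h ((i ⁻¹) ∙ k)))

    ⋆-distribʳ-+ : ∀ f g h k → ((λ i → g i + h i) ⋆ f) k ≡ (g ⋆ f) k + (h ⋆ f) k
    ⋆-distribʳ-+ f g h k = trans (sum-cong-≗ λ i → ℤ.*-distribʳ-+ (f ((i ⁻¹) ∙ k)) (g i) (h i))
      (∑-distrib-+ (λ i → g i * f ((i ⁻¹) ∙ k)) (λ i → h i * f ((i ⁻¹) ∙ k)))

    ⋆-constˡ : ∀ c f k → ((λ _ → c) ⋆ f) k ≡ c * sum f
    ⋆-constˡ c f k = trans (sym (*-distribˡ-sum c (λ i → f ((i ⁻¹) ∙ k))))
      (cong (c *_) (sym (sum-quotient k f)))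

    ⋆-negˡ : ∀ f g k → ((λ i → - f i) ⋆ g) k ≡ - (f ⋆ g) k
    ⋆-negˡ f g k = trans (sum-cong-≗ λ i → sym (ℤ.neg-distribˡ-* (f i) _)) (sum-neg (λ i → f i * g ((i ⁻¹) ∙ k)))

    δ-⋆ : ∀ a f k → (δ a ⋆ f) k ≡ f ((a ⁻¹) ∙ k)
    δ-⋆ a f k = trans (sum-single _ a off) on
      where
      off : ∀ i → i ≢ a → δ a i * f ((i ⁻¹) ∙ k) ≡ 0ℤ
      off i i≢a rewrite dec-false (a Fin.≟ i) (i≢a ∘ sym) = refl
      on : δ a a * f ((a ⁻¹) ∙ k) ≡ f ((a ⁻¹) ∙ k)
      on rewrite dec-true (a Fin.≟ a) refl = ℤ.*-identityˡ _

    δ-cong-shift : ∀ a b k → δ b ((a ⁻¹) ∙ k) ≡ δ (a ∙ b) k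
    δ-cong-shift a b k with b Fin.≟ ((a ⁻¹) ∙ k) | (a ∙ b) Fin.≟ k
    ... | yes _  | yes _  = refl
    ... | no _   | no _   = refl
    ... | yes b≡ | no ab≢ = contradiction (trans (cong (a ∙_) b≡) (a[a⁻¹b]≡b a k)) ab≢
    ... | no b≢  | yes ab≡ = contradiction (trans (sym (a⁻¹[ab]≡b a b)) (cong ((a ⁻¹) ∙_) ab≡)) b≢

    -- Congruence modulo p as the equality turns the Frobenius map into a semiring identity.
    module _ (p : ℤ) where

      -- A record, so that `f` and `g` remain recoverable from the type of a congruence; the bare
      -- function type would only show their values.
      record _≈_ (f g : Fin n → ℤ) : Set where
        constructor pointwise
        field ∣-at : ∀ k → p ∣ℤ f k - g k
      open _≈_

      ≗⇒≈ : ∀ {f g} → (∀ k → f k ≡ g k) → f ≈ g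
      ≗⇒≈ f≗g .∣-at k = divides 0ℤ (ℤ.i≡j⇒i-j≡0 (f≗g k))

      private
        ≈-trans : ∀ {f g h} → f ≈ g → g ≈ h → f ≈ h
        ≈-trans {f} {g} {h} f≈g g≈h .∣-at k = subst (p ∣ℤ_) (telescope (f k) (g k) (h k)) (ℤ∣.∣m∣n⇒∣m+n (∣-at f≈g k) (∣-at g≈h k))
          where
          telescope : ∀ a b c → (a - b) + (b - c) ≡ a - c
          telescope = solve-∀

        ≈-sym : ∀ {f g} → f ≈ g → g ≈ f
        ≈-sym {f} {g} f≈g .∣-at k = subst (p ∣ℤ_) (flip (f k) (g k)) (ℤ∣.∣m⇒∣-m (∣-at f≈g k))
          where
          flip : ∀ a b → - (a - b) ≡ b - a
          flip = solve-∀

        +-cong : ∀ {f f′ g g′} → f ≈ f′ → g ≈ g′ → (λ i → f i + g i) ≈ (λ i → f′ i + g′ i)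
        +-cong {f} {f′} {g} {g′} f≈ g≈ .∣-at k =
          subst (p ∣ℤ_) (regroup (f k) (f′ k) (g k) (g′ k)) (ℤ∣.∣m∣n⇒∣m+n (∣-at f≈ k) (∣-at g≈ k))
          where
          regroup : ∀ a a′ b b′ → (a - a′) + (b - b′) ≡ (a + b) - (a′ + b′)
          regroup = solve-∀

        ⋆-cong-≈ : ∀ {f f′ g g′} → f ≈ f′ → g ≈ g′ → (f ⋆ g) ≈ (f′ ⋆ g′)
        ⋆-cong-≈ {f} {f′} {g} {g′} f≈ g≈ .∣-at k = subst (p ∣ℤ_)
          (sum-∸ (λ i → f i * g ((i ⁻¹) ∙ k)) (λ i → f′ i * g′ ((i ⁻¹) ∙ k)))
          (sum-∣ _ λ i → subst (p ∣ℤ_) (regroup (f i) (f′ i) (g ((i ⁻¹) ∙ k)) (g′ ((i ⁻¹) ∙ k)))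
            (ℤ∣.∣m∣n⇒∣m+n (ℤ∣.∣m⇒∣m*n (g ((i ⁻¹) ∙ k)) (∣-at f≈ i)) (ℤ∣.∣n⇒∣m*n (f′ i) (∣-at g≈ ((i ⁻¹) ∙ k)))))
          where
          regroup : ∀ a a′ b b′ → (a - a′) * b + a′ * (b - b′) ≡ a * b - a′ * b′
          regroup = solve-∀

        ⋆-identityˡ : ∀ f k → (δ ε ⋆ f) k ≡ f k
        ⋆-identityˡ f k = trans (δ-⋆ ε f k) (cong f (trans (cong (_∙ k) ε⁻¹≈ε) (identityˡ k)))

        ⋆-zeroˡ : ∀ f k → ((λ _ → 0ℤ) ⋆ f) k ≡ 0ℤ
        ⋆-zeroˡ f k = sum-0 {f = λ i → 0ℤ * f ((i ⁻¹) ∙ k)} λ _ → refl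

      commutativeSemiring : CommutativeSemiring _ _
      commutativeSemiring = record
        { _≈_ = _≈_
        ; _+_ = λ f g i → f i + g i
        ; _*_ = _⋆_
        ; 0#  = λ _ → 0ℤ
        ; 1#  = δ ε
        ; isCommutativeSemiring = record
          { isSemiring = record
            { isSemiringWithoutAnnihilatingZero = record
              { +-isCommutativeMonoid = record
                { isMonoid = record
                  { isSemigroup = record
                    { isMagma = record
                      { isEquivalence = record
                        { refl = ≗⇒≈ λ _ → refl ; sym = ≈-sym ; trans = ≈-trans }
                      ; ∙-cong = +-cong }
                    ; assoc = λ f g h → ≗⇒≈ λ k → ℤ.+-assoc (f k) (g k) (h k) }
                  ; identity = (λ f → ≗⇒≈ λ k → ℤ.+-identityˡ (f k)) , (λ f → ≗⇒≈ λ k → ℤ.+-identityʳ (f k)) }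
                ; comm = λ f g → ≗⇒≈ λ k → ℤ.+-comm (f k) (g k) }
              ; *-cong = ⋆-cong-≈
              ; *-assoc = λ f g h → ≗⇒≈ (⋆-assoc f g h)
              ; *-identity = (λ f → ≗⇒≈ (⋆-identityˡ f))
                           , (λ f → ≗⇒≈ λ k → trans (⋆-comm f (δ ε) k) (⋆-identityˡ f k))
              ; distrib = (λ f g h → ≗⇒≈ (⋆-distribˡ-+ f g h)) , (λ f g h → ≗⇒≈ (⋆-distribʳ-+ f g h)) }
            ; zero = (λ f → ≗⇒≈ (⋆-zeroˡ f))
                   , (λ f → ≗⇒≈ λ k → trans (⋆-comm f (λ _ → 0ℤ) k) (⋆-zeroˡ f k)) }
          ; *-comm = λ f g → ≗⇒≈ (⋆-comm f g) } }

    -- The coefficient at `h` of `∑ u(g) gᵖ`, that is, the sum of `u` over the `p`-th roots of `h`.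
    rootSum : ℕ → (Fin n → ℤ) → Fin n → ℤ
    rootSum p u h = sum (λ g → u g * δ (pow g p) h)

    module _ {p : ℕ} (prime : Prime p) where

      private
        module R = CommutativeSemiring (commutativeSemiring (+ p))
        open Exp R.semiring using (_^_; ^-congˡ)
        open Mult R.semiring using () renaming (_×_ to _⋇_)
        open SemiringSum R.semiring using () renaming (sum to ⨁; sum-cong-≋ to ⨁-cong)

        ⋇-pointwise : ∀ m f k → (m ⋇ f) k ≡ + m * f k
        ⋇-pointwise zero    f k = refl
        ⋇-pointwise (suc m) f k = trans (cong (λ s → f k + s) (⋇-pointwise m f k)) (sym (ℤ.suc-* (+ m) (f k)))

        char : ∀ f → (p ⋇ f) R.≈ R.0#
        char f = pointwise λ k → divides (f k) (trans (ℤ.+-identityʳ _) (trans (⋇-pointwise p f k) (ℤ.*-comm (+ p) (f k))))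

        open Frobenius (commutativeSemiring (+ p)) prime char

        ⨁-pointwise : ∀ {m} (t : Fin m → Fin n → ℤ) k → ⨁ t k ≡ sum (λ i → t i k)
        ⨁-pointwise {zero}  t k = refl
        ⨁-pointwise {suc m} t k = cong (λ s → t zero k + s) (⨁-pointwise (t ∘ suc) k)

        δ-^ : ∀ a m → δ a ^ m R.≈ δ (pow a m)
        δ-^ a zero    = R.refl
        δ-^ a (suc m) = R.trans (R.*-congˡ {x = δ a} (δ-^ a m))
          (≗⇒≈ (+ p) λ k → trans (δ-⋆ a (δ (pow a m)) k) (δ-cong-shift a (pow a m) k))

        monomial : Bool → Fin n → Fin n → ℤ
        monomial b g k = 𝟙 b * δ g k

        -- For a coefficient `c` equal to 0 or 1, `cᵖ = c` is immediate. This is why `u` enters the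
        -- Frobenius argument as a sum of two indicators.
        𝟙δ-^ : ∀ b a → monomial b a ^ p R.≈ monomial b (pow a p)
        𝟙δ-^ true  a = R.trans (^-congˡ p (≗⇒≈ (+ p) λ k → ℤ.*-identityˡ (δ a k)))
          (R.trans (δ-^ a p) (≗⇒≈ (+ p) λ k → sym (ℤ.*-identityˡ (δ (pow a p) k))))
        𝟙δ-^ false a = 0^p≈0

        indicator-^ : ∀ (b : Fin n → Bool) → (𝟙 ∘ b) ^ p R.≈ (λ h → sum (λ g → 𝟙 (b g) * δ (pow g p) h))
        indicator-^ b = R.trans (^-congˡ p (≗⇒≈ (+ p) expand))
          (R.trans (^-distrib-⨁ (λ g → monomial (b g) g))
          (R.trans (⨁-cong (λ g → 𝟙δ-^ (b g) g))
          (≗⇒≈ (+ p) (⨁-pointwise (λ g → monomial (b g) (pow g p))))))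
          where
          expand : ∀ k → 𝟙 (b k) ≡ ⨁ (λ g → monomial (b g) g) k
          expand k = sym (trans (⨁-pointwise (λ g → monomial (b g) g) k)
            (trans (sum-single _ k off) on))
            where
            off : ∀ i → i ≢ k → 𝟙 (b i) * δ i k ≡ 0ℤ
            off i i≢k rewrite dec-false (i Fin.≟ k) i≢k = ℤ.*-zeroʳ (𝟙 (b i))
            on : 𝟙 (b k) * δ k k ≡ 𝟙 (b k)
            on rewrite dec-true (k Fin.≟ k) refl = ℤ.*-identityʳ (𝟙 (b k))

      -- By Frobenius the p-th power of u is ∑ u(g) gᵖ modulo p, and it is a multiple of
      -- the all-ones function since already u² is.
      rootSum-const : ∀ (a b : Fin n → Bool) (u : Fin n → ℤ) → (∀ g → u g ≡ 𝟙 (a g) + 𝟙 (b g)) →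
        ∀ {c d} → + p ∣ℤ d → (∀ k → (u ⋆ u) k ≡ c - d * u k) →
        ∀ h h′ → + p ∣ℤ rootSum p u h - rootSum p u h′
      rootSum-const a b u u≡a+b {c} {d} p∣d u²≡ h h′ =
        subst (+ p ∣ℤ_) (telescope (rootSum p u h) (rootSum p u h′) power-value)
          (ℤ∣.∣m∣n⇒∣m-n (rootSum≈ h) (rootSum≈ h′))
        where
        telescope : ∀ a b v → (a - v) - (b - v) ≡ a - b
        telescope = solve-∀
        -- A prime is at least 2, so `uᵖ` splits as `u² ⋆ uʳ` with `r = p - 2`.
        r = ℕ.pred (ℕ.pred p)
        1<⇒≡2+ : ∀ {m} → 1 ℕ.< m → m ≡ suc (suc (ℕ.pred (ℕ.pred m)))
        1<⇒≡2+ (ℕ.s≤s (ℕ.s≤s _)) = refl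
        p≡2+r : p ≡ suc (suc r)
        p≡2+r = 1<⇒≡2+ (ℕ.nonTrivial⇒n>1 p {{prime⇒nonTrivial prime}})
        -- Convolving the constant `c` with any function gives the constant `c` times the sum of
        -- that function, here of `uʳ`.
        power-value : ℤ
        power-value = c * sum (u ^ r)
        u²≈c : (u ⋆ u) R.≈ (λ _ → c)
        u²≈c = pointwise λ k → subst (+ p ∣ℤ_) (trans (cancel c (d * u k)) (cong (_- c) (sym (u²≡ k))))
          (ℤ∣.∣m⇒∣-m (ℤ∣.∣m⇒∣m*n (u k) p∣d))
          where
          cancel : ∀ c e → - e ≡ (c - e) - c
          cancel = solve-∀
        u^p≈ : u ^ p R.≈ (λ _ → power-value)
        u^p≈ = subst (λ m → u ^ m R.≈ (λ _ → power-value)) (sym p≡2+r)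
          (R.trans (R.sym (R.*-assoc u u (u ^ r)))
          (R.trans (R.*-congʳ {x = u ^ r} u²≈c) (≗⇒≈ (+ p) (⋆-constˡ c (u ^ r)))))
        u^p≈rootSum : u ^ p R.≈ rootSum p u
        u^p≈rootSum = R.trans (^-congˡ p (≗⇒≈ (+ p) u≡a+b))
          (R.trans (^-distrib-+ (𝟙 ∘ a) (𝟙 ∘ b))
          (R.trans (R.+-cong (indicator-^ a) (indicator-^ b))
          (≗⇒≈ (+ p) λ k → trans (sym (∑-distrib-+ (λ g → 𝟙 (a g) * δ (pow g p) k) (λ g → 𝟙 (b g) * δ (pow g p) k)))
            (sum-cong-≗ λ g → trans (sym (ℤ.*-distribʳ-+ (δ (pow g p) k) (𝟙 (a g)) (𝟙 (b g))))
                                    (cong (_* δ (pow g p) k) (sym (u≡a+b g)))))))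
        rootSum≈ : ∀ h → + p ∣ℤ rootSum p u h - power-value
        rootSum≈ = _≈_.∣-at (R.trans (R.sym u^p≈rootSum) u^p≈)

    -- Cauchy–Schwarz for u and a translate of u, with its defect.
    autocorrelation : ∀ u → (∀ g → u (g ⁻¹) ≡ u g) → ∀ g →
      sum (λ h → (u h - u ((h ⁻¹) ∙ g)) * (u h - u ((h ⁻¹) ∙ g))) ≡ + 2 * ((u ⋆ u) ε - (u ⋆ u) g)
    autocorrelation u u⁻¹≡u g = begin
      sum (λ h → (u h - u ((h ⁻¹) ∙ g)) * (u h - u ((h ⁻¹) ∙ g)))
        ≡⟨ sum-cong-≗ (λ h → square (u h) (u ((h ⁻¹) ∙ g))) ⟩
      sum (λ h → (u h * u h + u ((h ⁻¹) ∙ g) * u ((h ⁻¹) ∙ g)) - + 2 * (u h * u ((h ⁻¹) ∙ g)))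
        ≡⟨ sum-∸ (λ h → u h * u h + u ((h ⁻¹) ∙ g) * u ((h ⁻¹) ∙ g)) (λ h → + 2 * (u h * u ((h ⁻¹) ∙ g))) ⟩
      sum (λ h → u h * u h + u ((h ⁻¹) ∙ g) * u ((h ⁻¹) ∙ g)) - sum (λ h → + 2 * (u h * u ((h ⁻¹) ∙ g)))
        ≡⟨ cong₂ _-_ (∑-distrib-+ (λ h → u h * u h) (λ h → u ((h ⁻¹) ∙ g) * u ((h ⁻¹) ∙ g)))
                     (sym (*-distribˡ-sum (+ 2) (λ h → u h * u ((h ⁻¹) ∙ g)))) ⟩
      sum (λ h → u h * u h) + sum (λ h → u ((h ⁻¹) ∙ g) * u ((h ⁻¹) ∙ g)) - + 2 * (u ⋆ u) g
        ≡⟨ cong (λ s → sum (λ h → u h * u h) + s - + 2 * (u ⋆ u) g) (sum-quotient g (λ h → u h * u h)) ⟨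
      sum (λ h → u h * u h) + sum (λ h → u h * u h) - + 2 * (u ⋆ u) g
        ≡⟨ cong (λ s → s + s - + 2 * (u ⋆ u) g) (sum-cong-≗ λ h → cong (u h *_) (sym (trans (cong u (identityʳ (h ⁻¹))) (u⁻¹≡u h)))) ⟩
      (u ⋆ u) ε + (u ⋆ u) ε - + 2 * (u ⋆ u) g
        ≡⟨ double ((u ⋆ u) ε) ((u ⋆ u) g) ⟩
      + 2 * ((u ⋆ u) ε - (u ⋆ u) g) ∎
      where
      open ≡-Reasoning
      square : ∀ a b → (a - b) * (a - b) ≡ (a * a + b * b) - + 2 * (a * b)
      square = solve-∀
      double : ∀ a b → a + a - + 2 * b ≡ + 2 * (a - b)
      double = solve-∀

  -- Prime divisors, coprimality and sums over multiples

  primeDivisor : ∀ {n} → 1 ℕ.< n → ∃[ p ] (Prime p × p ∣ n)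
  primeDivisor {n} 1<n with factorise n {{ℕ.>-nonZero (ℕ.<-trans (ℕ.s≤s ℕ.z≤n) 1<n)}}
  ... | record { factors = []     ; isFactorisation = n≡1 } = contradiction n≡1 (ℕ.>⇒≢ 1<n)
  ... | record { factors = p ∷ ps ; isFactorisation = n≡  ; factorsPrime = p-prime ∷ _ } =
    p , p-prime , subst (p ∣_) (sym n≡) (ℕ∣.m∣m*n _)

  prime∤⇒coprime : ∀ {p n} → Prime p → p ∤ n → Coprime n p
  prime∤⇒coprime p-prime p∤n (d∣n , d∣p) with prime⇒irreducible p-prime d∣p
  ... | inj₁ d≡1  = d≡1
  ... | inj₂ refl = contradiction d∣n p∤n

  -- Each index is `r j + b` with `b < r`, and only `b = 0` gives a multiple of `r`. In a cyclic
  -- group this turns a sum weighted by the indicator of a subgroup into a sum over its elements.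
  sum-multiples : ∀ q r .{{_ : NonZero r}} (f : ℕ → ℤ) →
    sum {q ℕ.* r} (λ i → f (toℕ i) * 𝟙 (does (r ∣? toℕ i))) ≡ sum {q} (λ j → f (r ℕ.* toℕ j))
  sum-multiples q r@(suc r-1) f = trans (sum-combine q _) (sum-cong-≗ inner)
    where
    term : Fin q → Fin r → ℤ
    term j b = f (toℕ (combine j b)) * 𝟙 (does (r ∣? toℕ (combine j b)))
    inner : ∀ j → sum (term j) ≡ f (r ℕ.* toℕ j)
    inner j = trans (sum-single (term j) zero off) on
      where
      r∤ : ∀ b → b ≢ zero → r ∤ r ℕ.* toℕ j ℕ.+ toℕ b
      r∤ b b≢0 r∣ = ℕ∣.>⇒∤ {{ℕ.≢-nonZero (b≢0 ∘ Fin.toℕ-injective)}} (Fin.toℕ<n b)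
        (ℕ∣.∣m+n∣m⇒∣n r∣ (ℕ∣.m∣m*n (toℕ j)))
      off : ∀ b → b ≢ zero → term j b ≡ 0ℤ
      off b b≢0 rewrite Fin.toℕ-combine j b
                      | dec-false (r ∣? (r ℕ.* toℕ j ℕ.+ toℕ b)) (r∤ b b≢0) = ℤ.*-zeroʳ (f (r ℕ.* toℕ j ℕ.+ toℕ b))
      on : term j zero ≡ f (r ℕ.* toℕ j)
      on rewrite Fin.toℕ-combine j (zero {r-1}) | ℕ.+-identityʳ (r ℕ.* toℕ j)
               | dec-true (r ∣? (r ℕ.* toℕ j)) (ℕ∣.m∣m*n (toℕ j)) = ℤ.*-identityʳ (f (r ℕ.* toℕ j))

  -- Cyclic groups

  module CyclicProperties (m : ℕ) .{{_ : NonZero m}} where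
    open Cyclic m
    open Convolution ∙-isAbelianGroup public hiding (abelianGroup)
    open AbelianGroup abelianGroup public using (assoc; comm; identityˡ; identityʳ; inverseˡ; inverseʳ)
    open AbelianGroupProperties abelianGroup public
      using (⁻¹-∙-comm; ⁻¹-involutive; ε⁻¹≈ε; inverseʳ-unique; inverseˡ-unique; identityʳ-unique; identityˡ-unique)

    toℕ-x^ : ∀ i → toℕ (x^ i) ≡ i % m
    toℕ-x^ i = Fin.toℕ-fromℕ< (m%n<n i m)

    x^-cong-% : ∀ {i j} → i % m ≡ j % m → x^ i ≡ x^ j
    x^-cong-% {i} {j} eq = Fin.toℕ-injective (trans (toℕ-x^ i) (trans eq (sym (toℕ-x^ j))))

    x^-injective-% : ∀ {i j} → x^ i ≡ x^ j → i % m ≡ j % m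
    x^-injective-% {i} {j} eq = trans (sym (toℕ-x^ i)) (trans (cong toℕ eq) (toℕ-x^ j))

    x^-toℕ : ∀ g → x^ (toℕ g) ≡ g
    x^-toℕ g = Fin.toℕ-injective (trans (toℕ-x^ (toℕ g)) (m<n⇒m%n≡m (Fin.toℕ<n g)))

    0%m≡0 : 0 % m ≡ 0
    0%m≡0 = m<n⇒m%n≡m (ℕ.>-nonZero⁻¹ m)

    x^≡e⇔∣ : ∀ i → x^ i ≡ e ⇔ m ∣ i
    x^≡e⇔∣ i = mk⇔ (λ eq → ℕ∣.m%n≡0⇒n∣m i m (trans (x^-injective-% eq) 0%m≡0))
                   (λ m∣i → x^-cong-% (trans (ℕ∣.n∣m⇒m%n≡0 i m m∣i) (sym 0%m≡0)))

    x^≢e : ∀ {i} → 0 ℕ.< i → i ℕ.< m → x^ i ≢ e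
    x^≢e {i} 0<i i<m eq = ℕ∣.>⇒∤ {{ℕ.>-nonZero 0<i}} i<m (Equivalence.to (x^≡e⇔∣ i) eq)

    toℕ≡0⇒≡e : ∀ {g} → toℕ g ≡ 0 → g ≡ e
    toℕ≡0⇒≡e {g} eq = trans (sym (x^-toℕ g)) (cong x^_ eq)

    pow≡x^ : ∀ g k → pow g k ≡ x^ (k ℕ.* toℕ g)
    pow≡x^ g zero    = refl
    pow≡x^ g (suc k) = trans (cong₂ _∙_ (sym (x^-toℕ g)) (pow≡x^ g k)) (sym (x^-+ (toℕ g) (k ℕ.* toℕ g)))

    pow-∙ : ∀ g h k → pow (g ∙ h) k ≡ pow g k ∙ pow h k
    pow-∙ g h zero    = sym (identityˡ e)
    pow-∙ g h (suc k) = trans (cong ((g ∙ h) ∙_) (pow-∙ g h k)) (interchange g h (pow g k) (pow h k))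
      where
      open import Algebra.Properties.CommutativeSemigroup
        (AbelianGroup.commutativeSemigroup abelianGroup) using (interchange)

    pow-⁻¹ : ∀ g k → pow (g ⁻¹) k ≡ (pow g k) ⁻¹
    pow-⁻¹ g zero    = sym ε⁻¹≈ε
    pow-⁻¹ g (suc k) = trans (cong (g ⁻¹ ∙_) (pow-⁻¹ g k)) (⁻¹-∙-comm g (pow g k))

    kernel : ℕ → Fin m → ℤ
    kernel q g = 𝟙 (does (pow g q Fin.≟ e))

    kernel-⁻¹ : ∀ q g → kernel q (g ⁻¹) ≡ kernel q g
    kernel-⁻¹ q g = cong 𝟙 (does-⇔ (mk⇔ to from) (pow (g ⁻¹) q Fin.≟ e) (pow g q Fin.≟ e))
      where
      to : pow (g ⁻¹) q ≡ e → pow g q ≡ e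
      to eq = trans (sym (⁻¹-involutive (pow g q))) (trans (cong _⁻¹ (trans (sym (pow-⁻¹ g q)) eq)) ε⁻¹≈ε)
      from : pow g q ≡ e → pow (g ⁻¹) q ≡ e
      from eq = trans (pow-⁻¹ g q) (trans (cong _⁻¹ eq) ε⁻¹≈ε)

    kernel-e : ∀ q → kernel q e ≡ 1ℤ
    kernel-e q = cong 𝟙 (dec-true (pow e q Fin.≟ e) (pow-e q))
      where
      pow-e : ∀ k → pow e k ≡ e
      pow-e zero    = refl
      pow-e (suc k) = trans (identityˡ (pow e k)) (pow-e k)

    -- The `q`-th roots of `k^q` form the coset of `k` modulo the kernel of the `q`-th power map.
    rootSum-kernel : ∀ q u k → rootSum q u (pow k q) ≡ sum (λ g → u (k ∙ g) * kernel q g)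
    rootSum-kernel q u k = trans (sum-shift k (λ g → u g * δ (pow g q) (pow k q)))
      (sum-cong-≗ λ g → cong (λ b → u (k ∙ g) * 𝟙 b)
        (does-⇔ (mk⇔ (to g) (from g)) (pow (k ∙ g) q Fin.≟ pow k q) (pow g q Fin.≟ e)))
      where
      to : ∀ g → pow (k ∙ g) q ≡ pow k q → pow g q ≡ e
      to g eq = identityʳ-unique (pow k q) (pow g q) (trans (sym (pow-∙ k g q)) eq)
      from : ∀ g → pow g q ≡ e → pow (k ∙ g) q ≡ pow k q
      from g eq = trans (pow-∙ k g q) (trans (cong (pow k q ∙_) eq) (identityʳ (pow k q)))

    module _ (q r : ℕ) (m≡qr : m ≡ q ℕ.* r) where

      private instance
        qr≢0 : NonZero (q ℕ.* r)
        qr≢0 = subst NonZero m≡qr (ℕ.≢-nonZero (ℕ.≢-nonZero⁻¹ m))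
        q≢0 : NonZero q
        q≢0 = ℕ.m*n≢0⇒m≢0 q
        r≢0 : NonZero r
        r≢0 = ℕ.m*n≢0⇒n≢0 q

      -- In exponents: `q r ∣ q i` exactly when `r ∣ i`. So the kernel is the subgroup of order `q`
      -- generated by `x^r`.
      kernel≡multiples : ∀ g → kernel q g ≡ 𝟙 (does (r ∣? toℕ g))
      kernel≡multiples g = cong 𝟙 (does-⇔ (mk⇔ to from) (pow g q Fin.≟ e) (r ∣? toℕ g))
        where
        to : pow g q ≡ e → r ∣ toℕ g
        to eq = ℕ∣.*-cancelˡ-∣ q (subst (_∣ q ℕ.* toℕ g) m≡qr
          (Equivalence.to (x^≡e⇔∣ _) (trans (sym (pow≡x^ g q)) eq)))
        from : r ∣ toℕ g → pow g q ≡ e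
        from r∣g = trans (pow≡x^ g q) (Equivalence.from (x^≡e⇔∣ _)
          (subst (_∣ q ℕ.* toℕ g) (sym m≡qr) (ℕ∣.*-monoʳ-∣ q r∣g)))

      sum-kernel : ∀ f → sum (λ g → f g * kernel q g) ≡ sum {q} (λ j → f (x^ (r ℕ.* toℕ j)))
      sum-kernel f = trans
        (sum-cong-≗ λ g → cong₂ _*_ (cong f (sym (x^-toℕ g))) (kernel≡multiples g))
        (trans (sum-cast m≡qr (λ i → f (x^ i) * 𝟙 (does (r ∣? i)))) (sum-multiples q r (f ∘ x^_)))

  -- Zero-one values, squares and elementary inequalities

  𝟙+𝟙-cases : ∀ b b′ → 𝟙 b + 𝟙 b′ ≡ 0ℤ ⊎ 𝟙 b + 𝟙 b′ ≡ 1ℤ ⊎ 𝟙 b + 𝟙 b′ ≡ + 2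
  𝟙+𝟙-cases false false = inj₁ refl
  𝟙+𝟙-cases false true  = inj₂ (inj₁ refl)
  𝟙+𝟙-cases true  false = inj₂ (inj₁ refl)
  𝟙+𝟙-cases true  true  = inj₂ (inj₂ refl)

  i²≥0 : ∀ i → 0ℤ ℤ.≤ i * i
  i²≥0 (+ n)      = subst (0ℤ ℤ.≤_) (ℤ.pos-* n n) (ℤ.+≤+ ℕ.z≤n)
  i²≥0 ℤ.-[1+ n ] = ℤ.+≤+ ℕ.z≤n

  i²≤0⇒i≡0 : ∀ i → i * i ℤ.≤ 0ℤ → i ≡ 0ℤ
  i²≤0⇒i≡0 i i²≤0 with ℤ.i*j≡0⇒i≡0∨j≡0 i (ℤ.≤-antisym i²≤0 (i²≥0 i))
  ... | inj₁ i≡0 = i≡0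
  ... | inj₂ i≡0 = i≡0

  𝟙≥0 : ∀ b → 0ℤ ℤ.≤ 𝟙 b
  𝟙≥0 true  = ℤ.+≤+ ℕ.z≤n
  𝟙≥0 false = ℤ.≤-refl

  *𝟙≥0 : ∀ {i} → 0ℤ ℤ.≤ i → ∀ b → 0ℤ ℤ.≤ i * 𝟙 b
  *𝟙≥0 {i} i≥0 true  = subst (0ℤ ℤ.≤_) (sym (ℤ.*-identityʳ i)) i≥0
  *𝟙≥0 {i} i≥0 false = ℤ.≤-reflexive (sym (ℤ.*-zeroʳ i))

  prime∣n+n : ∀ {p n} → Prime p → 0 ℕ.< n → n ℕ.< p → p ∣ n ℕ.+ n → p ∣ 2
  prime∣n+n {p} {n} p-prime 0<n n<p p∣n+n
    with euclidsLemma 2 n p-prime (subst (p ∣_) (cong (n ℕ.+_) (sym (ℕ.+-identityʳ n))) p∣n+n)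
  ... | inj₁ p∣2 = p∣2
  ... | inj₂ p∣n = contradiction p∣n (ℕ∣.>⇒∤ {{ℕ.>-nonZero 0<n}} n<p)

  -- Index zero accounts for the strictness. It is described through `toℕ i ≡ 0` because `Fin n` has
  -- no visible `zero` while `n` is a variable.
  sum-𝟙-< : ∀ {n} (b : Fin n → Bool) → 0 ℕ.< n → (∀ i → toℕ i ≡ 0 → b i ≡ false) → sum (𝟙 ∘ b) ℤ.< + n
  sum-𝟙-< {suc n} b _ b₀ rewrite b₀ zero refl = begin-strict
    0ℤ + sum (λ i → 𝟙 (b (suc i)))  ≡⟨ ℤ.+-identityˡ _ ⟩
    sum (λ i → 𝟙 (b (suc i)))       ≤⟨ sum-mono-≤ (λ i → 𝟙≤1 (b (suc i))) ⟩
    sum {n} (λ _ → 1ℤ)              ≡⟨ trans (sum-const n 1ℤ) (ℤ.*-identityʳ (+ n)) ⟩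
    + n                             <⟨ ℤ.+<+ (ℕ.n<1+n n) ⟩
    + suc n                         ∎
    where
    open ℤ.≤-Reasoning
    𝟙≤1 : ∀ b → 𝟙 b ℤ.≤ 1ℤ
    𝟙≤1 true  = ℤ.≤-refl
    𝟙≤1 false = ℤ.+≤+ ℕ.z≤n

  -- The case where u vanishes only at e

  module TwoValued (m : ℕ) .{{_ : NonZero m}} (a : Fin m → Bool) where
    open Cyclic m hiding (_⊎_)
    open CyclicProperties m

    u : Fin m → ℤ
    u g = 𝟙 (a g) + 𝟙 (a (g ⁻¹))

    u-⁻¹ : ∀ g → u (g ⁻¹) ≡ u g
    u-⁻¹ g = trans (cong (λ h → 𝟙 (a (g ⁻¹)) + 𝟙 (a h)) (⁻¹-involutive g))
                   (ℤ.+-comm (𝟙 (a (g ⁻¹))) (𝟙 (a g)))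

    u-e : a e ≡ false → u e ≡ 0ℤ
    u-e a-e = trans (cong (λ g → 𝟙 (a e) + 𝟙 (a g)) ε⁻¹≈ε) (cong (λ b → 𝟙 b + 𝟙 b) a-e)

    defect : Fin m → Fin m → ℤ
    defect g h = (u h - u (h ⁻¹ ∙ g)) * (u h - u (h ⁻¹ ∙ g))

    defect≥0 : ∀ g h → 0ℤ ℤ.≤ defect g h
    defect≥0 g h = i²≥0 (u h - u (h ⁻¹ ∙ g))

    -- In `autocorrelation` the constants `c` cancel, and `u e = 0` removes the term `d * u e`.
    sum-defect : a e ≡ false → ∀ {c d} → (∀ k → (u ⋆ u) k ≡ c - d * u k) →
      ∀ g → sum (defect g) ≡ + 2 * (d * u g)
    sum-defect a-e {c} {d} u² g = trans (autocorrelation u u-⁻¹ g)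
      (cong (+ 2 *_) (trans (cong₂ _-_ (u² e) (u² g))
        (trans (cong (λ s → (c - d * s) - (c - d * u g)) (u-e a-e)) (cancel c d (u g)))))
      where
      cancel : ∀ c d s → (c - d * 0ℤ) - (c - d * s) ≡ d * s
      cancel = solve-∀

    module _ (a-e : a e ≡ false) (u≡0⇒≡e : ∀ g → u g ≡ 0ℤ → g ≡ e)
             {c d : ℤ} (u² : ∀ k → (u ⋆ u) k ≡ c - d * u k)
             (g₀ : Fin m) (u-g₀ : u g₀ ≡ 1ℤ) where

      private

        u-cases : ∀ {g} → g ≢ e → u g ≡ 1ℤ ⊎ u g ≡ + 2
        u-cases {g} g≢e with 𝟙+𝟙-cases (a g) (a (g ⁻¹))
        ... | inj₁ u≡0 = contradiction (u≡0⇒≡e g u≡0) g≢e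
        ... | inj₂ u≡  = u≡

        u≥0 : ∀ g → 0ℤ ℤ.≤ u g
        u≥0 g with 𝟙+𝟙-cases (a g) (a (g ⁻¹))
        ... | inj₁ u≡0        = ℤ.≤-reflexive (sym u≡0)
        ... | inj₂ (inj₁ u≡1) = subst (0ℤ ℤ.≤_) (sym u≡1) (ℤ.+≤+ ℕ.z≤n)
        ... | inj₂ (inj₂ u≡2) = subst (0ℤ ℤ.≤_) (sym u≡2) (ℤ.+≤+ ℕ.z≤n)

        u-≢ : ∀ {g h i j} → u g ≡ i → u h ≡ j → i ≢ j → g ≢ h
        u-≢ ug uh i≢j g≡h = i≢j (trans (sym ug) (trans (cong u g≡h) uh))

        defect-value : ∀ {g h i j} → u h ≡ i → u (h ⁻¹ ∙ g) ≡ j → defect g h ≡ (i - j) * (i - j)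
        defect-value uh uh⁻¹g = cong₂ (λ i j → (i - j) * (i - j)) uh uh⁻¹g

        defect-e : ∀ {g i} → u g ≡ i → defect g e ≡ (0ℤ - i) * (0ℤ - i)
        defect-e {g} ug = defect-value (u-e a-e) (trans (cong u (trans (cong (_∙ g) ε⁻¹≈ε) (identityˡ g))) ug)

        defect-self : ∀ {g i} → u g ≡ i → defect g g ≡ (i - 0ℤ) * (i - 0ℤ)
        defect-self {g} ug = defect-value ug (trans (cong u (inverseˡ g)) (u-e a-e))

        defects≤ : ∀ {g i} → u g ≡ i → ∀ {ps} → Unique ps → sumOver (defect g) ps ℤ.≤ + 2 * (d * i)
        defects≤ {g} refl {ps} unique = subst (sumOver (defect g) ps ℤ.≤_) (sum-defect a-e {c} {d} u² g)
          (sumOver-≤ unique (defect≥0 g))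

        0≢1 : 0ℤ ≢ 1ℤ
        0≢1 ()

        0≢2 : 0ℤ ≢ + 2
        0≢2 ()

        1≢2 : 1ℤ ≢ + 2
        1≢2 ()

        -- In the sum of squares for `g₀`, whose total is `2 d`, the indices `e` and `g₀` contribute
        -- 1 each.
        1≤d : 1ℤ ℤ.≤ d
        1≤d = ℤ.*-cancelˡ-≤-pos 1ℤ d (+ 2) (subst (λ s → + 2 ℤ.≤ + 2 * s) (ℤ.*-identityʳ d)
          (subst (ℤ._≤ + 2 * (d * 1ℤ))
            (cong₂ (λ s t → s + (t + 0ℤ)) (defect-e u-g₀) (defect-self u-g₀))
            (defects≤ u-g₀ ((u-≢ (u-e a-e) u-g₀ 0≢1 ∷ []) ∷ [] ∷ []))))

        -- Where `u b = 2`, the indices `e` and `b` contribute 4 each to a total of `4 d`. This is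
        -- impossible for `d = 1`, and for `d = 2` it exhausts the total.
        4+4≤2d2 : ∀ {b} → u b ≡ + 2 → ∀ {ps} → Unique (e ∷ b ∷ ps) → + 4 + (+ 4 + sumOver (defect b) ps) ℤ.≤ + 2 * (d * + 2)
        4+4≤2d2 {b} ub {ps} unique = subst (ℤ._≤ + 2 * (d * + 2))
          (cong₂ (λ s t → s + (t + sumOver (defect b) ps)) (defect-e ub) (defect-self ub))
          (defects≤ ub unique)

      -- A value 2 would require `8 ≤ 4`.
      d≡1⇒u≡1 : d ≡ 1ℤ → ∀ g → g ≢ e → u g ≡ 1ℤ
      d≡1⇒u≡1 refl g g≢e with u-cases g≢e
      ... | inj₁ u≡1 = u≡1
      ... | inj₂ u≡2 with 4+4≤2d2 u≡2 ((≢-sym g≢e ∷ []) ∷ [] ∷ [])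
      ...   | ℤ.+≤+ (ℕ.s≤s (ℕ.s≤s (ℕ.s≤s (ℕ.s≤s ()))))

      module _ (d≡2 : d ≡ + 2) where

        private
          -- For `d = 2` the total is 8, already used up by the indices `e` and `b`; every other
          -- square is therefore zero.
          translate : ∀ {b} → u b ≡ + 2 → ∀ {h} → h ≢ e → h ≢ b → u h ≡ u (h ⁻¹ ∙ b)
          translate {b} ub {h} h≢e h≢b = ℤ.i-j≡0⇒i≡j _ _ (i²≤0⇒i≡0 (u h - u (h ⁻¹ ∙ b))
            (subst (ℤ._≤ 0ℤ) (cancel (defect b h)) (ℤ.i≤j⇒i-j≤0 bound)))
            where
            cancel : ∀ s → (+ 8 + s) - + 8 ≡ s
            cancel = solve-∀
            bound : + 8 + defect b h ℤ.≤ + 8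
            bound = subst₂ ℤ._≤_ (regroup (defect b h)) (cong (λ d → + 2 * (d * + 2)) d≡2)
              (4+4≤2d2 ub ((u-≢ (u-e a-e) ub 0≢2 ∷ ≢-sym h≢e ∷ []) ∷ (≢-sym h≢b ∷ []) ∷ [] ∷ []))
              where
              regroup : ∀ s → + 4 + (+ 4 + (s + 0ℤ)) ≡ + 8 + s
              regroup = solve-∀

          -- `translate` at `h = g₀` gives `u g₀ = u (g₀⁻¹ b)`, and `u` is invariant under
          -- inversion.
          defect-g₀ : ∀ {b} → u b ≡ + 2 → u (b ⁻¹ ∙ g₀) ≡ 1ℤ
          defect-g₀ {b} ub = trans (sym (trans (translate ub (u-≢ u-g₀ (u-e a-e) (≢-sym 0≢1)) (u-≢ u-g₀ ub 1≢2))
            (trans (sym (u-⁻¹ _)) (cong u (trans (sym (⁻¹-∙-comm _ b))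
              (trans (cong (_∙ b ⁻¹) (⁻¹-involutive g₀)) (comm g₀ (b ⁻¹)))))))) u-g₀

        -- A second element of value 2 would give u and its translate by g₀ five differences,
        -- but their squares add up to 4.
        u≡2-unique : ∀ {b z} → u b ≡ + 2 → u z ≡ + 2 → b ≡ z
        u≡2-unique {b} {z} ub uz with b Fin.≟ z
        ... | yes b≡z = b≡z
        ... | no  b≢z = contradiction five≤four λ { (ℤ.+≤+ (ℕ.s≤s (ℕ.s≤s (ℕ.s≤s (ℕ.s≤s ()))))) }
          where
          -- The map `h ↦ h⁻¹ g₀` sends `w` back to `z`, so at `w` the values compared are 1 and 2.
          -- The other four differences sit at `e`, `g₀`, `b` and `z`, and each of the five squares
          -- is 1.
          w = z ⁻¹ ∙ g₀
          uw : u w ≡ 1ℤ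
          uw = defect-g₀ uz
          z≢e : z ≢ e
          z≢e = u-≢ uz (u-e a-e) (≢-sym 0≢2)
          g₀≢w : g₀ ≢ w
          g₀≢w g₀≡w = z≢e (trans (sym (⁻¹-involutive z)) (trans (cong _⁻¹ (identityˡ-unique (z ⁻¹) g₀ (sym g₀≡w))) ε⁻¹≈ε))
          unique : Unique (e ∷ g₀ ∷ b ∷ z ∷ w ∷ [])
          unique = (u-≢ (u-e a-e) u-g₀ 0≢1 ∷ u-≢ (u-e a-e) ub 0≢2 ∷ u-≢ (u-e a-e) uz 0≢2 ∷ u-≢ (u-e a-e) uw 0≢1 ∷ [])
                 ∷ (u-≢ u-g₀ ub 1≢2 ∷ u-≢ u-g₀ uz 1≢2 ∷ g₀≢w ∷ [])
                 ∷ (b≢z ∷ u-≢ ub uw (≢-sym 1≢2) ∷ [])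
                 ∷ (u-≢ uz uw (≢-sym 1≢2) ∷ [])
                 ∷ [] ∷ []
          five≤four : + 5 ℤ.≤ + 4
          five≤four = subst₂ ℤ._≤_
            (cong₂ _+_ (defect-e u-g₀) (cong₂ _+_ (defect-self u-g₀) (cong₂ _+_ (defect-value ub (defect-g₀ ub))
              (cong₂ _+_ (defect-value uz uw) (cong (_+ 0ℤ) (defect-value uw (trans (cong u ([a⁻¹b]⁻¹b≡a z g₀)) uz)))))))
            (cong (λ d → + 2 * (d * 1ℤ)) d≡2)
            (defects≤ u-g₀ unique)

      module _ {q : ℕ} (q-prime : Prime q) (q∣d : + q ∣ℤ d) where

        private
          roots≡ : ∀ h h′ → + q ∣ℤ rootSum q u h - rootSum q u h′
          roots≡ = rootSum-const q-prime a (λ g → a (g ⁻¹)) u (λ _ → refl) {c} {d} q∣d u²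

          1<q : 1 ℕ.< q
          1<q = ℕ.nonTrivial⇒n>1 q {{prime⇒nonTrivial q-prime}}

          q∤1 : q ∤ 1
          q∤1 = ℕ∣.>⇒∤ 1<q

        -- A power map with exponent prime to the group order is injective, so the root sum at `k^q`
        -- is the single value `u k`. At `g₀` and `e` these values differ by 1, yet all root sums
        -- agree modulo `q`.
        prime∣d⇒∣m : q ∣ m
        prime∣d⇒∣m with q ∣? m
        ... | yes q∣m = q∣m
        ... | no  q∤m = contradiction (ℤ∣.∣⇒∣ᵤ (subst (+ q ∣ℤ_) difference (roots≡ (pow g₀ q) (pow e q)))) q∤1
          where
          kernel≡0 : ∀ g → g ≢ e → kernel q g ≡ 0ℤ
          kernel≡0 g g≢e = cong 𝟙 (dec-false (pow g q Fin.≟ e) λ g^q≡e → g≢e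
            (trans (sym (x^-toℕ g)) (Equivalence.from (x^≡e⇔∣ (toℕ g))
              (coprime-divisor (prime∤⇒coprime q-prime q∤m)
                (Equivalence.to (x^≡e⇔∣ (q ℕ.* toℕ g)) (trans (sym (pow≡x^ g q)) g^q≡e))))))
          rootSum≡u : ∀ k → rootSum q u (pow k q) ≡ u k
          rootSum≡u k = trans (rootSum-kernel q u k) (trans
            (sum-single (λ g → u (k ∙ g) * kernel q g) e
              λ g g≢e → trans (cong (u (k ∙ g) *_) (kernel≡0 g g≢e)) (ℤ.*-zeroʳ (u (k ∙ g))))
            (trans (cong₂ _*_ (cong u (identityʳ k)) (kernel-e q)) (ℤ.*-identityʳ (u k))))
          difference : rootSum q u (pow g₀ q) - rootSum q u (pow e q) ≡ 1ℤ
          difference = cong₂ _-_ (trans (rootSum≡u g₀) u-g₀) (trans (rootSum≡u e) (u-e a-e))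

        private
          1<m : 1 ℕ.< m
          1<m = ℕ.<-≤-trans 1<q (ℕ∣.∣⇒≤ prime∣d⇒∣m)

        -- The generator x is not a q-th power, so the constant value of the root sums is 0.
        coset-sum : ∀ k → + q ∣ℤ sum (λ g → u (k ∙ g) * kernel q g)
        coset-sum k = subst (+ q ∣ℤ_)
          (trans (cong₂ _-_ (rootSum-kernel q u k) rootSum-x) (ℤ.+-identityʳ _))
          (roots≡ (pow k q) (x^ 1))
          where
          not-root : ∀ g → pow g q ≢ x^ 1
          not-root g g^q≡x = q∤1 (subst (q ∣_)
            (trans (x^-injective-% (trans (sym (pow≡x^ g q)) g^q≡x)) (m<n⇒m%n≡m 1<m))
            (ℕ∣.%-presˡ-∣ (ℕ∣.m∣m*n (toℕ g)) prime∣d⇒∣m))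
          rootSum-x : rootSum q u (x^ 1) ≡ 0ℤ
          rootSum-x = sum-0 λ g → trans
            (cong (λ b → u g * 𝟙 b) (dec-false (pow g q Fin.≟ x^ 1) (not-root g)))
            (ℤ.*-zeroʳ (u g))

        private
          r : ℕ
          r = ℕ∣.quotient prime∣d⇒∣m

          m≡qr : m ≡ q ℕ.* r
          m≡qr = ℕ∣.m∣n⇒n≡m*quotient prime∣d⇒∣m

          0<r : 0 ℕ.< r
          0<r = ℕ.>-nonZero⁻¹ r {{ℕ∣.quotient≢0 prime∣d⇒∣m}}

          r<m : r ℕ.< m
          r<m = subst (r ℕ.<_) (sym (ℕ∣.m∣n⇒n≡quotient*m prime∣d⇒∣m)) (ℕ.m<m*n r q {{ℕ.>-nonZero 0<r}} 1<q)

          z : Fin m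
          z = x^ r

          z≢e : z ≢ e
          z≢e = x^≢e 0<r r<m

        -- The kernel is closed under inversion, so `u` sums over it to `A + A`. Here `A < q`
        -- because `e` is among its `q` elements and is not counted, and `A > 0` because `u` is
        -- positive at `x^r`.
        prime∣d⇒≡2 : q ≡ 2
        prime∣d⇒≡2 = ℕ.≤-antisym (ℕ∣.∣⇒≤ q∣2) 1<q
          where
          A : ℤ
          A = sum (λ g → 𝟙 (a g) * kernel q g)

          A+A : sum (λ g → u (e ∙ g) * kernel q g) ≡ A + A
          A+A = begin
            sum (λ g → u (e ∙ g) * kernel q g)
              ≡⟨ sum-cong-≗ (λ g → trans (cong (λ h → u h * kernel q g) (identityˡ g))
                   (ℤ.*-distribʳ-+ (kernel q g) (𝟙 (a g)) (𝟙 (a (g ⁻¹))))) ⟩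
            sum (λ g → 𝟙 (a g) * kernel q g + 𝟙 (a (g ⁻¹)) * kernel q g)
              ≡⟨ ∑-distrib-+ (λ g → 𝟙 (a g) * kernel q g) (λ g → 𝟙 (a (g ⁻¹)) * kernel q g) ⟩
            A + sum (λ g → 𝟙 (a (g ⁻¹)) * kernel q g)
              ≡⟨ cong (λ s → A + s) (sum-cong-≗ (λ g → cong (𝟙 (a (g ⁻¹)) *_) (kernel-⁻¹ q g))) ⟨
            A + sum (λ g → 𝟙 (a (g ⁻¹)) * kernel q (g ⁻¹))
              ≡⟨ cong (λ s → A + s) (sum-inverse (λ g → 𝟙 (a g) * kernel q g)) ⟨
            A + A ∎
            where open ≡-Reasoning

          1≤A+A : 1ℤ ℤ.≤ A + A
          1≤A+A = subst (1ℤ ℤ.≤_) A+A (ℤ.≤-trans at-z (sumOver-≤ {f = λ g → u (e ∙ g) * kernel q g} ([] ∷ []) nonneg))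
            where
            kernel-z : kernel q z ≡ 1ℤ
            kernel-z = trans (kernel≡multiples q r m≡qr z) (cong 𝟙 (dec-true (r ∣? toℕ z)
              (subst (r ∣_) (sym (trans (toℕ-x^ r) (m<n⇒m%n≡m r<m))) ℕ∣.∣-refl)))
            at-z : 1ℤ ℤ.≤ u (e ∙ z) * kernel q z + 0ℤ
            at-z = subst (1ℤ ℤ.≤_) (sym (trans (ℤ.+-identityʳ _)
              (trans (cong₂ _*_ (cong u (identityˡ z)) kernel-z) (ℤ.*-identityʳ (u z))))) (1≤u (u-cases z≢e))
              where
              1≤u : u z ≡ 1ℤ ⊎ u z ≡ + 2 → 1ℤ ℤ.≤ u z
              1≤u (inj₁ u≡1) = ℤ.≤-reflexive (sym u≡1)
              1≤u (inj₂ u≡2) = subst (1ℤ ℤ.≤_) (sym u≡2) (ℤ.+≤+ (ℕ.s≤s ℕ.z≤n))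
            nonneg : ∀ g → 0ℤ ℤ.≤ u (e ∙ g) * kernel q g
            nonneg g = *𝟙≥0 (u≥0 (e ∙ g)) (does (pow g q Fin.≟ e))

          A<q : A ℤ.< + q
          A<q = subst (ℤ._< + q) (sym (sum-kernel q r m≡qr (λ g → 𝟙 (a g))))
            (sum-𝟙-< (λ j → a (x^ (r ℕ.* toℕ j))) (ℕ.<-trans (ℕ.s≤s ℕ.z≤n) 1<q)
              λ j j≡0 → trans (cong (λ i → a (x^ i)) (trans (cong (r ℕ.*_) j≡0) (ℕ.*-zeroʳ r))) a-e)

          0≤A : 0ℤ ℤ.≤ A
          0≤A = sum-nonneg {f = λ g → 𝟙 (a g) * kernel q g} λ g → *𝟙≥0 (𝟙≥0 (a g)) (does (pow g q Fin.≟ e))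

          q∣2 : q ∣ 2
          q∣2 = cases ℤ.∣ A ∣ (ℤ.0≤i⇒+∣i∣≡i 0≤A)
            where
            cases : ∀ n → + n ≡ A → q ∣ 2
            cases n n≡A = prime∣n+n q-prime (0<n n n≡A) (ℤ.drop‿+<+ (subst (ℤ._< + q) (sym n≡A) A<q))
              (ℤ∣.∣⇒∣ᵤ (subst (+ q ∣ℤ_) (trans A+A (cong₂ _+_ (sym n≡A) (sym n≡A))) (coset-sum e)))
              where
              0<n : ∀ n → + n ≡ A → 0 ℕ.< n
              0<n zero 0≡A with subst (λ s → 1ℤ ℤ.≤ s + s) (sym 0≡A) 1≤A+A
              ... | ℤ.+≤+ ()
              0<n (suc n) _ = ℕ.s≤s ℕ.z≤n

      private
        odd : ∀ {i} → i ≡ 1ℤ ⊎ i ≡ + 3 → ¬ + 2 ∣ℤ i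
        odd (inj₁ refl) 2∣1 = ℕ∣.>⇒∤ (ℕ.s≤s (ℕ.s≤s ℕ.z≤n)) (ℤ∣.∣⇒∣ᵤ 2∣1)
        odd (inj₂ refl) 2∣3 = contradiction (ℕ∣.n∣m⇒m%n≡0 3 2 (ℤ∣.∣⇒∣ᵤ 2∣3)) λ ()

        same-parity : ∀ {i j} → i ≡ 1ℤ ⊎ i ≡ + 2 → j ≡ 1ℤ ⊎ j ≡ + 2 → + 2 ∣ℤ i + j → i ≡ j
        same-parity (inj₁ refl) (inj₁ refl) _     = refl
        same-parity (inj₂ refl) (inj₂ refl) _     = refl
        same-parity (inj₁ refl) (inj₂ refl) 2∣i+j = contradiction 2∣i+j (odd (inj₂ refl))
        same-parity (inj₂ refl) (inj₁ refl) 2∣i+j = contradiction 2∣i+j (odd (inj₂ refl))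

        module _ (2∣d : + 2 ∣ℤ d) (r : ℕ) (m≡2r : m ≡ 2 ℕ.* r) where

          m≡r+r : m ≡ r ℕ.+ r
          m≡r+r = trans m≡2r (cong (r ℕ.+_) (ℕ.+-identityʳ r))

          z : Fin m
          z = x^ r

          z≢e : z ≢ e
          z≢e = x^≢e 0<r (subst (r ℕ.<_) (sym m≡r+r) (ℕ.m<m+n r 0<r))
            where
            0<r : 0 ℕ.< r
            0<r = ℕ.n≢0⇒n>0 λ { refl → ℕ.≢-nonZero⁻¹ m m≡2r }

          z⁻¹≡z : z ⁻¹ ≡ z
          z⁻¹≡z = sym (inverseʳ-unique z z (trans (sym (x^-+ r r)) (trans (cong x^_ (sym m≡r+r)) x^n≡e)))

          -- The kernel of squaring is the pair `e`, `z`, so `coset-sum` for the prime 2 has just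
          -- two terms.
          pair-sum : ∀ k → + 2 ∣ℤ u k + u (k ∙ z)
          pair-sum k = subst (+ 2 ∣ℤ_) (trans (sum-kernel 2 r m≡2r (λ g → u (k ∙ g)))
              (cong₂ _+_ (cong u (trans (cong (λ i → k ∙ x^ i) (ℕ.*-zeroʳ r)) (identityʳ k)))
                (trans (ℤ.+-identityʳ (u (k ∙ x^ (r ℕ.* 1)))) (cong (λ i → u (k ∙ x^ i)) (ℕ.*-identityʳ r)))))
            (coset-sum prime[2] 2∣d k)

          u-z : u z ≡ + 2
          u-z with u-cases z≢e
          ... | inj₂ u≡2 = u≡2
          ... | inj₁ u≡1 = contradiction (pair-sum e)
            (odd (inj₁ (cong₂ _+_ (u-e a-e) (trans (cong u (identityˡ z)) u≡1))))

          u-∙z : ∀ {h} → h ≢ e → h ≢ z → u h ≡ u (h ∙ z)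
          u-∙z {h} h≢e h≢z = same-parity (u-cases h≢e)
            (u-cases λ hz≡e → h≢z (trans (inverseˡ-unique h z hz≡e) z⁻¹≡z)) (pair-sum h)

          -- Since `z` is its own inverse, `h⁻¹ z` is the inverse of `h z`, and `u` agrees at `h`
          -- and `h z`: both values are 1 or 2 and have the same parity.
          defect-0 : ∀ h → h ≢ e → h ≢ z → defect z h ≡ 0ℤ
          defect-0 h h≢e h≢z = trans (defect-value refl (trans (sym (u-⁻¹ (h ⁻¹ ∙ z))) (trans
              (cong u (trans (sym (⁻¹-∙-comm (h ⁻¹) z)) (cong₂ _∙_ (⁻¹-involutive h) z⁻¹≡z)))
              (sym (u-∙z h≢e h≢z))))) (zero² (u h))
            where
            zero² : ∀ i → (i - i) * (i - i) ≡ 0ℤ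
            zero² = solve-∀

          sum-defect-z : sum (defect z) ≡ + 8
          sum-defect-z = trans (sum-extract (defect z) e) (cong₂ _+_ (defect-e u-z)
            (trans (sum-single (defect z ∖ e) z off) (trans (∖-≢ (defect z) z≢e) (defect-self u-z))))
            where
            off : ∀ h → h ≢ z → (defect z ∖ e) h ≡ 0ℤ
            off h h≢z = by-cases (h Fin.≟ e)
              where
              by-cases : Dec (h ≡ e) → (defect z ∖ e) h ≡ 0ℤ
              by-cases (yes refl) = ∖-≡ (defect z) e
              by-cases (no  h≢e)  = trans (∖-≢ (defect z) h≢e) (defect-0 h h≢e h≢z)

      -- The sum of squares at the involution is `4 d` by `sum-defect` and 8 by direct count.
      even⇒≡2 : + 2 ∣ℤ d → d ≡ + 2 × ∃[ z ] u z ≡ + 2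
      even⇒≡2 2∣d = d≡2 , z 2∣d r m≡2r , u-z 2∣d r m≡2r
        where
        r = ℕ∣.quotient (prime∣d⇒∣m prime[2] 2∣d)
        m≡2r : m ≡ 2 ℕ.* r
        m≡2r = ℕ∣.m∣n⇒n≡m*quotient (prime∣d⇒∣m prime[2] 2∣d)
        d≡2 : d ≡ + 2
        d≡2 = ℤ.*-cancelʳ-≡ d (+ 2) (+ 2) (ℤ.*-cancelˡ-≡ (+ 2) (d * + 2) (+ 4)
          (trans (sym (trans (sum-defect a-e {c} {d} u² (z 2∣d r m≡2r)) (cong (λ s → + 2 * (d * s)) (u-z 2∣d r m≡2r))))
                 (sum-defect-z 2∣d r m≡2r)))

      -- Either `d = 1`, or `d` has a prime divisor; that divisor must be 2, and then `d` itself is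
      -- 2.
      classification : (d ≡ 1ℤ × (∀ g → g ≢ e → u g ≡ 1ℤ)) ⊎
                       (d ≡ + 2 × ∃[ z ] (u z ≡ + 2 × (∀ g → u g ≡ + 2 → g ≡ z)))
      classification = cases ℤ.∣ d ∣ (ℤ.0≤i⇒+∣i∣≡i (ℤ.≤-trans (ℤ.+≤+ ℕ.z≤n) 1≤d))
        where
        cases : ∀ n → + n ≡ d → (d ≡ 1ℤ × (∀ g → g ≢ e → u g ≡ 1ℤ)) ⊎
                                (d ≡ + 2 × ∃[ z ] (u z ≡ + 2 × (∀ g → u g ≡ + 2 → g ≡ z)))
        cases zero 0≡d with subst (1ℤ ℤ.≤_) (sym 0≡d) 1≤d
        ... | ℤ.+≤+ ()
        cases (suc zero) 1≡d = inj₁ (sym 1≡d , d≡1⇒u≡1 (sym 1≡d))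
        cases (suc (suc n)) n≡d with primeDivisor {suc (suc n)} (ℕ.s≤s (ℕ.s≤s ℕ.z≤n))
        ... | q , q-prime , q∣n = even⇒two (even⇒≡2 (subst (λ q → + q ∣ℤ d) (prime∣d⇒≡2 q-prime q∣d) q∣d))
          where
          q∣d : + q ∣ℤ d
          q∣d = subst (+ q ∣ℤ_) n≡d (ℤ∣.∣ᵤ⇒∣ q∣n)
          even⇒two : d ≡ + 2 × ∃[ z ] u z ≡ + 2 → _
          even⇒two (d≡2 , z , u-z) = inj₂ (d≡2 , z , u-z , λ g u-g → u≡2-unique d≡2 u-g u-z)

  -- Reduction to a quotient

  module Projection (n m : ℕ) .{{_ : NonZero n}} .{{_ : NonZero m}} (h : ℕ) (n≡hm : n ≡ h ℕ.* m) where
    private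
      module N where
        open Cyclic n public
        open CyclicProperties n public
      module M where
        open Cyclic m public
        open CyclicProperties m public

    m∣n : m ∣ n
    m∣n = ℕ∣.divides h n≡hm

    π : Fin n → Fin m
    π g = M.x^ (toℕ g)

    π-x^ : ∀ i → π (N.x^ i) ≡ M.x^ i
    π-x^ i = M.x^-cong-% (trans (cong (_% m) (N.toℕ-x^ i)) (m∣n⇒o%n%m≡o%m m n i m∣n))

    π-∙ : ∀ g k → π (g N.∙ k) ≡ π g M.∙ π k
    π-∙ g k = trans (π-x^ (toℕ g ℕ.+ toℕ k)) (M.x^-+ (toℕ g) (toℕ k))

    π-⁻¹ : ∀ g → π (g N.⁻¹) ≡ (π g) M.⁻¹
    π-⁻¹ g = M.inverseˡ-unique (π (g N.⁻¹)) (π g)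
      (trans (sym (π-∙ (g N.⁻¹) g)) (trans (cong π (N.inverseˡ g)) (π-x^ 0)))

    π≡e⇔∣ : ∀ g → π g ≡ M.e ⇔ m ∣ toℕ g
    π≡e⇔∣ g = M.x^≡e⇔∣ (toℕ g)

    sum-π : ∀ f → sum (f ∘ π) ≡ + h * sum f
    sum-π f = trans (sum-cast n≡hm (f ∘ M.x^_)) (trans (sum-combine h (λ i → f (M.x^ (toℕ i))))
      (trans (sum-cong-≗ λ i → sum-cong-≗ λ j → cong f (Fin.toℕ-injective (trans (M.toℕ-x^ (toℕ (combine i j)))
         (remainder i j)))) (sum-const h (sum f))))
      where
      remainder : ∀ (i : Fin h) (j : Fin m) → toℕ (combine i j) % m ≡ toℕ j
      remainder i j = trans (cong (_% m) (Fin.toℕ-combine i j))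
        (trans (%-remove-+ˡ (toℕ j) (ℕ∣.m∣m*n (toℕ i))) (m<n⇒m%n≡m (Fin.toℕ<n j)))

    -- Each element of `Cₘ` has `h` preimages, which is where the factor comes from.
    ⋆-π : ∀ f f′ k → ((f ∘ π) N.⋆ (f′ ∘ π)) k ≡ + h * (f M.⋆ f′) (π k)
    ⋆-π f f′ k = trans
      (sum-cong-≗ λ i → cong (λ j → f (π i) * f′ j)
        (trans (π-∙ (i N.⁻¹) k) (cong (M._∙ π k) (π-⁻¹ i))))
      (sum-π (λ j → f j * f′ (j M.⁻¹ M.∙ π k)))

  -- Least positive exponents and periodic functions

  leastPositive : ∀ {P : ℕ → Set} → Decidable P → ∀ n → 0 ℕ.< n → P n →
    ∃[ m ] (0 ℕ.< m × P m × (∀ i → 0 ℕ.< i → i ℕ.< m → ¬ P i))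
  leastPositive {P} P? = <-rec _ step
    where
    Least = ∃[ m ] (0 ℕ.< m × P m × (∀ i → 0 ℕ.< i → i ℕ.< m → ¬ P i))
    step : ∀ n → (∀ {k} → k ℕ.< n → 0 ℕ.< k → P k → Least) → 0 ℕ.< n → P n → Least
    step n rec 0<n Pn with ℕ.anyUpTo? (λ i → (0 ℕ.<? i) ×-dec P? i) n
    ... | yes (i , i<n , 0<i , Pi) = rec i<n 0<i Pi
    ... | no none = n , 0<n , Pn , λ i 0<i i<n Pi → none (i , i<n , 0<i , Pi)

  module _ {ℓ} {A : Set ℓ} {m : ℕ} .{{_ : NonZero m}} {f : ℕ → A} (periodic : ∀ i → f (m ℕ.+ i) ≡ f i) where

    periodic-* : ∀ q i → f (q ℕ.* m ℕ.+ i) ≡ f i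
    periodic-* zero    i = refl
    periodic-* (suc q) i = trans (cong f (ℕ.+-assoc m (q ℕ.* m) i)) (trans (periodic (q ℕ.* m ℕ.+ i)) (periodic-* q i))

    periodic-% : ∀ i → f i ≡ f (i % m)
    periodic-% i = trans (cong f (trans (m≡m%n+[m/n]*n i m) (ℕ.+-comm (i % m) (i / m ℕ.* m))))
      (periodic-* (i / m) (i % m))

  -- The outcome of the analysis of `U`, transported back to `Cₙ`. The subgroup `H` has order `h`
  -- and index `m`, and membership in it is written `m ∣ toℕ g`. In the second alternative `x^r`
  -- represents the involution of `Cₙ / H`, and `u` equals 2 exactly on its coset.
  record Structure (n : ℕ) .{{_ : NonZero n}} (b : Fin n → Bool) (d : ℤ) : Set where
    open Cyclic n using (x^_; _∙_; _⁻¹)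
    open TwoValued n b using (u)
    field
      {m h}     : ℕ
      n≡hm      : n ≡ h ℕ.* m
      1<m       : 1 ℕ.< m
      invariant : ∀ g k → m ∣ toℕ g → b (g ∙ k) ≡ b k
      u≡0⇔      : ∀ g → u g ≡ 0ℤ ⇔ m ∣ toℕ g
      values    : (d ≡ + h × (∀ g → u g ≢ + 2)) ⊎
                  (d ≡ + 2 * + h × ∃[ r ] (1 ℕ.< r × m ≡ 2 ℕ.* r × u (x^ r) ≡ + 2 ×
                    (∀ g → u g ≡ + 2 → m ∣ toℕ ((x^ r) ⁻¹ ∙ g))))

  -- From the equation for `XU` to the structure of `U`

  module _ (n : ℕ) .{{_ : NonZero n}} (b : Fin n → Bool) where
    open Cyclic n hiding (_⊎_)
    open CyclicProperties n
    open TwoValued n b using (u; u-⁻¹; u-e; defect; defect≥0; sum-defect)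

    module _ (b-e : b e ≡ false) {μ d : ℤ} (x⋆u : ∀ k → ((𝟙 ∘ b) ⋆ u) k ≡ μ - d * 𝟙 (b k))
             (g₀ : Fin n) (u-g₀ : u g₀ ≡ 1ℤ) where

      private
        x : Fin n → ℤ
        x = 𝟙 ∘ b

        -- Inversion is an automorphism of an abelian group and fixes `u`. Adding this to the
        -- equation for `XU` gives the one for `U²`.
        x⁻¹⋆u : ∀ k → ((λ i → x (i ⁻¹)) ⋆ u) k ≡ (x ⋆ u) (k ⁻¹)
        x⁻¹⋆u k = trans (sum-inverse (λ i → x (i ⁻¹) * u (i ⁻¹ ∙ k)))
          (sum-cong-≗ λ i → cong₂ (λ j l → x j * l) (⁻¹-involutive i)
            (trans (sym (u-⁻¹ (i ⁻¹ ⁻¹ ∙ k))) (cong u (trans (sym (⁻¹-∙-comm (i ⁻¹ ⁻¹) k))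
              (cong (_∙ k ⁻¹) (⁻¹-involutive (i ⁻¹)))))))

        u⋆u : ∀ k → (u ⋆ u) k ≡ + 2 * μ - d * u k
        u⋆u k = trans (⋆-distribʳ-+ u x (λ i → x (i ⁻¹)) k)
          (trans (cong₂ _+_ (x⋆u k) (trans (x⁻¹⋆u k) (x⋆u (k ⁻¹)))) (regroup μ d (x k) (x (k ⁻¹))))
          where
          regroup : ∀ μ d s t → (μ - d * s) + (μ - d * t) ≡ + 2 * μ - d * (s + t)
          regroup = solve-∀

        defect≤ : ∀ g h → defect g h ℤ.≤ + 2 * (d * u g)
        defect≤ g h = subst₂ ℤ._≤_ (ℤ.+-identityʳ (defect g h)) (sum-defect b-e {+ 2 * μ} {d} u⋆u g)
          (sumOver-≤ {f = defect g} {h ∷ []} ([] ∷ []) (defect≥0 g))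

        -- In the sum of squares for `g₀` the term at `e` is 1, while `d = 0` would make the total
        -- 0.
        d≢0 : d ≢ 0ℤ
        d≢0 d≡0 = contradiction (subst₂ ℤ._≤_
            (cong₂ (λ s t → (s - t) * (s - t)) (u-e b-e)
              (trans (cong u (trans (cong (_∙ g₀) ε⁻¹≈ε) (identityˡ g₀))) u-g₀))
            (cong (λ d → + 2 * (d * u g₀)) d≡0) (defect≤ g₀ e))
          λ { (ℤ.+≤+ ()) }

        -- When `u g = 0` the whole sum of squares for `g` is zero, so `u h = u (h⁻¹ g)` for every
        -- `h`. Taking `h = g ∙ k` turns the right side into `u (k⁻¹) = u k`.
        u-invariant : ∀ {g} → u g ≡ 0ℤ → ∀ k → u (g ∙ k) ≡ u k
        u-invariant {g} ug k = trans (ℤ.i-j≡0⇒i≡j (u (g ∙ k)) (u ((g ∙ k) ⁻¹ ∙ g)) (i²≤0⇒i≡0 _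
            (subst (defect g (g ∙ k) ℤ.≤_) (trans (cong (λ s → + 2 * (d * s)) ug) (cong (+ 2 *_) (ℤ.*-zeroʳ d)))
              (defect≤ g (g ∙ k)))))
          (trans (cong u (trans ([ab]⁻¹c≡b⁻¹[a⁻¹c] g k g) (trans (cong (k ⁻¹ ∙_) (inverseˡ g)) (identityʳ (k ⁻¹)))))
            (u-⁻¹ k))

        𝟙-injective : ∀ {b b′} → 𝟙 b ≡ 𝟙 b′ → b ≡ b′
        𝟙-injective {false} {false} _ = refl
        𝟙-injective {true}  {true}  _ = refl

        -- `XU` inherits the invariance of `U`, and `d X = μ Cₙ - XU` with `d ≠ 0` passes it on to
        -- `X`.
        b-invariant : ∀ {g} → u g ≡ 0ℤ → ∀ k → b (g ∙ k) ≡ b k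
        b-invariant {g} ug k = 𝟙-injective (ℤ.*-cancelˡ-≡ d (x (g ∙ k)) (x k) {{ℤ.≢-nonZero d≢0}} dx)
          where
          shifted : (u ⋆ x) (g ∙ k) ≡ (u ⋆ x) k
          shifted = trans (sum-shift g (λ i → u i * x (i ⁻¹ ∙ (g ∙ k))))
            (sum-cong-≗ λ i → cong₂ _*_ (u-invariant ug i)
              (cong x (trans ([ab]⁻¹c≡b⁻¹[a⁻¹c] g i (g ∙ k)) (cong (i ⁻¹ ∙_) (a⁻¹[ab]≡b g k)))))
          x⋆u-shifted : μ - d * x (g ∙ k) ≡ μ - d * x k
          x⋆u-shifted = trans (sym (x⋆u (g ∙ k))) (trans (⋆-comm x u (g ∙ k))
            (trans shifted (trans (⋆-comm u x k) (x⋆u k))))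
          dx : d * x (g ∙ k) ≡ d * x k
          dx = trans (uncancel μ (d * x (g ∙ k))) (trans (cong (λ s → μ - s) x⋆u-shifted) (sym (uncancel μ (d * x k))))
            where
            uncancel : ∀ c s → s ≡ c - (c - s)
            uncancel = solve-∀

        -- The exponent of a generator of `H`. The search starts from `n`, which qualifies because
        -- `x^n = e`.
        least = leastPositive {P = λ i → u (x^ i) ≡ 0ℤ} (λ i → u (x^ i) ℤ.≟ 0ℤ)
                  n (ℕ.>-nonZero⁻¹ n) (trans (cong u x^n≡e) (u-e b-e))

      module _ (m : ℕ) (0<m : 0 ℕ.< m) (u-x^m : u (x^ m) ≡ 0ℤ)
               (minimal : ∀ i → 0 ℕ.< i → i ℕ.< m → u (x^ i) ≢ 0ℤ) where

        private
          instance
            m≢0 : NonZero m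
            m≢0 = ℕ.>-nonZero 0<m

          u-periodic : ∀ i → u (x^ (m ℕ.+ i)) ≡ u (x^ i)
          u-periodic i = trans (cong u (x^-+ m i)) (u-invariant u-x^m (x^ i))

          u≡0⇒∣ : ∀ i → u (x^ i) ≡ 0ℤ → m ∣ i
          u≡0⇒∣ i ui≡0 = ℕ∣.m%n≡0⇒n∣m i m (by-cases (i % m ℕ.≟ 0))
            where
            by-cases : Dec (i % m ≡ 0) → i % m ≡ 0
            by-cases (yes i%m≡0) = i%m≡0
            by-cases (no  i%m≢0) = contradiction (trans (sym (periodic-% u-periodic i)) ui≡0)
              (minimal (i % m) (ℕ.n≢0⇒n>0 i%m≢0) (m%n<n i m))

          u≡0⇔∣ : ∀ g → u g ≡ 0ℤ ⇔ m ∣ toℕ g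
          u≡0⇔∣ g = mk⇔ (λ ug → u≡0⇒∣ (toℕ g) (trans (cong u (x^-toℕ g)) ug)) from
            where
            from : m ∣ toℕ g → u g ≡ 0ℤ
            from m∣g = trans (cong u (sym (x^-toℕ g))) (trans (periodic-% u-periodic (toℕ g))
              (trans (cong (u ∘ x^_) (ℕ∣.n∣m⇒m%n≡0 (toℕ g) m m∣g)) (u-e b-e)))

          m∣n : m ∣ n
          m∣n = u≡0⇒∣ n (trans (cong u x^n≡e) (u-e b-e))

          h : ℕ
          h = ℕ∣.quotient m∣n

          n≡hm : n ≡ h ℕ.* m
          n≡hm = ℕ∣.m∣n⇒n≡quotient*m m∣n

          module M where
            open Cyclic m public
            open CyclicProperties m public
          open Projection n m h n≡hm using (π; π-x^; π-∙; π-⁻¹; π≡e⇔∣; ⋆-π)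

          a : Fin m → Bool
          a k = b (x^ (toℕ k))

          module A = TwoValued m a

          b≡a∘π : ∀ g → b g ≡ a (π g)
          b≡a∘π g = trans (cong b (sym (x^-toℕ g)))
            (trans (periodic-% (λ i → trans (cong b (x^-+ m i)) (b-invariant u-x^m (x^ i))) (toℕ g))
              (cong (b ∘ x^_) (sym (M.toℕ-x^ (toℕ g)))))

          u≡u∘π : ∀ g → u g ≡ A.u (π g)
          u≡u∘π g = cong₂ (λ b b′ → 𝟙 b + 𝟙 b′) (b≡a∘π g)
            (trans (b≡a∘π (g ⁻¹)) (cong a (π-⁻¹ g)))

          π-section : ∀ k → π (x^ (toℕ k)) ≡ k
          π-section k = trans (π-x^ (toℕ k)) (M.x^-toℕ k)

          uₘ : ∀ k → A.u k ≡ u (x^ (toℕ k))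
          uₘ k = sym (trans (u≡u∘π (x^ (toℕ k))) (cong A.u (π-section k)))

          h⋆ : ∀ k → + h * (A.u M.⋆ A.u) k ≡ + 2 * μ - d * A.u k
          h⋆ k = trans (cong (λ k → + h * (A.u M.⋆ A.u) k) (sym (π-section k)))
            (trans (sym (⋆-π A.u A.u (x^ (toℕ k))))
            (trans (sym (⋆-cong u≡u∘π u≡u∘π (x^ (toℕ k))))
            (trans (u⋆u (x^ (toℕ k))) (cong (λ s → + 2 * μ - d * s) (sym (uₘ k))))))

          aₑ : a M.e ≡ false
          aₑ = trans (cong (b ∘ x^_) (trans (M.toℕ-x^ 0) M.0%m≡0)) b-e

          uₑ : A.u M.e ≡ 0ℤ
          uₑ = trans (uₘ M.e) (trans (cong (u ∘ x^_) (trans (M.toℕ-x^ 0) M.0%m≡0)) (u-e b-e))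

          u-πg₀ : A.u (π g₀) ≡ 1ℤ
          u-πg₀ = trans (sym (u≡u∘π g₀)) u-g₀

          -- On `Cₘ` the equation reads `h u² = 2 μ - d u`. Subtracting the value of `u²` at `g₀`,
          -- where `u = 1`, from that at `e`, where `u = 0`, produces `d / h` directly as an
          -- integer.
          c d′ : ℤ
          c  = (A.u M.⋆ A.u) M.e
          d′ = c - (A.u M.⋆ A.u) (π g₀)

          hc : + h * c ≡ + 2 * μ
          hc = trans (h⋆ M.e) (trans (cong (λ s → + 2 * μ - d * s) uₑ) (minus-zero (+ 2 * μ) d))
            where
            minus-zero : ∀ c d → c - d * 0ℤ ≡ c
            minus-zero = solve-∀

          d≡d′h : d ≡ d′ * + h
          d≡d′h = sym (trans (expand c ((A.u M.⋆ A.u) (π g₀)) (+ h))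
            (trans (cong₂ _-_ hc (trans (h⋆ (π g₀)) (cong (λ s → + 2 * μ - d * s) u-πg₀))) (cancel (+ 2 * μ) d)))
            where
            expand : ∀ a b h → (a - b) * h ≡ h * a - h * b
            expand = solve-∀
            cancel : ∀ c d → c - (c - d * 1ℤ) ≡ d
            cancel = solve-∀

          h≢0 : h ≢ 0
          h≢0 h≡0 = ℕ.≢-nonZero⁻¹ n (trans n≡hm (cong (ℕ._* m) h≡0))

          u⋆uₘ : ∀ k → (A.u M.⋆ A.u) k ≡ c - d′ * A.u k
          u⋆uₘ k = ℤ.*-cancelˡ-≡ (+ h) _ _ {{ℕ.≢-nonZero h≢0}}
            (trans (h⋆ k) (trans (cong₂ (λ c d → c - d * A.u k) (sym hc) d≡d′h) (factor (+ h) c d′ (A.u k))))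
            where
            factor : ∀ h c d s → h * c - d * h * s ≡ h * (c - d * s)
            factor = solve-∀

          uₘ≡0⇒≡e : ∀ k → A.u k ≡ 0ℤ → k ≡ M.e
          uₘ≡0⇒≡e k uk≡0 = trans (sym (M.x^-toℕ k)) (Equivalence.from (M.x^≡e⇔∣ (toℕ k))
            (u≡0⇒∣ (toℕ k) (trans (sym (uₘ k)) uk≡0)))

          1<m′ : 1 ℕ.< m
          1<m′ = ℕ.≤∧≢⇒< 0<m λ 1≡m → contradiction
            (trans (sym (Equivalence.from (u≡0⇔∣ g₀) (subst (_∣ toℕ g₀) 1≡m (ℕ∣.1∣ toℕ g₀)))) u-g₀) λ ()

          -- `z⁻¹` has value 2 as well, so uniqueness makes `z` an involution. Its exponent `r`
          -- satisfies `0 < r < m` and `m ∣ 2 r`, and the quotient can only be 1.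
          involution : ∀ z → A.u z ≡ + 2 → (∀ g → A.u g ≡ + 2 → g ≡ z) →
            ∃[ r ] (1 ℕ.< r × m ≡ 2 ℕ.* r × u (x^ r) ≡ + 2 × (∀ g → u g ≡ + 2 → m ∣ toℕ ((x^ r) ⁻¹ ∙ g)))
          involution z uz unique = r , 1<r , m≡2r , trans (sym (uₘ z)) uz , same-coset
            where
            r = toℕ z
            0<r : 0 ℕ.< r
            0<r = ℕ.n≢0⇒n>0 λ r≡0 → contradiction (trans (sym uz) (trans (cong A.u (M.toℕ≡0⇒≡e r≡0)) uₑ)) λ ()
            z∙z≡e : z M.∙ z ≡ M.e
            z∙z≡e = trans (cong (M._∙ z) (sym (unique (z M.⁻¹) (trans (A.u-⁻¹ z) uz)))) (M.inverseˡ z)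
            m∣2r : m ∣ 2 ℕ.* r
            m∣2r = subst (m ∣_) (cong (r ℕ.+_) (sym (ℕ.+-identityʳ r)))
              (Equivalence.to (M.x^≡e⇔∣ (r ℕ.+ r)) z∙z≡e)
            m≡2r : m ≡ 2 ℕ.* r
            m≡2r = sym (2r≡ (ℕ∣.quotient m∣2r) (ℕ∣.m∣n⇒n≡quotient*m m∣2r))
              where
              2r≡ : ∀ q → 2 ℕ.* r ≡ q ℕ.* m → 2 ℕ.* r ≡ m
              2r≡ zero          2r≡0 = contradiction (ℕ.m+n≡0⇒m≡0 r 2r≡0) (ℕ.>⇒≢ 0<r)
              2r≡ (suc zero)    2r≡m = trans 2r≡m (ℕ.+-identityʳ m)
              2r≡ (suc (suc q)) 2r≡  = contradiction 2r≡ (ℕ.<⇒≢ (ℕ.<-≤-trans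
                (ℕ.*-monoʳ-< 2 (Fin.toℕ<n z)) (ℕ.*-monoˡ-≤ m (ℕ.s≤s (ℕ.s≤s (ℕ.z≤n {q}))))))
            -- Three values of u occur on Cₘ, so m ≠ 2.
            1<r : 1 ℕ.< r
            1<r = ℕ.≤∧≢⇒< 0<r λ 1≡r → two-values (toℕ (π g₀)) refl
              (subst (toℕ (π g₀) ℕ.<_) (trans m≡2r (cong (2 ℕ.*_) (sym 1≡r))) (Fin.toℕ<n (π g₀))) 1≡r
              where
              two-values : ∀ t → toℕ (π g₀) ≡ t → t ℕ.< 2 → ¬ 1 ≡ r
              two-values zero t≡ _ _ = contradiction
                (trans (sym u-πg₀) (trans (cong A.u (M.toℕ≡0⇒≡e t≡)) uₑ)) λ ()
              two-values (suc zero) t≡ _ 1≡r = contradiction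
                (trans (sym u-πg₀) (trans (cong A.u (Fin.toℕ-injective (trans t≡ 1≡r))) uz)) λ ()
              two-values (suc (suc t)) _ (ℕ.s≤s (ℕ.s≤s ())) _
            same-coset : ∀ g → u g ≡ + 2 → m ∣ toℕ ((x^ r) ⁻¹ ∙ g)
            same-coset g ug = Equivalence.to (π≡e⇔∣ ((x^ r) ⁻¹ ∙ g)) (trans (π-∙ ((x^ r) ⁻¹) g)
              (trans (cong₂ M._∙_ (trans (π-⁻¹ (x^ r)) (cong M._⁻¹ (π-section z)))
                                  (unique (π g) (trans (sym (u≡u∘π g)) ug)))
                (M.inverseˡ z)))

          values : (d ≡ + h × (∀ g → u g ≢ + 2)) ⊎
                   (d ≡ + 2 * + h × ∃[ r ] (1 ℕ.< r × m ≡ 2 ℕ.* r × u (x^ r) ≡ + 2 ×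
                     (∀ g → u g ≡ + 2 → m ∣ toℕ ((x^ r) ⁻¹ ∙ g))))
          values = cases (A.classification aₑ uₘ≡0⇒≡e {c} {d′} u⋆uₘ (π g₀) u-πg₀)
            where
            cases : (d′ ≡ 1ℤ × (∀ g → g ≢ M.e → A.u g ≡ 1ℤ)) ⊎
                    (d′ ≡ + 2 × ∃[ z ] (A.u z ≡ + 2 × (∀ g → A.u g ≡ + 2 → g ≡ z))) → _
            cases (inj₁ (d′≡1 , u≡1)) = inj₁ (trans d≡d′h (trans (cong (_* + h) d′≡1) (ℤ.*-identityˡ (+ h))) , u≢2)
              where
              u≢2 : ∀ g → u g ≢ + 2
              u≢2 g ug = contradiction (trans (sym uπg) (u≡1 (π g) λ πg≡e →
                  contradiction (trans (sym uπg) (trans (cong A.u πg≡e) uₑ)) λ ())) λ ()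
                where
                uπg : A.u (π g) ≡ + 2
                uπg = trans (sym (u≡u∘π g)) ug
            cases (inj₂ (d′≡2 , z , uz , unique)) =
              inj₂ (trans d≡d′h (cong (_* + h) d′≡2) , involution z uz unique)

        structureOf : Structure n b d
        structureOf = record
          { n≡hm      = n≡hm
          ; 1<m       = 1<m′
          ; invariant = λ g k m∣g → b-invariant (Equivalence.from (u≡0⇔∣ g) m∣g) k
          ; u≡0⇔      = u≡0⇔∣
          ; values    = values
          }

      structure : Structure n b d
      structure with m , 0<m , u-x^m , minimal ← least = structureOf m 0<m u-x^m minimal

  -- Subsets of `Fin n` through their characteristic functions

  Bool-ext : ∀ {b b′} → (b ≡ true → b′ ≡ true) → (b′ ≡ true → b ≡ true) → b ≡ b′
  Bool-ext {false} {false} _ _ = refl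
  Bool-ext {false} {true}  _ f = f refl
  Bool-ext {true}  {b′}    f _ = sym (f refl)

  does-true⇒ : ∀ {ℓ} {P : Set ℓ} (P? : Dec P) → does P? ≡ true → P
  does-true⇒ (yes p) _ = p

  ∈⇔lookup : ∀ {n} {X : Subset n} {g} → g ∈ X ⇔ lookup X g ≡ true
  ∈⇔lookup {X = X} {g} = mk⇔ []=⇒lookup (lookup⇒[]= g X)

  ∈-tabulate⇔ : ∀ {n ℓ} {P : Fin n → Set ℓ} (P? : ∀ h → Dec (P h)) {h} → h ∈ tabulate (does ∘ P?) ⇔ P h
  ∈-tabulate⇔ P? {h} = mk⇔
    (λ h∈ → does-true⇒ (P? h) (trans (sym (lookup∘tabulate (does ∘ P?) h)) ([]=⇒lookup h∈)))
    (λ Ph → lookup⇒[]= h _ (trans (lookup∘tabulate (does ∘ P?) h) (dec-true (P? h) Ph)))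

  lookup-ext : ∀ {n} {X Y : Subset n} → (∀ g → lookup X g ≡ lookup Y g) → X ≡ Y
  lookup-ext {X = X} {Y} eq = trans (sym (tabulate∘lookup X)) (trans (tabulate-cong eq) (tabulate∘lookup Y))

  lookup-∪ : ∀ {n} (X Y : Subset n) g → lookup (X ∪ Y) g ≡ lookup X g ∨ lookup Y g
  lookup-∪ X Y g = lookup-zipWith _∨_ g X Y

  lookup-∩ : ∀ {n} (X Y : Subset n) g → lookup (X ∩ Y) g ≡ lookup X g ∧ lookup Y g
  lookup-∩ X Y g = lookup-zipWith _∧_ g X Y

  lookup-full─ : ∀ {n} (X : Subset n) g → lookup (full ─ X) g ≡ not (lookup X g)
  lookup-full─ (false ∷ X) zero    = refl
  lookup-full─ (true ∷ X)  zero    = refl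
  lookup-full─ (_ ∷ X)     (suc g) = lookup-full─ X g

  -- Cosets of ⟨ xʷ ⟩

  module Cosets (n : ℕ) .{{_ : NonZero n}} {w : ℕ} (w∣n : w ∣ n) where
    open Cyclic n hiding (_⊎_)
    open CyclicProperties n

    private instance
      w≢0 : NonZero w
      w≢0 = ℕ.≢-nonZero λ { refl → ℕ.≢-nonZero⁻¹ n (ℕ∣.0∣⇒≡0 w∣n) }

    ∣x^⇔∣ : ∀ i → w ∣ toℕ (x^ i) ⇔ w ∣ i
    ∣x^⇔∣ i = mk⇔ (λ w∣ → ℕ∣.∣n∣m%n⇒∣m w∣n (subst (w ∣_) (toℕ-x^ i) w∣))
                  (λ w∣i → subst (w ∣_) (sym (toℕ-x^ i)) (ℕ∣.%-presˡ-∣ w∣i w∣n))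

    ∣∙⇔∣ : ∀ {g} → w ∣ toℕ g → ∀ k → w ∣ toℕ (g ∙ k) ⇔ w ∣ toℕ k
    ∣∙⇔∣ {g} w∣g k = mk⇔ (λ w∣gk → ℕ∣.∣m+n∣m⇒∣n (Equivalence.to (∣x^⇔∣ (toℕ g ℕ.+ toℕ k)) w∣gk) w∣g)
                         (λ w∣k → Equivalence.from (∣x^⇔∣ (toℕ g ℕ.+ toℕ k)) (ℕ∣.∣m∣n⇒∣m+n w∣g w∣k))

    ∈⟨x^⟩⇔ : ∀ {g} → g ∈ ⟨x^ w ⟩ ⇔ w ∣ toℕ g
    ∈⟨x^⟩⇔ {g} = mk⇔ to from
      where
      image⇔ = ∈-tabulate⇔ (λ h → Fin.any? λ i → (i ∈? full) ×-dec (x^ (w ℕ.* toℕ i) Fin.≟ h)) {g}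
      to : g ∈ ⟨x^ w ⟩ → w ∣ toℕ g
      to g∈ = on-image (Equivalence.to image⇔ g∈)
        where
        on-image : ∃[ i ] (i ∈ full × x^ (w ℕ.* toℕ i) ≡ g) → w ∣ toℕ g
        on-image (i , _ , eq) = subst (λ h → w ∣ toℕ h) eq (Equivalence.from (∣x^⇔∣ (w ℕ.* toℕ i)) (ℕ∣.m∣m*n (toℕ i)))
      from : w ∣ toℕ g → g ∈ ⟨x^ w ⟩
      from w∣g@(ℕ∣.divides q g≡qw) = Equivalence.from image⇔
        (Fin.fromℕ< q<n , ∈⊤ , trans (cong x^_ (trans (cong (w ℕ.*_) (Fin.toℕ-fromℕ< q<n))
          (trans (ℕ.*-comm w q) (sym g≡qw)))) (x^-toℕ g))
        where
        q<n : q ℕ.< n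
        q<n = ℕ.≤-<-trans (ℕ.≤-trans (ℕ.m≤m*n q w) (ℕ.≤-reflexive (sym g≡qw))) (Fin.toℕ<n g)

    lookup-⟨x^⟩ : ∀ g → lookup ⟨x^ w ⟩ g ≡ does (w ∣? toℕ g)
    lookup-⟨x^⟩ g = Bool-ext
      (λ eq → dec-true (w ∣? toℕ g) (Equivalence.to ∈⟨x^⟩⇔ (Equivalence.from ∈⇔lookup eq)))
      (λ eq → Equivalence.to ∈⇔lookup (Equivalence.from ∈⟨x^⟩⇔ (does-true⇒ (w ∣? toℕ g) eq)))

    ∈translate⇔ : ∀ s X {h} → h ∈ s · X ⇔ (s ⁻¹ ∙ h) ∈ X
    ∈translate⇔ s X {h} = mk⇔ (λ h∈ → to (Equivalence.to image⇔ h∈)) from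
      where
      image⇔ = ∈-tabulate⇔ (λ h → Fin.any? λ g → (g ∈? X) ×-dec (s ∙ g Fin.≟ h)) {h}
      to : ∃[ g ] (g ∈ X × s ∙ g ≡ h) → (s ⁻¹ ∙ h) ∈ X
      to (g , g∈X , sg≡h) = subst (_∈ X) (trans (sym (a⁻¹[ab]≡b s g)) (cong (s ⁻¹ ∙_) sg≡h)) g∈X
      from : (s ⁻¹ ∙ h) ∈ X → h ∈ s · X
      from s⁻¹h∈X = Equivalence.from image⇔ (s ⁻¹ ∙ h , s⁻¹h∈X , a[a⁻¹b]≡b s h)

    lookup-translate : ∀ s X h → lookup (s · X) h ≡ lookup X (s ⁻¹ ∙ h)
    lookup-translate s X h = Bool-ext
      (λ eq → Equivalence.to ∈⇔lookup (Equivalence.to (∈translate⇔ s X) (Equivalence.from ∈⇔lookup eq)))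
      (λ eq → Equivalence.to ∈⇔lookup (Equivalence.from (∈translate⇔ s X) (Equivalence.from ∈⇔lookup eq)))

    lookup-⁻¹ : ∀ X g → lookup (X ⁽⁻¹⁾) g ≡ lookup X (g ⁻¹)
    lookup-⁻¹ X g = Bool-ext
      (λ eq → Equivalence.to ∈⇔lookup (to (Equivalence.to image⇔ (Equivalence.from ∈⇔lookup eq))))
      (λ eq → Equivalence.to ∈⇔lookup (Equivalence.from image⇔ (g ⁻¹ , Equivalence.from ∈⇔lookup eq , ⁻¹-involutive g)))
      where
      image⇔ = ∈-tabulate⇔ (λ h → Fin.any? λ g → (g ∈? X) ×-dec (g ⁻¹ Fin.≟ h)) {g}
      to : ∃[ k ] (k ∈ X × k ⁻¹ ≡ g) → (g ⁻¹) ∈ X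
      to (k , k∈X , k⁻¹≡g) = subst (_∈ X) (trans (sym (⁻¹-involutive k)) (cong _⁻¹ k⁻¹≡g)) k∈X

    ∈·⟨x^⟩⇔ : ∀ T {h} → h ∈ T ·⟨x^ w ⟩ ⇔ (∃[ s ] (s ∈ T × w ∣ toℕ (s ⁻¹ ∙ h)))
    ∈·⟨x^⟩⇔ T {h} = mk⇔ (λ h∈ → to (Equivalence.to coset⇔ h∈))
        (λ { (s , s∈T , w∣) → Equivalence.from coset⇔ (s , s∈T ,
               Equivalence.from (∈translate⇔ s ⟨x^ w ⟩) (Equivalence.from ∈⟨x^⟩⇔ w∣)) })
      where
      coset⇔ = ∈-tabulate⇔ (λ h → Fin.any? λ s → (s ∈? T) ×-dec (h ∈? (s · ⟨x^ w ⟩))) {h}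
      to : ∃[ s ] (s ∈ T × h ∈ s · ⟨x^ w ⟩) → ∃[ s ] (s ∈ T × w ∣ toℕ (s ⁻¹ ∙ h))
      to (s , s∈T , h∈s) = s , s∈T , Equivalence.to ∈⟨x^⟩⇔ (Equivalence.to (∈translate⇔ s ⟨x^ w ⟩) h∈s)

    Invariant : ∀ {a} {A : Set a} → (Fin n → A) → Set a
    Invariant f = ∀ g k → w ∣ toℕ g → f (g ∙ k) ≡ f k

    ·⟨x^⟩-invariant : ∀ T → Invariant (lookup (T ·⟨x^ w ⟩))
    ·⟨x^⟩-invariant T g k w∣g = Bool-ext
      (λ eq → Equivalence.to ∈⇔lookup (Equivalence.from (∈·⟨x^⟩⇔ T)
        (map-coset (λ s → Equivalence.to (shift s)) (Equivalence.to (∈·⟨x^⟩⇔ T) (Equivalence.from ∈⇔lookup eq)))))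
      (λ eq → Equivalence.to ∈⇔lookup (Equivalence.from (∈·⟨x^⟩⇔ T)
        (map-coset (λ s → Equivalence.from (shift s)) (Equivalence.to (∈·⟨x^⟩⇔ T) (Equivalence.from ∈⇔lookup eq)))))
      where
      shift : ∀ s → w ∣ toℕ (s ⁻¹ ∙ (g ∙ k)) ⇔ w ∣ toℕ (s ⁻¹ ∙ k)
      shift s = subst (λ h → w ∣ toℕ h ⇔ w ∣ toℕ (s ⁻¹ ∙ k))
        (trans (sym (assoc g (s ⁻¹) k)) (trans (cong (_∙ k) (comm g (s ⁻¹))) (assoc (s ⁻¹) g k)))
        (∣∙⇔∣ w∣g (s ⁻¹ ∙ k))
      map-coset : ∀ {h h′} → (∀ s → w ∣ toℕ (s ⁻¹ ∙ h) → w ∣ toℕ (s ⁻¹ ∙ h′)) →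
        ∃[ s ] (s ∈ T × w ∣ toℕ (s ⁻¹ ∙ h)) → ∃[ s ] (s ∈ T × w ∣ toℕ (s ⁻¹ ∙ h′))
      map-coset f (s , s∈T , w∣) = s , s∈T , f s w∣

    -- The canonical choice of `T` and `T′`: the representatives with exponent below `w`. Exponent 0
    -- is excluded later by `e ∉ X`.
    transversal : Subset n → Subset n
    transversal X = tabulate λ g → does ((g ∈? X) ×-dec (toℕ g ℕ.<? w))

    ∈transversal⇔ : ∀ X {g} → g ∈ transversal X ⇔ (g ∈ X × toℕ g ℕ.< w)
    ∈transversal⇔ X = ∈-tabulate⇔ (λ g → (g ∈? X) ×-dec (toℕ g ℕ.<? w))

    transversal⊆ : ∀ X → e ∉ X → transversal X ⊆x⋯x^[ w -1]
    transversal⊆ X e∉X {g} g∈T = on-pair (Equivalence.to (∈transversal⇔ X) g∈T)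
      where
      on-pair : g ∈ X × toℕ g ℕ.< w → ∃[ i ] (1 ℕ.≤ i × i ℕ.< w × g ≡ x^ i)
      on-pair (g∈X , g<w) = toℕ g , ℕ.n≢0⇒n>0 (λ g≡0 → e∉X (subst (_∈ X) (toℕ≡0⇒≡e g≡0) g∈X)) , g<w , sym (x^-toℕ g)

    -- Dividing the exponent of `g` by `w` writes `g` as an element of `⟨x^w⟩` times a
    -- representative, and invariance moves membership in `X` between the two.
    transversal-covers : ∀ X → Invariant (lookup X) → X ≡ transversal X ·⟨x^ w ⟩
    transversal-covers X invariant = lookup-ext λ g → Bool-ext
      (λ eq → Equivalence.to ∈⇔lookup (Equivalence.from (∈·⟨x^⟩⇔ (transversal X)) (into g eq)))
      (λ eq → out g (Equivalence.to (∈·⟨x^⟩⇔ (transversal X)) (Equivalence.from ∈⇔lookup eq)))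
      where
      into : ∀ g → lookup X g ≡ true → ∃[ s ] (s ∈ transversal X × w ∣ toℕ (s ⁻¹ ∙ g))
      into g g∈X = s , Equivalence.from (∈transversal⇔ X)
          ( Equivalence.from ∈⇔lookup (trans (sym (invariant k s w∣k)) (trans (cong (lookup X) k∙s≡g) g∈X))
          , ℕ.≤-<-trans (ℕ.≤-trans (ℕ.≤-reflexive (toℕ-x^ (toℕ g % w))) (m%n≤m (toℕ g % w) n)) (m%n<n (toℕ g) w))
        , subst (λ h → w ∣ toℕ h) (sym (trans (cong (s ⁻¹ ∙_) (sym k∙s≡g))
            (trans (cong (s ⁻¹ ∙_) (comm k s)) (a⁻¹[ab]≡b s k)))) w∣k
        where
        s = x^ (toℕ g % w)
        k = x^ (toℕ g / w ℕ.* w)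
        w∣k : w ∣ toℕ k
        w∣k = Equivalence.from (∣x^⇔∣ (toℕ g / w ℕ.* w)) (ℕ∣.n∣m*n (toℕ g / w))
        k∙s≡g : k ∙ s ≡ g
        k∙s≡g = trans (sym (x^-+ (toℕ g / w ℕ.* w) (toℕ g % w)))
          (trans (cong x^_ (trans (ℕ.+-comm (toℕ g / w ℕ.* w) (toℕ g % w)) (sym (m≡m%n+[m/n]*n (toℕ g) w)))) (x^-toℕ g))
      out : ∀ g → ∃[ s ] (s ∈ transversal X × w ∣ toℕ (s ⁻¹ ∙ g)) → lookup X g ≡ true
      out g (s , s∈T , w∣) = trans (cong (lookup X) (sym (trans (comm (s ⁻¹ ∙ g) s) (a[a⁻¹b]≡b s g))))
        (trans (invariant (s ⁻¹ ∙ g) s w∣) (Equivalence.to ∈⇔lookup (proj₁ (Equivalence.to (∈transversal⇔ X) s∈T))))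

    coset : Fin n → Fin n → ℤ
    coset z g = 𝟙 (does (w ∣? toℕ (z ⁻¹ ∙ g)))

    -- In the group ring `zH f = h · z f` for `f` constant on the cosets of `H`: all `h` terms of
    -- the sum coincide.
    coset-⋆ : ∀ {h} → n ≡ h ℕ.* w → ∀ {f : Fin n → ℤ} → Invariant f → ∀ z k →
              (coset z ⋆ f) k ≡ + h * f (z ⁻¹ ∙ k)
    coset-⋆ {h} n≡hw {f} invariant z k = begin
      sum (λ i → coset z i * f (i ⁻¹ ∙ k))
        ≡⟨ sum-shift z (λ i → coset z i * f (i ⁻¹ ∙ k)) ⟩
      sum (λ j → 𝟙 (does (w ∣? toℕ (z ⁻¹ ∙ (z ∙ j)))) * f ((z ∙ j) ⁻¹ ∙ k))
        ≡⟨ sum-cong-≗ (λ j → cong₂ (λ i i′ → 𝟙 (does (w ∣? toℕ i)) * f i′) (a⁻¹[ab]≡b z j) ([ab]⁻¹c≡b⁻¹[a⁻¹c] z j k)) ⟩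
      sum (λ j → 𝟙 (does (w ∣? toℕ j)) * f (j ⁻¹ ∙ (z ⁻¹ ∙ k)))
        ≡⟨ sum-cong-≗ (λ j → on-subgroup j (w ∣? toℕ j)) ⟩
      sum {n} (λ j → f (z ⁻¹ ∙ k) * 𝟙 (does (w ∣? toℕ j)))
        ≡⟨ trans (sum-cast n≡hw (λ i → f (z ⁻¹ ∙ k) * 𝟙 (does (w ∣? i)))) (sum-multiples h w (λ _ → f (z ⁻¹ ∙ k))) ⟩
      sum {h} (λ _ → f (z ⁻¹ ∙ k))
        ≡⟨ sum-const h (f (z ⁻¹ ∙ k)) ⟩
      + h * f (z ⁻¹ ∙ k) ∎
      where
      open ≡-Reasoning
      on-subgroup : ∀ j (w∣?j : Dec (w ∣ toℕ j)) →
        𝟙 (does w∣?j) * f (j ⁻¹ ∙ (z ⁻¹ ∙ k)) ≡ f (z ⁻¹ ∙ k) * 𝟙 (does w∣?j)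
      on-subgroup j (no _)    = sym (ℤ.*-zeroʳ (f (z ⁻¹ ∙ k)))
      on-subgroup j (yes w∣j) = trans (ℤ.*-identityˡ _) (trans
        (sym (invariant j (j ⁻¹ ∙ (z ⁻¹ ∙ k)) w∣j))
        (trans (cong f (a[a⁻¹b]≡b j (z ⁻¹ ∙ k))) (sym (ℤ.*-identityʳ _))))

  open import Data.Fin.Subset using (∣_∣)

  sum-𝟙≡∣∣ : ∀ {n} (X : Subset n) → sum (𝟙 ∘ lookup X) ≡ + ∣ X ∣
  sum-𝟙≡∣∣ []          = refl
  sum-𝟙≡∣∣ (true ∷ X)  = cong (λ s → 1ℤ + s) (sum-𝟙≡∣∣ X)
  sum-𝟙≡∣∣ (false ∷ X) = trans (ℤ.+-identityˡ (sum (𝟙 ∘ lookup X))) (sum-𝟙≡∣∣ X)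

  -- The adjacency matrix of a dihedrant

  module DihedrantMatrix (n : ℕ) .{{_ : NonZero n}} (X : Subset n) where
    open Cyclic n hiding (_⊎_)
    open CyclicProperties n
    open TwoValued n (lookup X) using (u; u-⁻¹)
    open Digraph (Dih n X X) using (enum)
    open Matrices (Dih n X X)
    private module Dₙ = Dihedral n

    x : Fin n → ℤ
    x = 𝟙 ∘ lookup X

    -- The same `X` governs rotations and reflections, so adjacency depends on `g⁻¹ h` only through
    -- its exponent.
    exponent : D n → Fin n
    exponent (rot i) = i
    exponent (ref i) = i

    _↦_ : D n → D n → Fin n
    g ↦ h = exponent (g Dₙ.⁻¹ Dₙ.∙ h)

    A≡x : ∀ g h → A g h ≡ x (g ↦ h)
    A≡x g h = connection (g Dₙ.⁻¹ Dₙ.∙ h)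
      where
      connection : ∀ s → 𝟙 ((X Dₙ.∪ X τ) s) ≡ x (exponent s)
      connection (rot i) = refl
      connection (ref i) = refl

    sum-D : ∀ (F : D n → ℤ) → sum (F ∘ Inverse.to enum) ≡ sum (F ∘ rot) + sum (F ∘ ref)
    sum-D F = trans (sum-combine 2 {n} (F ∘ Inverse.to enum))
      (cong₂ _+_ (sum-cong-≗ {n} λ j → cong F (Inverse.strictlyInverseˡ enum (rot j)))
        (trans (ℤ.+-identityʳ (sum {n} (λ j → F (Inverse.to enum (combine {2} (suc zero) j)))))
          (sum-cong-≗ {n} λ j → cong F (Inverse.strictlyInverseˡ enum (ref j)))))

    private
      i∙b⁻¹ : ∀ i b → i ∙ b ⁻¹ ≡ (i ⁻¹ ∙ b) ⁻¹
      i∙b⁻¹ i b = trans (cong (_∙ b ⁻¹) (sym (⁻¹-involutive i))) (⁻¹-∙-comm (i ⁻¹) b)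

      sum-x-quotient : ∀ b → sum (λ j → x (j ⁻¹ ∙ b)) ≡ + ∣ X ∣
      sum-x-quotient b = trans (sym (sum-quotient b x)) (sum-𝟙≡∣∣ X)

      sum-x-shift : ∀ a → sum (λ j → x (a ∙ j)) ≡ + ∣ X ∣
      sum-x-shift a = trans (sym (sum-shift a x)) (sum-𝟙≡∣∣ X)

      sum-x-/ : ∀ b → sum (λ j → x (j ∙ b ⁻¹)) ≡ + ∣ X ∣
      sum-x-/ b = trans (sum-cong-≗ λ j → cong x (comm j (b ⁻¹))) (sum-x-shift (b ⁻¹))

      sum-x-\\ : ∀ a → sum (λ j → x (a ∙ j ⁻¹)) ≡ + ∣ X ∣
      sum-x-\\ a = trans (sum-cong-≗ λ j → cong x (comm a (j ⁻¹))) (sum-x-quotient a)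

      double : + ∣ X ∣ + + ∣ X ∣ ≡ + (2 ℕ.* ∣ X ∣) * 1ℤ
      double = trans (cong (λ s → + (∣ X ∣ ℕ.+ s)) (sym (ℕ.+-identityʳ ∣ X ∣))) (sym (ℤ.*-identityʳ _))

    J⊗A : J ⊗ A ≋ (2 ℕ.* ∣ X ∣) • J
    J⊗A g h = trans (sum-D (λ v → 1ℤ * A v h)) (trans (cong₂ _+_
        (sum-cong-≗ λ j → trans (ℤ.*-identityˡ (A (rot j) h)) (A≡x (rot j) h))
        (sum-cong-≗ λ j → trans (ℤ.*-identityˡ (A (ref j) h)) (A≡x (ref j) h)))
      (trans (column h) double))
      where
      column : ∀ h → sum (λ j → x (rot j ↦ h)) + sum (λ j → x (ref j ↦ h)) ≡ + ∣ X ∣ + + ∣ X ∣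
      column (rot b) = cong₂ _+_ (sum-x-quotient b) (sum-x-/ b)
      column (ref b) = cong₂ _+_ (sum-x-quotient b) (sum-x-/ b)

    A⊗J : A ⊗ J ≋ (2 ℕ.* ∣ X ∣) • J
    A⊗J g h = trans (sum-D (λ v → A g v * 1ℤ)) (trans (cong₂ _+_
        (sum-cong-≗ λ j → trans (ℤ.*-identityʳ (A g (rot j))) (A≡x g (rot j)))
        (sum-cong-≗ λ j → trans (ℤ.*-identityʳ (A g (ref j))) (A≡x g (ref j))))
      (trans (row g) double))
      where
      row : ∀ g → sum (λ j → x (g ↦ rot j)) + sum (λ j → x (g ↦ ref j)) ≡ + ∣ X ∣ + + ∣ X ∣
      row (rot a) = cong₂ _+_ (sum-x-shift (a ⁻¹)) (sum-x-shift (a ⁻¹))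
      row (ref a) = cong₂ _+_ (sum-x-\\ a) (sum-x-\\ a)

    private
      -- The middle vertex of a walk is `x^i` or `x^i τ`. The two second steps contribute
      -- `x (i⁻¹ b)` and `x (i b⁻¹)`, whose arguments are mutually inverse, so together they form
      -- `u`.
      walks-rot : ∀ a b → sum (λ i → x (a ⁻¹ ∙ i) * x (i ⁻¹ ∙ b)) + sum (λ i → x (a ⁻¹ ∙ i) * x (i ∙ b ⁻¹))
                        ≡ (x ⋆ u) (a ⁻¹ ∙ b)
      walks-rot a b = begin
        sum (λ i → x (a ⁻¹ ∙ i) * x (i ⁻¹ ∙ b)) + sum (λ i → x (a ⁻¹ ∙ i) * x (i ∙ b ⁻¹))
          ≡⟨ ∑-distrib-+ (λ i → x (a ⁻¹ ∙ i) * x (i ⁻¹ ∙ b)) (λ i → x (a ⁻¹ ∙ i) * x (i ∙ b ⁻¹)) ⟨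
        sum (λ i → x (a ⁻¹ ∙ i) * x (i ⁻¹ ∙ b) + x (a ⁻¹ ∙ i) * x (i ∙ b ⁻¹))
          ≡⟨ sum-cong-≗ (λ i → trans (sym (ℤ.*-distribˡ-+ (x (a ⁻¹ ∙ i)) (x (i ⁻¹ ∙ b)) (x (i ∙ b ⁻¹))))
               (cong (λ y → x (a ⁻¹ ∙ i) * (x (i ⁻¹ ∙ b) + x y)) (i∙b⁻¹ i b))) ⟩
        sum (λ i → x (a ⁻¹ ∙ i) * u (i ⁻¹ ∙ b))
          ≡⟨ sum-shift a (λ i → x (a ⁻¹ ∙ i) * u (i ⁻¹ ∙ b)) ⟩
        sum (λ j → x (a ⁻¹ ∙ (a ∙ j)) * u ((a ∙ j) ⁻¹ ∙ b))
          ≡⟨ sum-cong-≗ (λ j → cong₂ (λ y y′ → x y * u y′) (a⁻¹[ab]≡b a j) ([ab]⁻¹c≡b⁻¹[a⁻¹c] a j b)) ⟩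
        (x ⋆ u) (a ⁻¹ ∙ b) ∎
        where open ≡-Reasoning

      -- As for rotations, but the first step now sees `a i⁻¹`; the substitution `i ↦ i⁻¹ a`
      -- together with `u (g⁻¹) = u g` restores the convolution.
      walks-ref : ∀ a b → sum (λ i → x (a ∙ i ⁻¹) * x (i ⁻¹ ∙ b)) + sum (λ i → x (a ∙ i ⁻¹) * x (i ∙ b ⁻¹))
                        ≡ (x ⋆ u) (a ∙ b ⁻¹)
      walks-ref a b = begin
        sum (λ i → x (a ∙ i ⁻¹) * x (i ⁻¹ ∙ b)) + sum (λ i → x (a ∙ i ⁻¹) * x (i ∙ b ⁻¹))
          ≡⟨ ∑-distrib-+ (λ i → x (a ∙ i ⁻¹) * x (i ⁻¹ ∙ b)) (λ i → x (a ∙ i ⁻¹) * x (i ∙ b ⁻¹)) ⟨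
        sum (λ i → x (a ∙ i ⁻¹) * x (i ⁻¹ ∙ b) + x (a ∙ i ⁻¹) * x (i ∙ b ⁻¹))
          ≡⟨ sum-cong-≗ (λ i → trans (sym (ℤ.*-distribˡ-+ (x (a ∙ i ⁻¹)) (x (i ⁻¹ ∙ b)) (x (i ∙ b ⁻¹))))
               (trans (cong (λ y → x (a ∙ i ⁻¹) * (x (i ⁻¹ ∙ b) + x y)) (i∙b⁻¹ i b))
                 (cong₂ (λ y s → x y * s) (comm a (i ⁻¹)) (sym (u-⁻¹ (i ⁻¹ ∙ b)))))) ⟩
        sum (λ i → x (i ⁻¹ ∙ a) * u ((i ⁻¹ ∙ b) ⁻¹))
          ≡⟨ sum-quotient a (λ i → x (i ⁻¹ ∙ a) * u ((i ⁻¹ ∙ b) ⁻¹)) ⟩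
        sum (λ j → x ((j ⁻¹ ∙ a) ⁻¹ ∙ a) * u (((j ⁻¹ ∙ a) ⁻¹ ∙ b) ⁻¹))
          ≡⟨ sum-cong-≗ (λ j → cong₂ (λ y y′ → x y * u y′) ([a⁻¹b]⁻¹b≡a j a)
               (trans (sym (i∙b⁻¹ (j ⁻¹ ∙ a) b)) (assoc (j ⁻¹) a (b ⁻¹)))) ⟩
        (x ⋆ u) (a ∙ b ⁻¹) ∎
        where open ≡-Reasoning

    A⊗A : ∀ g h → (A ⊗ A) g h ≡ (x ⋆ u) (g ↦ h)
    A⊗A g h = trans (sum-D (λ v → A g v * A v h)) (trans (cong₂ _+_
        (sum-cong-≗ λ j → cong₂ _*_ (A≡x g (rot j)) (A≡x (rot j) h))
        (sum-cong-≗ λ j → cong₂ _*_ (A≡x g (ref j)) (A≡x (ref j) h)))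
      (walks g h))
      where
      walks : ∀ g h → sum (λ j → x (g ↦ rot j) * x (rot j ↦ h)) + sum (λ j → x (g ↦ ref j) * x (ref j ↦ h))
                    ≡ (x ⋆ u) (g ↦ h)
      walks (rot a) (rot b) = walks-rot a b
      walks (rot a) (ref b) = walks-rot a b
      walks (ref a) (rot b) = walks-ref a b
      walks (ref a) (ref b) = walks-ref a b

    -- With `t = μ` the identity matrix cancels on the right of the equation for `A²`, which then
    -- depends only on the exponent.
    isDSRG : ∀ {μ lam} → (∀ k → (x ⋆ u) k ≡ + μ - (+ μ - + lam) * x k) → 0 ℕ.< μ → μ ℕ.< 2 ℕ.* ∣ X ∣ →
             IsDSRG (Dih n X X) (2 ℕ.* ∣ X ∣) μ lam μ
    isDSRG {μ} {lam} x⋆u 0<μ μ<k = record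
      { JA  = J⊗A
      ; AJ  = A⊗J
      ; A²  = λ g h → trans (A⊗A g h) (trans (x⋆u (g ↦ h))
                (trans (cong (λ a → + μ - (+ μ - + lam) * a) (sym (A≡x g h))) (regroup (+ μ) (+ lam) (A g h) (I g h))))
      ; 0<t = 0<μ
      ; t<k = μ<k
      }
      where
      regroup : ∀ μ l a i → μ - (μ - l) * a ≡ μ * i + l * a + μ * (1ℤ - i - a)
      regroup = solve-∀

    module _ (e∉X : lookup X e ≡ false) {k μ lam t : ℕ} (dsrg : IsDSRG (Dih n X X) k μ lam t) where
      open IsDSRG dsrg

      private
        e⁻¹∙ : ∀ i → e ⁻¹ ∙ i ≡ i
        e⁻¹∙ i = trans (cong (_∙ i) ε⁻¹≈ε) (identityˡ i)

        x⋆u-at : ∀ h i → exponent (rot (e ⁻¹) Dₙ.∙ h) ≡ e ⁻¹ ∙ i →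
          (x ⋆ u) i ≡ + t * I (rot e) h + + lam * x i + + μ * (1ℤ - I (rot e) h - x i)
        x⋆u-at h i eq = trans (cong (x ⋆ u) (sym rot-e↦h)) (trans (sym (A⊗A (rot e) h)) (trans (A² (rot e) h)
          (cong (λ a → + t * I (rot e) h + + lam * a + + μ * (1ℤ - I (rot e) h - a)) (trans (A≡x (rot e) h) (cong x rot-e↦h)))))
          where
          rot-e↦h : rot e ↦ h ≡ i
          rot-e↦h = trans eq (e⁻¹∙ i)

      -- The columns `ref i` are off the diagonal in row `rot e`, yet their exponents run through
      -- all of `Cₙ`; so the identity matrix drops out.
      equation : ∀ i → (x ⋆ u) i ≡ + μ - (+ μ - + lam) * x i
      equation i = trans (x⋆u-at (ref i) i refl)
        (trans (cong (λ s → + t * s + + lam * x i + + μ * (1ℤ - s - x i)) off-diagonal) (regroup (+ t) (+ lam) (+ μ) (x i)))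
        where
        off-diagonal : I (rot e) (ref i) ≡ 0ℤ
        off-diagonal = cong 𝟙 (dec-false (Inverse.from enum (rot e) Fin.≟ Inverse.from enum (ref i)) λ eq →
          rot≢ref (trans (sym (Inverse.strictlyInverseˡ enum (rot e))) (trans (cong (Inverse.to enum) eq)
            (Inverse.strictlyInverseˡ enum (ref i)))))
          where
          rot≢ref : rot e ≢ ref i
          rot≢ref ()
        regroup : ∀ t l μ a → t * 0ℤ + l * a + μ * (1ℤ - 0ℤ - a) ≡ μ - (μ - l) * a
        regroup = solve-∀

      -- In row `rot e` the columns `rot e` and `ref e` have the same exponent, hence the same
      -- entries of `A` and `A²`. Only the identity matrix distinguishes them.
      t≡μ : t ≡ μ
      t≡μ = ℤ.+-injective (trans (sym at-t) (trans (equation e) at-μ))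
        where
        xe≡0 : x e ≡ 0ℤ
        xe≡0 = cong 𝟙 e∉X
        diagonal : I (rot e) (rot e) ≡ 1ℤ
        diagonal = cong 𝟙 (dec-true (Inverse.from enum (rot e) Fin.≟ Inverse.from enum (rot e)) refl)
        at-t : (x ⋆ u) e ≡ + t
        at-t = trans (x⋆u-at (rot e) e refl)
          (trans (cong₂ (λ s a → + t * s + + lam * a + + μ * (1ℤ - s - a)) diagonal xe≡0) (regroup (+ t) (+ lam) (+ μ)))
          where
          regroup : ∀ t l μ → t * 1ℤ + l * 0ℤ + μ * (1ℤ - 1ℤ - 0ℤ) ≡ t
          regroup = solve-∀
        at-μ : + μ - (+ μ - + lam) * x e ≡ + μ
        at-μ = trans (cong (λ a → + μ - (+ μ - + lam) * a) xe≡0) (regroup (+ μ) (+ lam))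
          where
          regroup : ∀ μ l → μ - (μ - l) * 0ℤ ≡ μ
          regroup = solve-∀

      -- If `u` avoided the value 1, then `x u = 2 x` pointwise and `XU` would have coefficient
      -- `2 ∣ X ∣ = k` at `e`. That coefficient is `μ = t`, contradicting `t < k`.
      asymmetric : k ≡ 2 ℕ.* ∣ X ∣ → ∃[ g ] u g ≡ 1ℤ
      asymmetric k≡2∣X∣ = by-cases (Fin.any? λ g → u g ℤ.≟ 1ℤ)
        where
        by-cases : Dec (∃[ g ] u g ≡ 1ℤ) → ∃[ g ] u g ≡ 1ℤ
        by-cases (yes g)   = g
        by-cases (no none) = contradiction (ℤ.+-injective μ≡k) (ℕ.<⇒≢ (subst (ℕ._< k) t≡μ t<k))
          where
          x·u : ∀ b b′ → 𝟙 b + 𝟙 b′ ≢ 1ℤ → 𝟙 b * (𝟙 b + 𝟙 b′) ≡ 𝟙 b + 𝟙 b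
          x·u false b′    _   = refl
          x·u true  true  _   = refl
          x·u true  false u≢1 = contradiction refl u≢1
          μ≡k : + μ ≡ + k
          μ≡k = begin
            + μ                                  ≡⟨ regroup (+ μ) (+ lam) ⟩
            + μ - (+ μ - + lam) * 0ℤ             ≡⟨ cong (λ a → + μ - (+ μ - + lam) * 𝟙 a) e∉X ⟨
            + μ - (+ μ - + lam) * x e            ≡⟨ equation e ⟨
            sum (λ i → x i * u (i ⁻¹ ∙ e))       ≡⟨ sum-cong-≗ (λ i → trans
                (cong (x i *_) (trans (cong u (identityʳ (i ⁻¹))) (u-⁻¹ i)))
                (x·u (lookup X i) (lookup X (i ⁻¹)) λ u≡1 → none (i , u≡1))) ⟩
            sum (λ i → x i + x i)                ≡⟨ ∑-distrib-+ x x ⟩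
            sum x + sum x                        ≡⟨ cong₂ _+_ (sum-𝟙≡∣∣ X) (sum-𝟙≡∣∣ X) ⟩
            + ∣ X ∣ + + ∣ X ∣                    ≡⟨ trans double (ℤ.*-identityʳ (+ (2 ℕ.* ∣ X ∣))) ⟩
            + (2 ℕ.* ∣ X ∣)                      ≡⟨ cong (λ k → + k) k≡2∣X∣ ⟨
            + k                                  ∎
            where
            open ≡-Reasoning
            regroup : ∀ μ l → μ ≡ μ - (μ - l) * 0ℤ
            regroup = solve-∀

  -- Conditions (a) and (b)

  module Conditions (n : ℕ) .{{_ : NonZero n}} (X : Subset n) where
    open Cyclic n hiding (_⊎_)
    open CyclicProperties n
    open TwoValued n (lookup X) using (u; u-⁻¹)

    private
      x : Fin n → ℤ
      x = 𝟙 ∘ lookup X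

      e⁻¹∙ : ∀ g → e ⁻¹ ∙ g ≡ g
      e⁻¹∙ g = trans (cong (_∙ g) ε⁻¹≈ε) (identityˡ g)

      x-e : e ∉ X → x e ≡ 0ℤ
      x-e e∉X = 𝟙≡0 (lookup X e) λ eq → e∉X (Equivalence.from ∈⇔lookup eq)
        where
        𝟙≡0 : ∀ b → b ≢ true → 𝟙 b ≡ 0ℤ
        𝟙≡0 false _   = refl
        𝟙≡0 true  b≢t = contradiction refl b≢t

      u≡2⇒x≡1 : ∀ g → u g ≡ + 2 → x g ≡ 1ℤ
      u≡2⇒x≡1 g = 𝟙-full (lookup X g) (lookup X (g ⁻¹))
        where
        𝟙-full : ∀ b b′ → 𝟙 b + 𝟙 b′ ≡ + 2 → 𝟙 b ≡ 1ℤ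
        𝟙-full true  b′    _ = refl
        𝟙-full false true  ()
        𝟙-full false false ()

      ℤ-value : ∀ b → + (if b then 1 else 0) ≡ 𝟙 b
      ℤ-value true  = refl
      ℤ-value false = refl

    module _ (w h : ℕ) (n≡hw : n ≡ h ℕ.* w) where
      open Cosets n {w} (ℕ∣.divides h n≡hw)

      coset-e : ∀ g → coset e g ≡ 𝟙 (does (w ∣? toℕ g))
      coset-e g = cong (λ k → 𝟙 (does (w ∣? toℕ k))) (e⁻¹∙ g)

      sum-coset : ∀ z → sum (coset z) ≡ + h
      sum-coset z = trans (sum-cong-≗ λ i → sym (ℤ.*-identityʳ (coset z i)))
        (trans (coset-⋆ {h} n≡hw {λ _ → 1ℤ} (λ _ _ _ → refl) z e) (ℤ.*-identityʳ (+ h)))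

      module _ (invariant : Invariant (lookup X)) where

        private
          x-invariant : Invariant x
          x-invariant g k w∣g = cong 𝟙 (invariant g k w∣g)

        ⋆-complement : ∀ k → ((λ g → 1ℤ - coset e g) ⋆ x) k ≡ sum x - + h * x k
        ⋆-complement k = trans (⋆-distribʳ-+ x (λ _ → 1ℤ) (λ g → - coset e g) k)
          (cong₂ _+_ (trans (⋆-constˡ 1ℤ x k) (ℤ.*-identityˡ (sum x)))
            (trans (⋆-negˡ (coset e) x k) (cong -_ (trans (coset-⋆ {h} n≡hw x-invariant e k) (cong (λ g → + h * x g) (e⁻¹∙ k))))))

        -- In the group ring `U = Cₙ - H`, and `H X = h X` because `X` is a union of cosets of `H`.
        x⋆u-A : (∀ g → u g ≡ 1ℤ - coset e g) → ∀ k → (x ⋆ u) k ≡ sum x - + h * x k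
        x⋆u-A profile k = trans (⋆-comm x u k) (trans (⋆-cong {g = x} profile (λ _ → refl) k) (⋆-complement k))

        -- Here `U = Cₙ - H + zH`, and the additional product `zH X` equals `h · zX`.
        x⋆u-B : ∀ z → (∀ g → u g ≡ (1ℤ - coset e g) + coset z g) →
                ∀ k → (x ⋆ u) k ≡ (sum x - + h * x k) + + h * x (z ⁻¹ ∙ k)
        x⋆u-B z profile k = trans (⋆-comm x u k) (trans (⋆-cong {g = x} profile (λ _ → refl) k)
          (trans (⋆-distribʳ-+ x (λ g → 1ℤ - coset e g) (coset z) k)
            (cong₂ _+_ (⋆-complement k) (coset-⋆ {h} n≡hw x-invariant z k))))

    private
      complement-A : ∀ b b′ {P : Set} (P? : Dec P) → (𝟙 b + 𝟙 b′ ≡ 0ℤ ⇔ P) → b ∨ b′ ≡ not (does P?)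
      complement-A false false P? u≡0⇔P = cong not (sym (dec-true P? (Equivalence.to u≡0⇔P refl)))
      complement-A false true  P? u≡0⇔P = cong not (sym (dec-false P? λ p → contradiction (Equivalence.from u≡0⇔P p) λ ()))
      complement-A true  false P? u≡0⇔P = cong not (sym (dec-false P? λ p → contradiction (Equivalence.from u≡0⇔P p) λ ()))
      complement-A true  true  P? u≡0⇔P = cong not (sym (dec-false P? λ p → contradiction (Equivalence.from u≡0⇔P p) λ ()))

      disjoint-A : ∀ b b′ → 𝟙 b + 𝟙 b′ ≢ + 2 → b ∧ b′ ≡ false
      disjoint-A false b′    _   = refl
      disjoint-A true  false _   = refl
      disjoint-A true  true  u≢2 = contradiction refl u≢2

      profile-A : ∀ b b′ c → b ∨ b′ ≡ not c → b ∧ b′ ≡ false → 𝟙 b + 𝟙 b′ ≡ 1ℤ - 𝟙 c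
      profile-A false false true  _ _ = refl
      profile-A false true  false _ _ = refl
      profile-A true  false false _ _ = refl

      profile-B : ∀ b b′ {P Q : Set} (P? : Dec P) (Q? : Dec Q) →
        (𝟙 b + 𝟙 b′ ≡ 0ℤ ⇔ P) → (𝟙 b + 𝟙 b′ ≡ + 2 ⇔ Q) → 𝟙 b + 𝟙 b′ ≡ (1ℤ - 𝟙 (does P?)) + 𝟙 (does Q?)
      profile-B b b′ (yes p) (yes q) P⇔ Q⇔ = contradiction
        (trans (sym (Equivalence.from P⇔ p)) (Equivalence.from Q⇔ q)) λ ()
      profile-B b b′ (yes p) (no _)  P⇔ Q⇔ = Equivalence.from P⇔ p
      profile-B b b′ (no _)  (yes q) P⇔ Q⇔ = Equivalence.from Q⇔ q
      profile-B b b′ (no ¬p) (no ¬q) P⇔ Q⇔ with 𝟙+𝟙-cases b b′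
      ... | inj₁ u≡0        = contradiction (Equivalence.to P⇔ u≡0) ¬p
      ... | inj₂ (inj₁ u≡1) = u≡1
      ... | inj₂ (inj₂ u≡2) = contradiction (Equivalence.to Q⇔ u≡2) ¬q

      1-𝟙 : ∀ c → 1ℤ - 𝟙 c ≡ 𝟙 (not c)
      1-𝟙 true  = refl
      1-𝟙 false = refl

    conditionA : ∀ {m h} → n ≡ h ℕ.* m → e ∉ X → (∀ g k → m ∣ toℕ g → lookup X (g ∙ k) ≡ lookup X k) →
      (∀ g → u g ≡ 0ℤ ⇔ m ∣ toℕ g) → (∀ g → u g ≢ + 2) → ConditionA n X m
    conditionA {m} {h} n≡hm e∉X invariant u≡0⇔ u≢2 = record
      { T        = transversal X
      ; T⊆       = transversal⊆ X e∉X
      ; i        = transversal-covers X invariant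
      ; ii       = lookup-ext λ g → begin
          lookup (X ∪ X ⁽⁻¹⁾) g             ≡⟨ lookup-∪ X (X ⁽⁻¹⁾) g ⟩
          lookup X g ∨ lookup (X ⁽⁻¹⁾) g    ≡⟨ cong (lookup X g ∨_) (lookup-⁻¹ X g) ⟩
          lookup X g ∨ lookup X (g ⁻¹)      ≡⟨ complement-A (lookup X g) (lookup X (g ⁻¹)) (m ∣? toℕ g) (u≡0⇔ g) ⟩
          not (does (m ∣? toℕ g))           ≡⟨ cong not (lookup-⟨x^⟩ g) ⟨
          not (lookup ⟨x^ m ⟩ g)            ≡⟨ lookup-full─ ⟨x^ m ⟩ g ⟨
          lookup (full ─ ⟨x^ m ⟩) g         ∎
      ; disjoint = lookup-ext λ g → begin
          lookup (X ∩ X ⁽⁻¹⁾) g             ≡⟨ lookup-∩ X (X ⁽⁻¹⁾) g ⟩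
          lookup X g ∧ lookup (X ⁽⁻¹⁾) g    ≡⟨ cong (lookup X g ∧_) (lookup-⁻¹ X g) ⟩
          lookup X g ∧ lookup X (g ⁻¹)      ≡⟨ disjoint-A (lookup X g) (lookup X (g ⁻¹)) (u≢2 g) ⟩
          false                             ≡⟨ lookup-replicate g false ⟨
          lookup ∅ g                        ∎
      }
      where
      open ≡-Reasoning
      open Cosets n {m} (ℕ∣.divides h n≡hm)

    conditionB : ∀ {r h} → n ≡ h ℕ.* (2 ℕ.* r) → e ∉ X →
      (∀ g k → 2 ℕ.* r ∣ toℕ g → lookup X (g ∙ k) ≡ lookup X k) →
      (∀ g → u g ≡ 0ℤ ⇔ 2 ℕ.* r ∣ toℕ g) → u (x^ r) ≡ + 2 →
      (∀ g → u g ≡ + 2 → 2 ℕ.* r ∣ toℕ ((x^ r) ⁻¹ ∙ g)) →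
      ∀ {μ} → (∀ k → (x ⋆ u) k ≡ μ - + 2 * + h * x k) → ConditionB n X r
    conditionB {r} {h} n≡hw e∉X invariant u≡0⇔ u-z u≡2⇒ {μ} x⋆u = record
      { 2v∣n = w∣n
      ; T′   = transversal X
      ; T′⊆  = transversal⊆ X e∉X
      ; i    = transversal-covers X invariant
      ; ii   = λ g → ℤ.+-injective (begin
          + (⟦ X ⟧ g ℕ.+ ⟦ X ⁽⁻¹⁾ ⟧ g)
            ≡⟨ cong₂ _+_ (ℤ-value (lookup X g)) (trans (ℤ-value (lookup (X ⁽⁻¹⁾) g)) (cong 𝟙 (lookup-⁻¹ X g))) ⟩
          u g
            ≡⟨ profile g ⟩
          (1ℤ - coset e g) + coset z g
            ≡⟨ cong₂ _+_ (complement g) (in-coset g) ⟩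
          𝟙 (lookup (full ─ ⟨x^ w ⟩) g) + 𝟙 (lookup (z · ⟨x^ w ⟩) g)
            ≡⟨ cong₂ _+_ (ℤ-value (lookup (full ─ ⟨x^ w ⟩) g)) (ℤ-value (lookup (z · ⟨x^ w ⟩) g)) ⟨
          + (⟦ full ─ ⟨x^ w ⟩ ⟧ g ℕ.+ ⟦ z · ⟨x^ w ⟩ ⟧ g) ∎)
      ; iii  = lookup-ext λ g → trans (lookup-∪ X (z · X) g) (trans (cong (lookup X g ∨_) (lookup-translate z X g))
          (trans (∨≡true (lookup X g) (lookup X (z ⁻¹ ∙ g)) (partition g)) (sym (lookup-replicate g true))))
      }
      where
      open ≡-Reasoning
      w = 2 ℕ.* r
      z = x^ r
      w∣n : w ∣ n
      w∣n = ℕ∣.divides h n≡hw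
      open Cosets n {w} w∣n
      u-invariant : ∀ g k → w ∣ toℕ g → u (g ∙ k) ≡ u k
      u-invariant g k w∣g = cong₂ (λ b b′ → 𝟙 b + 𝟙 b′) (invariant g k w∣g)
        (trans (cong (lookup X) (sym (⁻¹-∙-comm g k))) (invariant (g ⁻¹) (k ⁻¹) w∣g⁻¹))
        where
        w∣g⁻¹ : w ∣ toℕ (g ⁻¹)
        w∣g⁻¹ = Equivalence.to (∣∙⇔∣ w∣g (g ⁻¹)) (subst (λ k → w ∣ toℕ k) (sym (inverseʳ g))
          (Equivalence.from (∣x^⇔∣ 0) (w ℕ∣.∣0)))
      u≡2⇔ : ∀ g → u g ≡ + 2 ⇔ w ∣ toℕ (z ⁻¹ ∙ g)
      u≡2⇔ g = mk⇔ (u≡2⇒ g) λ w∣ → trans (cong u (sym (trans (comm (z ⁻¹ ∙ g) z) (a[a⁻¹b]≡b z g))))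
        (trans (u-invariant (z ⁻¹ ∙ g) z w∣) u-z)
      profile : ∀ g → u g ≡ (1ℤ - coset e g) + coset z g
      profile g = trans (profile-B (lookup X g) (lookup X (g ⁻¹)) (w ∣? toℕ g) (w ∣? toℕ (z ⁻¹ ∙ g)) (u≡0⇔ g) (u≡2⇔ g))
        (cong (λ s → (1ℤ - s) + coset z g) (sym (coset-e w h n≡hw g)))
      complement : ∀ g → 1ℤ - coset e g ≡ 𝟙 (lookup (full ─ ⟨x^ w ⟩) g)
      complement g = trans (cong (λ s → 1ℤ - s) (coset-e w h n≡hw g)) (trans (1-𝟙 (does (w ∣? toℕ g)))
        (cong 𝟙 (trans (cong not (sym (lookup-⟨x^⟩ g))) (sym (lookup-full─ ⟨x^ w ⟩ g)))))
      in-coset : ∀ g → coset z g ≡ 𝟙 (lookup (z · ⟨x^ w ⟩) g)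
      in-coset g = cong 𝟙 (trans (sym (lookup-⟨x^⟩ (z ⁻¹ ∙ g))) (sym (lookup-translate z ⟨x^ w ⟩ g)))
      -- Two expressions for `XU` are compared, the one from the profile of `u` and the given one;
      -- what remains is that `h (X + zX)` is constant.
      h·partition : ∀ k → + h * (x k + x (z ⁻¹ ∙ k)) ≡ μ - sum x
      h·partition k = trans (split (+ h) (x k) (x (z ⁻¹ ∙ k)) (sum x))
        (trans (cong (λ s → s + + 2 * + h * x k - sum x) (trans (sym (x⋆u-B w h n≡hw invariant z profile k)) (x⋆u k)))
          (cancel μ (+ 2 * + h * x k) (sum x)))
        where
        split : ∀ h a b s → h * (a + b) ≡ (s - h * a) + h * b + + 2 * h * a - s
        split = solve-∀
        cancel : ∀ μ t s → μ - t + t - s ≡ μ - s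
        cancel = solve-∀
      -- The constant is read off at `k = z`: `u z = 2` puts `z` into `X`, and `z⁻¹ z = e` is
      -- outside `X`.
      partition : ∀ k → x k + x (z ⁻¹ ∙ k) ≡ 1ℤ
      partition k = ℤ.*-cancelˡ-≡ (+ h) (x k + x (z ⁻¹ ∙ k)) 1ℤ {{h≢0}} (trans (h·partition k) (trans (sym (h·partition z))
        (cong (+ h *_) (cong₂ _+_ (u≡2⇒x≡1 z u-z) (trans (cong x (inverseˡ z)) (x-e e∉X))))))
        where
        h≢0 : ℤ.NonZero (+ h)
        h≢0 = ℕ.≢-nonZero λ h≡0 → ℕ.≢-nonZero⁻¹ n (trans n≡hw (cong (ℕ._* w) h≡0))
      ∨≡true : ∀ b b′ → 𝟙 b + 𝟙 b′ ≡ 1ℤ → b ∨ b′ ≡ true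
      ∨≡true true  b′   _ = refl
      ∨≡true false true _ = refl

    -- In case (a) `v` is the index `m` of `H`; in case (b) it is `m / 2`, because there `d` is
    -- `2 h` instead of `h`. Both make `v d = n`.
    conditions : e ∉ X → ∀ {μ d} → (∀ k → (x ⋆ u) k ≡ μ - d * x k) → Structure n (lookup X) d →
      ∃[ v ] (+ v * d ≡ + n × 1 ℕ.< v × (ConditionA n X v ⊎ ConditionB n X v))
    conditions e∉X {μ} {d} x⋆u s = cases values
      where
      open Structure s
      cases : _ → ∃[ v ] (+ v * d ≡ + n × 1 ℕ.< v × (ConditionA n X v ⊎ ConditionB n X v))
      cases (inj₁ (d≡h , u≢2)) = m ,
        trans (cong (+ m *_) d≡h) (trans (sym (ℤ.pos-* m h)) (cong (λ k → + k) (trans (ℕ.*-comm m h) (sym n≡hm)))) ,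
        1<m , inj₁ (conditionA {m} {h} n≡hm e∉X invariant u≡0⇔ u≢2)
      cases (inj₂ (d≡2h , r , 1<r , m≡2r , u-z , u≡2⇒)) = r ,
        trans (cong (+ r *_) d≡2h) (trans (regroup (+ r) (+ h)) (trans (cong (+ h *_) (sym (ℤ.pos-* 2 r)))
          (trans (sym (ℤ.pos-* h (2 ℕ.* r))) (cong (λ k → + k) (trans (cong (h ℕ.*_) (sym m≡2r)) (sym n≡hm)))))) ,
        1<r , inj₂ (conditionB {r} {h} (trans n≡hm (cong (h ℕ.*_) m≡2r)) e∉X
          (λ g k w∣g → invariant g k (subst (_∣ toℕ g) (sym m≡2r) w∣g))
          (λ g → subst (λ m → u g ≡ 0ℤ ⇔ m ∣ toℕ g) m≡2r (u≡0⇔ g)) u-z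
          (λ g ug → subst (_∣ toℕ ((x^ r) ⁻¹ ∙ g)) m≡2r (u≡2⇒ g ug))
          {μ} (λ k → trans (x⋆u k) (cong (λ d → μ - d * x k) d≡2h)))
        where
        regroup : ∀ r h → r * (+ 2 * h) ≡ h * (+ 2 * r)
        regroup = solve-∀

    -- What being a DSRG amounts to once `t = μ`; the last two bounds express genuineness with
    -- `k = 2 ∣ X ∣`.
    Equation : ℤ → ℕ → ℕ → Set
    Equation d μ lam = + μ - + lam ≡ d × (∀ k → (x ⋆ u) k ≡ + μ - (+ μ - + lam) * x k) × 0 ℕ.< μ × μ ℕ.< 2 ℕ.* ∣ X ∣

    private
      sum-x : sum x ≡ + ∣ X ∣
      sum-x = sum-𝟙≡∣∣ X

      sum-u : sum u ≡ + (2 ℕ.* ∣ X ∣)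
      sum-u = trans (∑-distrib-+ x (λ i → x (i ⁻¹))) (trans (cong (λ s → sum x + s) (sym (sum-inverse x)))
        (trans (cong₂ _+_ sum-x sum-x) (cong (λ k → + (∣ X ∣ ℕ.+ k)) (sym (ℕ.+-identityʳ ∣ X ∣)))))

    -- `XU = X (Cₙ - H) = ∣ X ∣ Cₙ - h X` dictates `μ = ∣ X ∣` and `λ = ∣ X ∣ - h`.
    equationA : ∀ {v d} → + v * d ≡ + n → 1 ℕ.< v → ConditionA n X v → ∃[ μ ] ∃[ lam ] Equation d μ lam
    equationA {v} {d} vd≡n 1<v cond = ∣ X ∣ , ∣ X ∣ ℕ.∸ h , trans μ-lam≡h (sym d≡h) ,
        (λ k → trans (x⋆u-A v h n≡hv invariant profile k)
          (cong₂ (λ s t → s - t * x k) sum-x (sym μ-lam≡h))) ,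
        0<∣X∣ , ℕ.m<m+n ∣ X ∣ (subst (0 ℕ.<_) (sym (ℕ.+-identityʳ ∣ X ∣)) 0<∣X∣)
      where
      open ConditionA cond
      v∣n : v ∣ n
      v∣n = ℤ∣.∣⇒∣ᵤ {+ v} {+ n} (divides d (trans (sym vd≡n) (ℤ.*-comm (+ v) d)))
      h = ℕ∣.quotient v∣n
      n≡hv : n ≡ h ℕ.* v
      n≡hv = ℕ∣.m∣n⇒n≡quotient*m v∣n
      open Cosets n {v} v∣n
      d≡h : d ≡ + h
      d≡h = ℤ.*-cancelˡ-≡ (+ v) d (+ h) {{ℕ.>-nonZero (ℕ.<-trans (ℕ.s≤s ℕ.z≤n) 1<v)}}
        (trans vd≡n (trans (cong (λ k → + k) (trans n≡hv (ℕ.*-comm h v))) (ℤ.pos-* v h)))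
      invariant : Invariant (lookup X)
      invariant = subst (λ X → Invariant (lookup X)) (sym i) (·⟨x^⟩-invariant T)
      profile′ : ∀ g → u g ≡ 1ℤ - 𝟙 (does (v ∣? toℕ g))
      profile′ g = profile-A (lookup X g) (lookup X (g ⁻¹)) (does (v ∣? toℕ g))
        (trans (cong (lookup X g ∨_) (sym (lookup-⁻¹ X g))) (trans (sym (lookup-∪ X (X ⁽⁻¹⁾) g))
          (trans (cong (λ Y → lookup Y g) ii) (trans (lookup-full─ ⟨x^ v ⟩ g) (cong not (lookup-⟨x^⟩ g))))))
        (trans (cong (lookup X g ∧_) (sym (lookup-⁻¹ X g))) (trans (sym (lookup-∩ X (X ⁽⁻¹⁾) g))
          (trans (cong (λ Y → lookup Y g) disjoint) (lookup-replicate g false))))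
      profile : ∀ g → u g ≡ 1ℤ - coset e g
      profile g = trans (profile′ g) (cong (λ s → 1ℤ - s) (sym (coset-e v h n≡hv g)))
      -- As `1 < v`, the generator lies outside `⟨x^v⟩`, so `u` is 1 there and either it or its
      -- inverse belongs to `X`.
      member : ∃[ g ] lookup X g ≡ true
      member = choose (lookup X (x^ 1)) (lookup X ((x^ 1) ⁻¹)) refl refl (trans (profile′ (x^ 1))
          (cong (λ c → 1ℤ - 𝟙 c) (dec-false (v ∣? toℕ (x^ 1)) λ v∣x → ℕ∣.>⇒∤ 1<v (Equivalence.to (∣x^⇔∣ 1) v∣x))))
        where
        choose : ∀ b b′ → lookup X (x^ 1) ≡ b → lookup X ((x^ 1) ⁻¹) ≡ b′ → 𝟙 b + 𝟙 b′ ≡ 1ℤ → ∃[ g ] lookup X g ≡ true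
        choose true  b′   eq _  _ = x^ 1 , eq
        choose false true _  eq _ = (x^ 1) ⁻¹ , eq
      -- `X` contains the whole coset of its member, so the truncated subtraction defining `λ` is a
      -- true one.
      h≤∣X∣ : h ℕ.≤ ∣ X ∣
      h≤∣X∣ = ℤ.drop‿+≤+ (subst₂ ℤ._≤_ (sum-coset v h n≡hv g) sum-x (sum-mono-≤ coset≤x))
        where
        g = proj₁ member
        coset≤x : ∀ k → coset g k ℤ.≤ x k
        coset≤x k = by-cases (v ∣? toℕ (g ⁻¹ ∙ k))
          where
          by-cases : (v∣? : Dec (v ∣ toℕ (g ⁻¹ ∙ k))) → 𝟙 (does v∣?) ℤ.≤ x k
          by-cases (no _)   = 𝟙≥0 (lookup X k)
          by-cases (yes v∣) = ℤ.≤-reflexive (cong 𝟙 (sym (trans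
            (cong (lookup X) (sym (trans (comm (g ⁻¹ ∙ k) g) (a[a⁻¹b]≡b g k))))
            (trans (invariant (g ⁻¹ ∙ k) g v∣) (proj₂ member)))))
      0<∣X∣ : 0 ℕ.< ∣ X ∣
      0<∣X∣ = ℕ.<-≤-trans (ℕ.n≢0⇒n>0 λ h≡0 → ℕ.≢-nonZero⁻¹ n (trans n≡hv (cong (ℕ._* v) h≡0))) h≤∣X∣
      μ-lam≡h : + ∣ X ∣ - + (∣ X ∣ ℕ.∸ h) ≡ + h
      μ-lam≡h = trans (cong (λ s → s - + (∣ X ∣ ℕ.∸ h)) (cong (λ k → + k) (sym (ℕ.m+[n∸m]≡n h≤∣X∣))))
        (cancel (+ h) (+ (∣ X ∣ ℕ.∸ h)))
        where
        cancel : ∀ h l → h + l - l ≡ h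
        cancel = solve-∀

    -- `XU = ∣ X ∣ Cₙ - h X + h zX`, and `zX = Cₙ - X` turns this into `(∣ X ∣ + h) Cₙ - 2 h X`,
    -- which dictates `μ = ∣ X ∣ + h` and `λ = ∣ X ∣ - h`.
    equationB : ∀ {v d} → + v * d ≡ + n → 1 ℕ.< v → ConditionB n X v → ∃[ μ ] ∃[ lam ] Equation d μ lam
    equationB {v} {d} vd≡n 1<v cond = ∣ X ∣ ℕ.+ h , ∣ X ∣ ℕ.∸ h , trans μ-lam≡2h (sym d≡2h) ,
        (λ k → trans (x⋆u-B w h n≡hw invariant z profile k)
          (trans (cong (λ s → (sum x - + h * x k) + + h * s) (complement-x k))
            (trans (regroup (sum x) (+ h) (x k)) (cong₂ (λ s t → s + + h - t * x k) sum-x (sym μ-lam≡2h))))) ,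
        ℕ.<-≤-trans 0<h (ℕ.m≤n+m h ∣ X ∣) ,
        ℕ.+-monoʳ-< ∣ X ∣ (subst (h ℕ.<_) (sym (ℕ.+-identityʳ ∣ X ∣)) h<∣X∣)
      where
      open ConditionB cond
      w = 2 ℕ.* v
      z = x^ v
      h = ℕ∣.quotient 2v∣n
      n≡hw : n ≡ h ℕ.* w
      n≡hw = ℕ∣.m∣n⇒n≡quotient*m 2v∣n
      open Cosets n {w} 2v∣n
      regroup : ∀ s h a → (s - h * a) + h * (1ℤ - a) ≡ s + h - + 2 * h * a
      regroup = solve-∀
      0<h : 0 ℕ.< h
      0<h = ℕ.n≢0⇒n>0 λ h≡0 → ℕ.≢-nonZero⁻¹ n (trans n≡hw (cong (ℕ._* w) h≡0))
      n≡v2h : + n ≡ + v * (+ 2 * + h)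
      n≡v2h = trans (cong (λ k → + k) n≡hw) (trans (ℤ.pos-* h w) (trans (cong (+ h *_) (ℤ.pos-* 2 v)) (rearrange (+ h) (+ v))))
        where
        rearrange : ∀ h v → h * (+ 2 * v) ≡ v * (+ 2 * h)
        rearrange = solve-∀
      d≡2h : d ≡ + 2 * + h
      d≡2h = ℤ.*-cancelˡ-≡ (+ v) d (+ 2 * + h) {{ℕ.>-nonZero (ℕ.<-trans (ℕ.s≤s ℕ.z≤n) 1<v)}} (trans vd≡n n≡v2h)
      invariant : Invariant (lookup X)
      invariant = subst (λ X → Invariant (lookup X)) (sym i) (·⟨x^⟩-invariant T′)
      profile : ∀ g → u g ≡ (1ℤ - coset e g) + coset z g
      profile g = begin
        u g
          ≡⟨ cong₂ _+_ (ℤ-value (lookup X g)) (trans (ℤ-value (lookup (X ⁽⁻¹⁾) g)) (cong 𝟙 (lookup-⁻¹ X g))) ⟨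
        + (⟦ X ⟧ g ℕ.+ ⟦ X ⁽⁻¹⁾ ⟧ g)
          ≡⟨ cong (λ k → + k) (ii g) ⟩
        + (⟦ full ─ ⟨x^ w ⟩ ⟧ g ℕ.+ ⟦ z · ⟨x^ w ⟩ ⟧ g)
          ≡⟨ cong₂ _+_ (ℤ-value (lookup (full ─ ⟨x^ w ⟩) g)) (ℤ-value (lookup (z · ⟨x^ w ⟩) g)) ⟩
        𝟙 (lookup (full ─ ⟨x^ w ⟩) g) + 𝟙 (lookup (z · ⟨x^ w ⟩) g)
          ≡⟨ cong₂ _+_ (cong 𝟙 (trans (lookup-full─ ⟨x^ w ⟩ g) (cong not (lookup-⟨x^⟩ g))))
               (cong 𝟙 (trans (lookup-translate z ⟨x^ w ⟩ g) (lookup-⟨x^⟩ (z ⁻¹ ∙ g)))) ⟩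
        𝟙 (not (does (w ∣? toℕ g))) + coset z g
          ≡⟨ cong (λ s → s + coset z g) (trans (sym (1-𝟙 (does (w ∣? toℕ g)))) (cong (λ s → 1ℤ - s) (sym (coset-e w h n≡hw g)))) ⟩
        (1ℤ - coset e g) + coset z g ∎
        where open ≡-Reasoning
      sum-u≡n : sum u ≡ + n
      sum-u≡n = begin
        sum u                                                     ≡⟨ sum-cong-≗ profile ⟩
        sum (λ g → (1ℤ - coset e g) + coset z g)                  ≡⟨ ∑-distrib-+ (λ g → 1ℤ - coset e g) (coset z) ⟩
        sum (λ g → 1ℤ - coset e g) + sum (coset z)                ≡⟨ cong (λ s → s + sum (coset z)) (sum-∸ (λ _ → 1ℤ) (coset e)) ⟩
        sum {n} (λ _ → 1ℤ) - sum (coset e) + sum (coset z)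
          ≡⟨ cong₂ _+_ (cong₂ _-_ (trans (sum-const n 1ℤ) (ℤ.*-identityʳ (+ n)))
               (sum-coset w h n≡hw e)) (sum-coset w h n≡hw z) ⟩
        + n - + h + + h                                           ≡⟨ cancel (+ n) (+ h) ⟩
        + n                                                       ∎
        where
        open ≡-Reasoning
        cancel : ∀ n h → n - h + h ≡ n
        cancel = solve-∀
      2∣X∣≡n : 2 ℕ.* ∣ X ∣ ≡ n
      2∣X∣≡n = ℤ.+-injective (trans (sym sum-u) sum-u≡n)
      -- From `2 ∣ X ∣ = n = 2 h v` follows `∣ X ∣ = h v`, so `1 < v` makes the bound strict. It
      -- yields `μ < k` and keeps the subtraction in `λ` from truncating.
      h<∣X∣ : h ℕ.< ∣ X ∣
      h<∣X∣ = subst (h ℕ.<_) (sym (ℕ.*-cancelˡ-≡ ∣ X ∣ (h ℕ.* v) 2 (trans 2∣X∣≡n (trans n≡hw (rearrange h v)))))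
        (ℕ.m<m*n h v {{ℕ.>-nonZero 0<h}} 1<v)
        where
        rearrange : ∀ h v → h ℕ.* (2 ℕ.* v) ≡ 2 ℕ.* (h ℕ.* v)
        rearrange h v = trans (sym (ℕ.*-assoc h 2 v)) (trans (cong (ℕ._* v) (ℕ.*-comm h 2)) (ℕ.*-assoc 2 h v))
      μ-lam≡2h : + (∣ X ∣ ℕ.+ h) - + (∣ X ∣ ℕ.∸ h) ≡ + 2 * + h
      μ-lam≡2h = trans (cong (λ k → + (k ℕ.+ h) - + (∣ X ∣ ℕ.∸ h)) (sym (ℕ.m+[n∸m]≡n (ℕ.<⇒≤ h<∣X∣))))
        (cancel (+ h) (+ (∣ X ∣ ℕ.∸ h)))
        where
        cancel : ∀ h l → h + l + h - l ≡ + 2 * h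
        cancel = solve-∀
      -- X and xᵛ X cover Cₙ and each has n / 2 elements, hence they are disjoint.
      excess : Fin n → ℤ
      excess k = x k + x (z ⁻¹ ∙ k) - 1ℤ
      excess≥0 : ∀ k → 0ℤ ℤ.≤ excess k
      excess≥0 k = covered (lookup X k) (lookup X (z ⁻¹ ∙ k))
        (trans (cong (lookup X k ∨_) (sym (lookup-translate z X k))) (trans (sym (lookup-∪ X (z · X) k))
          (trans (cong (λ Y → lookup Y k) iii) (lookup-replicate k true))))
        where
        covered : ∀ b b′ → b ∨ b′ ≡ true → 0ℤ ℤ.≤ 𝟙 b + 𝟙 b′ - 1ℤ
        covered true  true  _ = ℤ.+≤+ ℕ.z≤n
        covered true  false _ = ℤ.+≤+ ℕ.z≤n
        covered false true  _ = ℤ.+≤+ ℕ.z≤n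
      sum-excess : sum excess ≡ 0ℤ
      sum-excess = trans (sum-∸ (λ k → x k + x (z ⁻¹ ∙ k)) (λ _ → 1ℤ))
        (ℤ.i≡j⇒i-j≡0 (trans (∑-distrib-+ x (λ k → x (z ⁻¹ ∙ k)))
          (trans (cong (λ s → sum x + s) (trans (sym (sum-shift (z ⁻¹) x)) (sum-inverse x)))
          (trans (sym (∑-distrib-+ x (λ i → x (i ⁻¹))))
          (trans sum-u≡n (sym (trans (sum-const n 1ℤ) (ℤ.*-identityʳ (+ n)))))))))
      excess≡0 : ∀ k → excess k ≡ 0ℤ
      excess≡0 k = ℤ.≤-antisym (subst₂ ℤ._≤_ (ℤ.+-identityʳ (excess k)) sum-excess
        (sumOver-≤ {f = excess} {k ∷ []} ([] ∷ []) excess≥0)) (excess≥0 k)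
      complement-x : ∀ k → x (z ⁻¹ ∙ k) ≡ 1ℤ - x k
      complement-x k = trans (solve-for (x k) (x (z ⁻¹ ∙ k))) (trans (cong (λ s → s + (1ℤ - x k)) (excess≡0 k)) (ℤ.+-identityˡ (1ℤ - x k)))
        where
        solve-for : ∀ a b → b ≡ (a + b - 1ℤ) + (1ℤ - a)
        solve-for = solve-∀

  -- The equivalence for a fixed value of `μ - λ`

  module Main (n : ℕ) .{{_ : NonZero n}} (X : Subset n) (e∉X : Cyclic.e n ∉ X) (d : ℤ) where
    open DihedrantMatrix n X
    open Conditions n X

    lookup-e : lookup X (Cyclic.e n) ≡ false
    lookup-e = Bool-ext (λ eq → contradiction (Equivalence.from ∈⇔lookup eq) e∉X) λ ()

    -- Both sides share the integer `d = μ - λ`, so that `v = n / (μ - λ)` becomes the division-free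
    -- equation `v d = n`.
    DSRG Condition : Set
    DSRG      = ∃[ μ ] ∃[ lam ] ∃[ t ] (+ μ - + lam ≡ d × IsDSRG (Dih n X X) (2 ℕ.* ∣ X ∣) μ lam t)
    Condition = ∃[ v ] (+ v * d ≡ + n × 1 ℕ.< v × (ConditionA n X v ⊎ ConditionB n X v))

    necessary : DSRG → Condition
    necessary (μ , lam , t , μ-lam≡d , dsrg) = conditions e∉X {+ μ} {d} x⋆u≡
      (structure n (lookup X) lookup-e {+ μ} {d} x⋆u≡ (proj₁ g₀) (proj₂ g₀))
      where
      x⋆u≡ = λ k → trans (equation lookup-e dsrg k) (cong (λ d → + μ - d * x k) μ-lam≡d)
      g₀ = asymmetric lookup-e dsrg refl

    fromEquation : ∃[ μ ] ∃[ lam ] Equation d μ lam → DSRG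
    fromEquation (μ , lam , μ-lam≡d , x⋆u≡ , 0<μ , μ<k) = μ , lam , μ , μ-lam≡d , isDSRG x⋆u≡ 0<μ μ<k

    sufficient : Condition → DSRG
    sufficient (v , vd≡n , 1<v , inj₁ a) = fromEquation (equationA vd≡n 1<v a)
    sufficient (v , vd≡n , 1<v , inj₂ b) = fromEquation (equationB vd≡n 1<v b)

open import Defs
open import Data.Fin.Subset using (Subset; _∉_; ∣_∣)
open import Data.Integer.Base using (ℤ; +_) renaming (_*_ to _*ℤ_; _-_ to _-ℤ_)
open import Data.Nat.Base using (ℕ; NonZero; _≤_; _<_; _*_)
open import Data.Product.Base using (∃-syntax; _×_)
open import Data.Sum.Base using (_⊎_)
open import Function.Bundles using (_⇔_; mk⇔)
open import Relation.Binary.PropositionalEquality using (_≡_)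

theorem1p4 : (n : ℕ) .{{_ : NonZero n}} → 3 ≤ n →
    (X : Subset n) → Cyclic.e n ∉ X →
    (d : ℤ) →
    (∃[ μ ] ∃[ lam ] ∃[ t ] (+ μ -ℤ + lam ≡ d × IsDSRG (Dih n X X) (2 * ∣ X ∣) μ lam t))
    ⇔
    (∃[ v ] (+ v *ℤ d ≡ + n × 1 < v × (ConditionA n X v ⊎ ConditionB n X v)))
theorem1p4 n 3≤n X e∉X d = mk⇔ necessary sufficient
  where open Development.Main n X e∉X d
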